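{- Suppose $\prec$ is a binary relation on $\mathbb{N}^n$ definable in $(\mathbb{N},+)$ such that $(\mathbb{N}^n,\prec)$ is a linear order of order type $\mathbb{N}$ (that of $(\mathbb{N},<)$). Then the order isomorphism between $(\mathbb{N}^n,\prec)$ and $(\mathbb{N},<)$ is a piecewise polynomial function of degree $\le n$.
   Context: Definable means first-order definable in $(\mathbb{N},+)$ without parameters. For $\bar c,\bar p_1,\dots,\bar p_k\in\mathbb{Z}^n$ with $\bar p_1,\dots,\bar p_k$ linearly independent, $\{\bar c+\sum_i k_i\bar p_i\mid k_i\in\mathbb{N}\}$ is a fundamental lattice. A function $f:\mathbb{N}^n\to\mathbb{N}$ is piecewise polynomial of degree $\le d$ if $\mathbb{N}^n$ can be decomposed into finitely many disjoint fundamental lattices $C_1,\dots,C_k$ such that the restriction of $f$ to each $C_j$ is a polynomial with rational coefficients of degree $\le d$. -}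

module Defs where

open import Data.Nat as ℕ using (ℕ; zero; suc)
open import Data.Fin using (Fin; zero; suc)
open import Data.Integer as ℤ using (ℤ; +_)
open import Data.Rational as ℚ using (ℚ)
open import Data.List using (List; []; _∷_)
open import Data.List.Relation.Unary.All using (All)
open import Data.Product using (Σ; ∃; _×_; _,_)
open import Data.Empty using (⊥)
open import Data.Vec.Functional using (Vector; _++_)
open import Relation.Binary.PropositionalEquality using (_≡_)

data Term (m : ℕ) : Set where
  var  : Fin m → Term m
  _⊕_  : Term m → Term m → Term m

data Formula (m : ℕ) : Set where
  _≐_  : Term m → Term m → Formula m
  ¬'_  : Formula m → Formula m
  _∧'_ : Formula m → Formula m → Formula m
  ∃'_  : Formula (suc m) → Formula m

⟦_⟧t : ∀ {m} → Term m → Vector ℕ m → ℕ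
⟦ var i ⟧t ρ = ρ i
⟦ s ⊕ t ⟧t ρ = ⟦ s ⟧t ρ ℕ.+ ⟦ t ⟧t ρ

extend : ∀ {m} → ℕ → Vector ℕ m → Vector ℕ (suc m)
extend a ρ zero    = a
extend a ρ (suc i) = ρ i

_⊨_ : ∀ {m} → Vector ℕ m → Formula m → Set
ρ ⊨ (s ≐ t)  = ⟦ s ⟧t ρ ≡ ⟦ t ⟧t ρ
ρ ⊨ (¬' φ)   = ρ ⊨ φ → ⊥
ρ ⊨ (φ ∧' ψ) = (ρ ⊨ φ) × (ρ ⊨ ψ)
ρ ⊨ (∃' φ)   = Σ ℕ λ a → extend a ρ ⊨ φ

Definable : (n : ℕ) → (Vector ℕ n → Vector ℕ n → Set) → Set
Definable n R = Σ (Formula (n ℕ.+ n)) λ φ →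
  ∀ x y → ((x ++ y) ⊨ φ → R x y) × (R x y → (x ++ y) ⊨ φ)

sumℤ : ∀ {k} → (Fin k → ℤ) → ℤ
sumℤ {zero}  f = + 0
sumℤ {suc k} f = f zero ℤ.+ sumℤ (λ i → f (suc i))

sumℚ : ∀ {k} → (Fin k → ℚ) → ℚ
sumℚ {zero}  f = ℚ.0ℚ
sumℚ {suc k} f = f zero ℚ.+ sumℚ (λ i → f (suc i))

ℤ→ℚ : ℤ → ℚ
ℤ→ℚ z = z ℚ./ 1

ℕ→ℚ : ℕ → ℚ
ℕ→ℚ a = (+ a) ℚ./ 1

LinIndep : ∀ {n k} → (Fin k → Vector ℤ n) → Set
LinIndep {n} {k} p = (a : Fin k → ℚ) →
  (∀ (j : Fin n) → sumℚ (λ i → a i ℚ.* ℤ→ℚ (p i j)) ≡ ℚ.0ℚ) →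
  ∀ i → a i ≡ ℚ.0ℚ

record FundLattice (n : ℕ) : Set where
  field
    dim   : ℕ
    base  : Vector ℤ n
    gens  : Fin dim → Vector ℤ n
    indep : LinIndep gens

  point : (Fin dim → ℕ) → Vector ℤ n
  point κ j = base j ℤ.+ sumℤ (λ i → (+ κ i) ℤ.* gens i j)

open FundLattice public

_∈L_ : ∀ {n} → Vector ℕ n → FundLattice n → Set
x ∈L C = Σ (Fin (dim C) → ℕ) λ κ → ∀ j → point C κ j ≡ + (x j)

InNⁿ : ∀ {n} → FundLattice n → Set
InNⁿ C = ∀ κ j → ℤ._≤_ (+ 0) (point C κ j)

Monomial : ℕ → Set
Monomial n = ℚ × Vector ℕ n

Poly : ℕ → Set
Poly n = List (Monomial n)

sumℕ : ∀ {k} → (Fin k → ℕ) → ℕ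
sumℕ {zero}  f = 0
sumℕ {suc k} f = f zero ℕ.+ sumℕ (λ i → f (suc i))

prodℚ : ∀ {k} → (Fin k → ℚ) → ℚ
prodℚ {zero}  f = ℚ.1ℚ
prodℚ {suc k} f = f zero ℚ.* prodℚ (λ i → f (suc i))

evalMono : ∀ {n} → Monomial n → Vector ℕ n → ℚ
evalMono (c , e) x = c ℚ.* prodℚ (λ j → ℕ→ℚ (x j ℕ.^ e j))

evalPoly : ∀ {n} → Poly n → Vector ℕ n → ℚ
evalPoly []      x = ℚ.0ℚ
evalPoly (m ∷ P) x = evalMono m x ℚ.+ evalPoly P x

DegLe : ∀ {n} → ℕ → Poly n → Set
DegLe d P = All (λ { (c , e) → sumℕ e ℕ.≤ d }) P

PiecewisePoly : (n d : ℕ) → (Vector ℕ n → ℕ) → Set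
PiecewisePoly n d f =
  Σ ℕ λ m → Σ (Fin m → FundLattice n) λ C →
    (∀ j → InNⁿ (C j)) ×
    (∀ x → Σ (Fin m) λ j → x ∈L C j) ×
    (∀ x j j' → x ∈L C j → x ∈L C j' → j ≡ j') ×
    (∀ j → Σ (Poly n) λ P → DegLe d P ×
             (∀ x → x ∈L C j → evalPoly P x ≡ ℕ→ℚ (f x)))

{-# OPTIONS --safe #-}

-- f x counts the y ≺ x.  Quantifier elimination turns ≺ into a Boolean combination of affine
-- inequalities and congruences.  For such a φ(y, x), with M a common period of the congruences,
-- φ(y) and φ(M + y) agree unless y is one of finitely many rational affine functions of x (the
-- break points).  This yields Cooper's elimination, an affine δ(x) bounding all predecessors of x,
-- and, by summation by parts against a polynomial G with G(M + y) − G(y) = p(y), the fact that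
-- Σ_{y < N} [φ(y, x)] p(y, x) is a sum of terms [ψ(x)] q(x) with deg q ≤ deg p + 1.  Summing n times
-- over the box [0, δ(x))ⁿ exhibits f as such a sum of degree n.  Finally ℕⁿ is cut into lattices on
-- which every ψ is constant: passing to residue classes of two parameters whose coefficients have
-- opposite signs makes the coefficients opposite, the substitutions κᵢ = κⱼ + t and κⱼ = κᵢ + 1 + t
-- then annihilate one of them, and once all coefficients have one sign, splitting off κᵢ = 0
-- terminates.

module Submission where

open import Defs
open import Data.Bool using (Bool; true; false; not; _∧_; if_then_else_)
import Data.Bool.Properties as BoolP
open import Data.Nat as ℕ using (ℕ; zero; suc; _<_)
import Data.Nat.DivMod as ℕDM
import Data.Nat.Divisibility as ℕD
open import Data.Nat.Induction using (<-wellFounded)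
import Data.Nat.Properties as ℕP
import Data.Nat.Tactic.RingSolver as ℕSolver
open import Data.Integer as ℤ using (ℤ; +_; -[1+_]; ∣_∣)
import Data.Integer.Divisibility.Signed as ℤD
import Data.Integer.Properties as ℤP
open import Data.Integer.Tactic.RingSolver using (solve-∀)
open import Data.Rational as ℚ using (ℚ; 0ℚ; 1ℚ)
import Data.Rational.Properties as ℚP
import Data.Rational.Unnormalised as ℚᵘ
import Data.Rational.Unnormalised.Properties as ℚᵘP
open import Data.Fin as F using (Fin; zero; suc; toℕ)
import Data.Fin.Properties as FP
open import Data.Vec using (Vec; []; _∷_; _++_; lookup; zipWith; map; replicate; sum; tabulate; updateAt; insertAt; removeAt)
import Data.Vec.Properties as VecP
open import Data.Vec.Functional using (Vector)
import Data.Vec.Functional as VF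
open import Data.List as L using (List; []; _∷_; upTo; length)
open import Data.List.Membership.Propositional using (_∈_; lose)
import Data.List.Membership.Propositional.Properties as ∈P
open import Data.List.Relation.Unary.All as All using ([]; _∷_)
import Data.List.Relation.Unary.All.Properties as AllP
open import Data.List.Relation.Unary.AllPairs using (AllPairs; []; _∷_)
import Data.List.Relation.Unary.AllPairs.Properties as AllPairsP
open import Data.List.Relation.Unary.Any as Any using (Any; here; there)
import Data.List.Relation.Unary.Any.Properties as AnyP
open import Data.Empty using (⊥)
open import Data.Product using (Σ; ∃; _×_; _,_; proj₁; proj₂)
open import Data.Sum using (_⊎_; inj₁; inj₂)
open import Data.Unit using (⊤; tt)
open import Function using (_∘_; _⇔_; mk⇔; Equivalence; id; const)
open import Function.Definitions using (Bijective)
open import Induction.WellFounded using (Acc; acc)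
open import Relation.Binary using (tri<; tri≈; tri>)
open import Relation.Binary.PropositionalEquality
open import Relation.Nullary using (Dec; does; yes; no; ¬_; contradiction)
open import Relation.Nullary.Decidable using (does-⇔; dec-true; dec-false; dec⇒maybe)
import Tactic.RingSolver as Solver
open import Tactic.RingSolver.Core.AlmostCommutativeRing using (AlmostCommutativeRing; fromCommutativeRing)

-- Two obstacles shape the argument. Counting needs a finite range that is affine in x, whereas
-- finiteness of initial segments gives only some bound, with no control in x. That bound serves
-- solely to refute that "some predecessor of x has coordinate sum at least N" still holds past its
-- break points; the affine range is then read off the break points. The other obstacle is the
-- degree. The product of a polynomial with a non-periodic formula has no antidifference of the same
-- shape, but its failure to have one is confined to break points and to two windows of length M,
-- and evaluation at a rational affine point does not raise the degree. So only the antidifference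
-- costs a degree, and n summations of the constant 1 end at degree n. Lattices arise as images of
-- injective affine maps. Injectivity survives composition and carries disjointness of parameter
-- sets over to images; the linear independence of the generators is recovered from it at the end.

-- Affine forms with integer coefficients

record Aff (k : ℕ) : Set where
  constructor aff
  field
    cst : ℤ
    lin : Vec ℤ k
open Aff public

dot : ∀ {k} → Vec ℤ k → Vec ℕ k → ℤ
dot []       []       = + 0
dot (a ∷ as) (x ∷ xs) = a ℤ.* + x ℤ.+ dot as xs

val : ∀ {k} → Aff k → Vec ℕ k → ℤ
val (aff c as) x = c ℤ.+ dot as x

infixl 6 _⊞_
infixl 7 _⊠_

_⊞_ : ∀ {k} → Aff k → Aff k → Aff k
aff c as ⊞ aff d bs = aff (c ℤ.+ d) (zipWith ℤ._+_ as bs)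

_⊠_ : ∀ {k} → ℤ → Aff k → Aff k
z ⊠ aff c as = aff (z ℤ.* c) (map (z ℤ.*_) as)

constA : ∀ {k} → ℤ → Aff k
constA c = aff c (replicate _ (+ 0))

unit : ∀ {k} → Fin k → Vec ℤ k
unit zero    = + 1 ∷ replicate _ (+ 0)
unit (suc i) = + 0 ∷ unit i

coordA : ∀ {k} → Fin k → Aff k
coordA i = aff (+ 0) (unit i)

dot-zipWith : ∀ {k} (as bs : Vec ℤ k) x → dot (zipWith ℤ._+_ as bs) x ≡ dot as x ℤ.+ dot bs x
dot-zipWith []       []       []      = refl
dot-zipWith (a ∷ as) (b ∷ bs) (x ∷ xs) rewrite dot-zipWith as bs xs =
  lemma a b (+ x) (dot as xs) (dot bs xs)
  where
  lemma : ∀ a b x u v → (a ℤ.+ b) ℤ.* x ℤ.+ (u ℤ.+ v) ≡ a ℤ.* x ℤ.+ u ℤ.+ (b ℤ.* x ℤ.+ v)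
  lemma = solve-∀

dot-map : ∀ {k} z (as : Vec ℤ k) x → dot (map (z ℤ.*_) as) x ≡ z ℤ.* dot as x
dot-map z []       []       = sym (ℤP.*-zeroʳ z)
dot-map z (a ∷ as) (x ∷ xs) rewrite dot-map z as xs = lemma z a (+ x) (dot as xs)
  where
  lemma : ∀ z a x u → z ℤ.* a ℤ.* x ℤ.+ z ℤ.* u ≡ z ℤ.* (a ℤ.* x ℤ.+ u)
  lemma = solve-∀

dot-zeros : ∀ {k} (x : Vec ℕ k) → dot (replicate k (+ 0)) x ≡ + 0
dot-zeros []       = refl
dot-zeros (x ∷ xs) rewrite dot-zeros xs = ℤP.+-identityʳ _

dot-unit : ∀ {k} (i : Fin k) x → dot (unit i) x ≡ + lookup x i
dot-unit zero    (x ∷ xs) rewrite dot-zeros xs = trans (ℤP.+-identityʳ _) (ℤP.*-identityˡ (+ x))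
dot-unit (suc i) (x ∷ xs) rewrite dot-unit i xs = ℤP.+-identityˡ _

val-⊞ : ∀ {k} (ℓ ℓ' : Aff k) x → val (ℓ ⊞ ℓ') x ≡ val ℓ x ℤ.+ val ℓ' x
val-⊞ (aff c as) (aff d bs) x rewrite dot-zipWith as bs x = lemma c d (dot as x) (dot bs x)
  where
  lemma : ∀ c d u v → c ℤ.+ d ℤ.+ (u ℤ.+ v) ≡ c ℤ.+ u ℤ.+ (d ℤ.+ v)
  lemma = solve-∀

val-⊠ : ∀ {k} z (ℓ : Aff k) x → val (z ⊠ ℓ) x ≡ z ℤ.* val ℓ x
val-⊠ z (aff c as) x rewrite dot-map z as x = sym (ℤP.*-distribˡ-+ z c (dot as x))

val-constA : ∀ {k} c (x : Vec ℕ k) → val (constA c) x ≡ c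
val-constA c x rewrite dot-zeros x = ℤP.+-identityʳ c

val-coordA : ∀ {k} (i : Fin k) x → val (coordA i) x ≡ + lookup x i
val-coordA i x rewrite dot-unit i x = ℤP.+-identityˡ _

-- Presburger formulas without quantifiers

data QF (k : ℕ) : Set where
  ge  : Aff k → QF k
  dv  : ℕ → Aff k → QF k
  neg : QF k → QF k
  and : QF k → QF k → QF k

-- The modulus of [dv m ℓ] is 1 + m, so that it is never zero.
ev : ∀ {k} → QF k → Vec ℕ k → Bool
ev (ge ℓ)    x = does (+ 0 ℤ.≤? val ℓ x)
ev (dv m ℓ)  x = does (suc m ℕD.∣? ∣ val ℓ x ∣)
ev (neg φ)   x = not (ev φ x)
ev (and φ ψ) x = ev φ x ∧ ev ψ x

-- z parametrises x through the rational affine map with numerators σ and denominator 1 + a.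
Rel : ∀ {k l} → ℕ → (Fin k → Aff l) → Vec ℕ l → Vec ℕ k → Set
Rel a σ z x = ∀ i → val (σ i) z ≡ + suc a ℤ.* + lookup x i

subst-lin : ∀ {k l} a (σ : Fin k → Aff l) (as : Vec ℤ k) →
  Σ (Aff l) λ ℓ → ∀ z x → Rel a σ z x → val ℓ z ≡ + suc a ℤ.* dot as x
subst-lin a σ []       = constA (+ 0) , λ { z [] r → trans (val-constA _ z) (sym (ℤP.*-zeroʳ (+ suc a))) }
subst-lin a σ (b ∷ bs) with subst-lin a (σ ∘ suc) bs
... | ℓ , eq = b ⊠ σ zero ⊞ ℓ , λ { z (x ∷ xs) r → begin
    val (b ⊠ σ zero ⊞ ℓ) z                                     ≡⟨ val-⊞ (b ⊠ σ zero) ℓ z ⟩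
    val (b ⊠ σ zero) z ℤ.+ val ℓ z                             ≡⟨ cong₂ ℤ._+_ (trans (val-⊠ b (σ zero) z) (cong (b ℤ.*_) (r zero))) (eq z xs (r ∘ suc)) ⟩
    b ℤ.* (+ suc a ℤ.* + x) ℤ.+ + suc a ℤ.* dot bs xs          ≡⟨ lemma b (+ suc a) (+ x) (dot bs xs) ⟩
    + suc a ℤ.* (b ℤ.* + x ℤ.+ dot bs xs) ∎ }
  where
  open ≡-Reasoning
  lemma : ∀ b a x u → b ℤ.* (a ℤ.* x) ℤ.+ a ℤ.* u ≡ a ℤ.* (b ℤ.* x ℤ.+ u)
  lemma = solve-∀

-- Integer coefficients cannot express the value after a substitution with denominator `suc a`, so a
-- multiple of it is produced. This is harmless: inequalities and congruences can be rescaled, and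
-- polynomials absorb the factor into a rational coefficient.
subst-aff : ∀ {k l} a (σ : Fin k → Aff l) (ℓ : Aff k) →
  Σ (Aff l) λ ℓ' → ∀ z x → Rel a σ z x → val ℓ' z ≡ + suc a ℤ.* val ℓ x
subst-aff a σ (aff c as) with subst-lin a σ as
... | ℓ , eq = constA (+ suc a ℤ.* c) ⊞ ℓ , λ z x r →
  trans (val-⊞ (constA (+ suc a ℤ.* c)) ℓ z)
    (trans (cong₂ ℤ._+_ (val-constA (+ suc a ℤ.* c) z) (eq z x r)) (sym (ℤP.*-distribˡ-+ (+ suc a) c (dot as x))))

0≤-scale : ∀ a z → (+ 0 ℤ.≤ z) ⇔ (+ 0 ℤ.≤ + suc a ℤ.* z)
0≤-scale a z = mk⇔
  (λ p → subst (ℤ._≤ (+ suc a ℤ.* z)) (ℤP.*-zeroʳ (+ suc a)) (ℤP.*-monoˡ-≤-nonNeg (+ suc a) p))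
  (λ p → ℤP.*-cancelˡ-≤-pos (+ 0) z (+ suc a) (subst (ℤ._≤ (+ suc a ℤ.* z)) (sym (ℤP.*-zeroʳ (+ suc a))) p))

∣-scale : ∀ a m z → (suc m ℕD.∣ ∣ z ∣) ⇔ (suc a ℕ.* suc m ℕD.∣ ∣ + suc a ℤ.* z ∣)
∣-scale a m z = mk⇔
  (λ p → subst (suc a ℕ.* suc m ℕD.∣_) (sym (ℤP.abs-* (+ suc a) z)) (ℕD.*-monoʳ-∣ (suc a) p))
  (λ p → ℕD.*-cancelˡ-∣ (suc a) (subst (suc a ℕ.* suc m ℕD.∣_) (ℤP.abs-* (+ suc a) z) p))

subst-QF : ∀ {k l} a (σ : Fin k → Aff l) (φ : QF k) →
  Σ (QF l) λ ψ → ∀ z x → Rel a σ z x → ev ψ z ≡ ev φ x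
subst-QF a σ (ge ℓ) with subst-aff a σ ℓ
... | ℓ' , eq = ge ℓ' , λ z x r → sym (trans (does-⇔ (0≤-scale a (val ℓ x)) (_ ℤ.≤? _) (_ ℤ.≤? _))
                  (cong (λ v → does (+ 0 ℤ.≤? v)) (sym (eq z x r))))
subst-QF a σ (dv m ℓ) with subst-aff a σ ℓ
-- The new modulus is `suc a ℕ.* suc m`: it is multiplied by the same factor as the form.
... | ℓ' , eq = dv (m ℕ.+ a ℕ.* suc m) ℓ' , λ z x r →
                  sym (trans (does-⇔ (∣-scale a m (val ℓ x)) (_ ℕD.∣? _) (_ ℕD.∣? _))
                  (cong (λ v → does (suc a ℕ.* suc m ℕD.∣? ∣ v ∣)) (sym (eq z x r))))
subst-QF a σ (neg φ) with subst-QF a σ φ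
... | φ' , eq = neg φ' , λ z x r → cong not (eq z x r)
subst-QF a σ (and φ ψ) with subst-QF a σ φ | subst-QF a σ ψ
... | φ' , eq | ψ' , eq' = and φ' ψ' , λ z x r → cong₂ _∧_ (eq z x r) (eq' z x r)

∧-true⁻ : ∀ {a b} → a ∧ b ≡ true → a ≡ true × b ≡ true
∧-true⁻ {true} {true} _ = refl , refl

∧-true⁺ : ∀ {a b} → a ≡ true → b ≡ true → a ∧ b ≡ true
∧-true⁺ refl refl = refl

not-true⁺ : ∀ {a} → a ≢ true → not a ≡ true
not-true⁺ {true}  n = contradiction refl n
not-true⁺ {false} n = refl

not-true⁻ : ∀ {a} → not a ≡ true → a ≢ true
not-true⁻ {false} _ ()

does-true⁻ : ∀ {A : Set} (a? : Dec A) → does a? ≡ true → A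
does-true⁻ (yes a) _ = a

-- Break points and quantifier elimination

-- A point (a , q) stands for the partial function x ↦ q x / (1 + a).
Point : ℕ → Set
Point k = ℕ × Aff k

On : ∀ {k} → Point k → ℕ → Vec ℕ k → Set
On (a , q) y x = + suc a ℤ.* + y ≡ val q x

-- `Rel` knows a single denominator for all coordinates, so the unchanged ones are multiplied by
-- `suc a`.
headMap : ∀ {k} → Point k → Fin (suc k) → Aff k
headMap (a , q) zero    = q
headMap (a , q) (suc i) = + suc a ⊠ coordA i

Rel-headMap : ∀ {k} ((a , q) : Point k) {y x} → On (a , q) y x → Rel a (headMap (a , q)) x (y ∷ x)
Rel-headMap (a , q) on zero = sym on
Rel-headMap (a , q) {x = x} on (suc i) = trans (val-⊠ (+ suc a) (coordA i) x) (cong (+ suc a ℤ.*_) (val-coordA i x))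

natPoint : ∀ {k} → ℕ → Point k
natPoint j = 0 , constA (+ j)

On-natPoint : ∀ {k} j (x : Vec ℕ k) → On (natPoint j) j x
On-natPoint j x = trans (ℤP.*-identityˡ (+ j)) (sym (val-constA (+ j) x))

On-unique : ∀ {k} (p : Point k) {y y' x} → On p y x → On p y' x → y ≡ y'
On-unique (a , q) {y} {y'} e e' = ℤP.+-injective (ℤP.*-cancelˡ-≡ (+ suc a) (+ y) (+ y') (trans e (sym e')))

defined : ∀ {k} → Point k → QF k
defined (a , q) = and (dv a q) (ge q)

defined⁺ : ∀ {k} (p : Point k) {y x} → On p y x → ev (defined p) x ≡ true
defined⁺ (a , q) {y} {x} on = ∧-true⁺
  (dec-true (suc a ℕD.∣? _) (subst (λ v → suc a ℕD.∣ ∣ v ∣) on (subst (suc a ℕD.∣_) (sym (ℤP.abs-* (+ suc a) (+ y))) (ℕD.m∣m*n y))))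
  (dec-true (+ 0 ℤ.≤? _) (subst (+ 0 ℤ.≤_) on (subst (+ 0 ℤ.≤_) (ℤP.pos-* (suc a) y) (ℤ.+≤+ ℕ.z≤n))))

defined⁻ : ∀ {k} (p : Point k) {x} → ev (defined p) x ≡ true → ∃ λ y → On p y x
defined⁻ (a , q) {x} t with ∧-true⁻ t
... | d , g with does-true⁻ (suc a ℕD.∣? _) d | does-true⁻ (+ 0 ℤ.≤? _) g
... | ℕD.divides y eq | 0≤q = y , (begin
  + suc a ℤ.* + y ≡⟨ sym (ℤP.pos-* (suc a) y) ⟩
  + (suc a ℕ.* y) ≡⟨ cong +_ (ℕP.*-comm (suc a) y) ⟩
  + (y ℕ.* suc a) ≡⟨ cong +_ (sym eq) ⟩
  + ∣ val q x ∣    ≡⟨ ℤP.0≤i⇒+∣i∣≡i 0≤q ⟩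
  val q x ∎)
  where open ≡-Reasoning

-- The guard is indispensable: where the point has no natural value, the substituted formula speaks
-- of no element of ℕ.
at : ∀ {k} → Point k → QF (suc k) → QF k
at p φ = and (defined p) (proj₁ (subst-QF (proj₁ p) (headMap p) φ))

ev-subst-point : ∀ {k} (p : Point k) φ {y x} → On p y x →
  ev (proj₁ (subst-QF (proj₁ p) (headMap p) φ)) x ≡ ev φ (y ∷ x)
ev-subst-point p φ on = proj₂ (subst-QF (proj₁ p) (headMap p) φ) _ _ (Rel-headMap p on)

at⁺ : ∀ {k} (p : Point k) φ {y x} → On p y x → ev φ (y ∷ x) ≡ true → ev (at p φ) x ≡ true
at⁺ p φ on t = ∧-true⁺ (defined⁺ p on) (trans (ev-subst-point p φ on) t)

at⁻ : ∀ {k} (p : Point k) φ {x} → ev (at p φ) x ≡ true → ∃ λ y → On p y x × ev φ (y ∷ x) ≡ true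
at⁻ p φ t with ∧-true⁻ t
... | d , s with defined⁻ p d
... | y , on = y , on , trans (sym (ev-subst-point p φ on)) s

shiftMap : ∀ {k} → ℕ → Fin (suc k) → Aff (suc k)
shiftMap M zero    = coordA zero ⊞ constA (+ M)
shiftMap M (suc i) = coordA (suc i)

Rel-shiftMap : ∀ {k} M y (x : Vec ℕ k) → Rel 0 (shiftMap M) (y ∷ x) (M ℕ.+ y ∷ x)
Rel-shiftMap M y x zero = begin
  val (coordA zero ⊞ constA (+ M)) (y ∷ x) ≡⟨ val-⊞ (coordA zero) (constA (+ M)) (y ∷ x) ⟩
  val (coordA zero) (y ∷ x) ℤ.+ val (constA (+ M)) (y ∷ x) ≡⟨ cong₂ ℤ._+_ (val-coordA zero (y ∷ x)) (val-constA (+ M) (y ∷ x)) ⟩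
  + y ℤ.+ + M ≡⟨ ℤP.+-comm (+ y) (+ M) ⟩
  + (M ℕ.+ y) ≡⟨ sym (ℤP.*-identityˡ _) ⟩
  + 1 ℤ.* + (M ℕ.+ y) ∎
  where open ≡-Reasoning
Rel-shiftMap M y x (suc i) = trans (val-coordA (suc i) (y ∷ x)) (sym (ℤP.*-identityˡ _))

shift : ∀ {k} → ℕ → QF (suc k) → QF (suc k)
shift M φ = proj₁ (subst-QF 0 (shiftMap M) φ)

ev-shift : ∀ {k} M (φ : QF (suc k)) y x → ev (shift M φ) (y ∷ x) ≡ ev φ (M ℕ.+ y ∷ x)
ev-shift M φ y x = proj₂ (subst-QF 0 (shiftMap M) φ) _ _ (Rel-shiftMap M y x)

ball : ℕ → List ℤ
ball B = L.map +_ (upTo (suc B)) L.++ L.map (λ n → ℤ.- (+ n)) (upTo (suc B))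

∈-ball : ∀ {B} z → ∣ z ∣ ℕ.≤ B → z ∈ ball B
∈-ball (+ n) le = ∈P.∈-++⁺ˡ (∈P.∈-map⁺ +_ (∈P.∈-upTo⁺ (ℕ.s≤s le)))
∈-ball {B} -[1+ n ] le = ∈P.∈-++⁺ʳ (L.map +_ (upTo (suc B))) (∈P.∈-map⁺ (λ n → ℤ.- (+ n)) (∈P.∈-upTo⁺ (ℕ.s≤s le)))

-- The solutions y of α y + ℓ x = z with |z| at most `B`, one point for each z. For negative α both
-- sides change sign so that the denominator is positive; for α = 0 the form does not depend on y.
crossings : ∀ {k} → ℕ → ℤ → Aff k → List (Point k)
crossings B (+ zero)   ℓ = []
crossings B (+ suc a)  ℓ = L.map (λ z → a , constA z ⊞ (ℤ.- + 1) ⊠ ℓ) (ball B)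
crossings B (-[1+ a ]) ℓ = L.map (λ z → a , constA (ℤ.- z) ⊞ ℓ) (ball B)

crossings-complete : ∀ {k} B α (ℓ : Aff k) y x → α ≢ + 0 → ∣ α ℤ.* + y ℤ.+ val ℓ x ∣ ℕ.≤ B →
  Any (λ p → On p y x) (crossings B α ℓ)
crossings-complete B (+ zero) ℓ y x α≢0 le = contradiction refl α≢0
crossings-complete B (+ suc a) ℓ y x _ le = AnyP.map⁺ {f = λ z → a , constA z ⊞ (ℤ.- + 1) ⊠ ℓ} (lose (∈-ball (α ℤ.* + y ℤ.+ v) le) (sym (begin
  val (constA (α ℤ.* + y ℤ.+ v) ⊞ (ℤ.- + 1) ⊠ ℓ) x ≡⟨ val-⊞ (constA (α ℤ.* + y ℤ.+ v)) ((ℤ.- + 1) ⊠ ℓ) x ⟩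
  val (constA (α ℤ.* + y ℤ.+ v)) x ℤ.+ val ((ℤ.- + 1) ⊠ ℓ) x ≡⟨ cong₂ ℤ._+_ (val-constA (α ℤ.* + y ℤ.+ v) x) (val-⊠ (ℤ.- + 1) ℓ x) ⟩
  α ℤ.* + y ℤ.+ v ℤ.+ (ℤ.- + 1) ℤ.* v ≡⟨ lemma (α ℤ.* + y) v ⟩
  α ℤ.* + y ∎)))
  where
  open ≡-Reasoning
  α = + suc a
  v = val ℓ x
  lemma : ∀ t v → t ℤ.+ v ℤ.+ (ℤ.- + 1) ℤ.* v ≡ t
  lemma = solve-∀
crossings-complete B (-[1+ a ]) ℓ y x _ le = AnyP.map⁺ {f = λ z → a , constA (ℤ.- z) ⊞ ℓ} (lose (∈-ball (α ℤ.* + y ℤ.+ v) le) (sym (begin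
  val (constA (ℤ.- (α ℤ.* + y ℤ.+ v)) ⊞ ℓ) x ≡⟨ val-⊞ (constA (ℤ.- (α ℤ.* + y ℤ.+ v))) ℓ x ⟩
  val (constA (ℤ.- (α ℤ.* + y ℤ.+ v))) x ℤ.+ v ≡⟨ cong (ℤ._+ v) (val-constA (ℤ.- (α ℤ.* + y ℤ.+ v)) x) ⟩
  ℤ.- (ℤ.- + suc a ℤ.* + y ℤ.+ v) ℤ.+ v ≡⟨ lemma (+ suc a) (+ y) v ⟩
  + suc a ℤ.* + y ∎)))
  where
  open ≡-Reasoning
  α = -[1+ a ]
  v = val ℓ x
  lemma : ∀ a y v → ℤ.- (ℤ.- a ℤ.* y ℤ.+ v) ℤ.+ v ≡ a ℤ.* y
  lemma = solve-∀

-- A shift of y by `M` changes the form by α M, so its sign can change only where its absolute value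
-- is at most |α| M. A congruence whose modulus divides `M` never changes.
breaks : ∀ {k} → ℕ → QF (suc k) → List (Point k)
breaks M (ge (aff c (α ∷ as))) = crossings (∣ α ∣ ℕ.* M) α (aff c as)
breaks M (dv m ℓ)  = []
breaks M (neg φ)   = breaks M φ
breaks M (and φ ψ) = breaks M φ L.++ breaks M ψ

Period : ∀ {k} → ℕ → QF k → Set
Period M (ge ℓ)    = ⊤
Period M (dv m ℓ)  = suc m ℕD.∣ M
Period M (neg φ)   = Period M φ
Period M (and φ ψ) = Period M φ × Period M ψ

Period-∣ : ∀ {k M N} (φ : QF k) → M ℕD.∣ N → Period M φ → Period N φ
Period-∣ (ge ℓ)    d p = tt
Period-∣ (dv m ℓ)  d p = ℕD.∣-trans p d
Period-∣ (neg φ)   d p = Period-∣ φ d p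
Period-∣ (and φ ψ) d (p , q) = Period-∣ φ d p , Period-∣ ψ d q

∃Period : ∀ {k} (φ : QF k) → ∃ λ P → Period (suc P) φ
∃Period (ge ℓ)    = 0 , tt
∃Period (dv m ℓ)  = m , ℕD.∣-refl
∃Period (neg φ)   = ∃Period φ
∃Period (and φ ψ) with ∃Period φ | ∃Period ψ
-- The predecessor of `suc P ℕ.* suc Q`, a common multiple of both periods.
... | P , p | Q , q = Q ℕ.+ P ℕ.* suc Q , Period-∣ φ (ℕD.m∣m*n (suc Q)) p , Period-∣ ψ (ℕD.n∣m*n (suc P)) q

0≤-stable : ∀ z w → ∣ w ∣ ℕ.< ∣ z ∣ → (+ 0 ℤ.≤ z) ⇔ (+ 0 ℤ.≤ z ℤ.+ w)
0≤-stable z w lt = mk⇔ (to z w lt) (from z w lt)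
  where
  to : ∀ z w → ∣ w ∣ ℕ.< ∣ z ∣ → + 0 ℤ.≤ z → + 0 ℤ.≤ z ℤ.+ w
  to (+ n) (+ m)    lt _ = ℤ.+≤+ ℕ.z≤n
  to (+ n) -[1+ m ] lt _ = subst (+ 0 ℤ.≤_) (sym (ℤP.⊖-≥ (ℕP.<⇒≤ lt))) (ℤ.+≤+ ℕ.z≤n)
  from : ∀ z w → ∣ w ∣ ℕ.< ∣ z ∣ → + 0 ℤ.≤ z ℤ.+ w → + 0 ℤ.≤ z
  from (+ n) w lt _ = ℤ.+≤+ ℕ.z≤n
  from -[1+ n ] (+ m) lt p = contradiction (ℤP.≤-<-trans p (subst (ℤ._< + 0) (sym (ℤP.⊖-< lt)) (neg< lt))) (ℤP.<-irrefl refl)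
    where
    neg< : ∀ {m n} → m ℕ.< n → ℤ.- + (n ℕ.∸ m) ℤ.< + 0
    neg< {m} {n} lt with n ℕ.∸ m | ℕP.m<n⇒0<n∸m lt
    ... | suc _ | _ = ℤ.-<+

crossing : ∀ {k} M (φ : QF (suc k)) → Period M φ → ∀ y x →
  ev φ (y ∷ x) ≡ ev φ (M ℕ.+ y ∷ x) ⊎ Any (λ p → On p y x) (breaks M φ)
crossing M (ge (aff c (α ∷ as))) _ y x with ∣ α ℤ.* + y ℤ.+ (c ℤ.+ dot as x) ∣ ℕ.≤? ∣ α ∣ ℕ.* M | α ℤP.≟ + 0
... | _ | yes refl = inj₁ refl
... | yes le | no α≢0 = inj₂ (crossings-complete _ α (aff c as) y x α≢0 le)
... | no ≰ | no _ = inj₁ (trans (cong (λ v → does (+ 0 ℤ.≤? v)) (swap c (α ℤ.* + y) (dot as x)))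
      (trans (does-⇔ (0≤-stable (α ℤ.* + y ℤ.+ (c ℤ.+ dot as x)) (α ℤ.* + M) (subst (ℕ._< _) (sym (ℤP.abs-* α (+ M))) (ℕP.≰⇒> ≰))) (_ ℤ.≤? _) (_ ℤ.≤? _))
             (cong (λ v → does (+ 0 ℤ.≤? v)) (trans (lemma α (+ y) c (dot as x) (+ M)) (cong (λ v → c ℤ.+ (α ℤ.* v ℤ.+ dot as x)) (sym (ℤP.pos-+ M y)))))))
  where
  swap : ∀ c t d → c ℤ.+ (t ℤ.+ d) ≡ t ℤ.+ (c ℤ.+ d)
  swap = solve-∀
  lemma : ∀ α y c d M → α ℤ.* y ℤ.+ (c ℤ.+ d) ℤ.+ α ℤ.* M ≡ c ℤ.+ (α ℤ.* (M ℤ.+ y) ℤ.+ d)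
  lemma = solve-∀
crossing M (dv m (aff c (α ∷ as))) d y x = inj₁ (does-⇔ (mk⇔ to from) (suc m ℕD.∣? _) (suc m ℕD.∣? _))
  where
  v = val (aff c (α ∷ as)) (y ∷ x)
  v' = val (aff c (α ∷ as)) (M ℕ.+ y ∷ x)
  lemma : ∀ α y c d M → c ℤ.+ (α ℤ.* (M ℤ.+ y) ℤ.+ d) ≡ c ℤ.+ (α ℤ.* y ℤ.+ d) ℤ.+ α ℤ.* M
  lemma = solve-∀
  eq : v' ≡ v ℤ.+ α ℤ.* + M
  eq = trans (cong (λ v → c ℤ.+ (α ℤ.* v ℤ.+ dot as x)) (ℤP.pos-+ M y)) (lemma α (+ y) c (dot as x) (+ M))
  d' : + suc m ℤD.∣ α ℤ.* + M
  d' = ℤD.∣n⇒∣m*n α (ℤD.∣ᵤ⇒∣ d)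
  to : suc m ℕD.∣ ∣ v ∣ → suc m ℕD.∣ ∣ v' ∣
  to p = ℤD.∣⇒∣ᵤ {+ suc m} {v'} (subst (+ suc m ℤD.∣_) (sym eq) (ℤD.∣m∣n⇒∣m+n (ℤD.∣ᵤ⇒∣ {+ suc m} {v} p) d'))
  from : suc m ℕD.∣ ∣ v' ∣ → suc m ℕD.∣ ∣ v ∣
  from p = ℤD.∣⇒∣ᵤ {+ suc m} {v} (ℤD.∣m+n∣n⇒∣m (subst (+ suc m ℤD.∣_) eq (ℤD.∣ᵤ⇒∣ {+ suc m} {v'} p)) d')
crossing M (neg φ) p y x with crossing M φ p y x
... | inj₁ e = inj₁ (cong not e)
... | inj₂ a = inj₂ a
crossing M (and φ ψ) (p , q) y x with crossing M φ p y x | crossing M ψ q y x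
... | inj₂ a | _      = inj₂ (AnyP.++⁺ˡ a)
... | inj₁ _ | inj₂ a = inj₂ (AnyP.++⁺ʳ (breaks M φ) a)
... | inj₁ e | inj₁ f = inj₁ (cong₂ _∧_ e f)

anyQF : ∀ {k} → List (QF k) → QF k
anyQF []       = ge (constA (ℤ.- + 1))
anyQF (φ ∷ φs) = neg (and (neg φ) (neg (anyQF φs)))

anyQF⁺ : ∀ {k} {φs : List (QF k)} {x} → Any (λ φ → ev φ x ≡ true) φs → ev (anyQF φs) x ≡ true
anyQF⁺ {φs = φ ∷ φs} {x} (here t) rewrite t = refl
anyQF⁺ {φs = φ ∷ φs} {x} (there a) rewrite anyQF⁺ a with ev φ x
... | true  = refl
... | false = refl

anyQF⁻ : ∀ {k} (φs : List (QF k)) {x} → ev (anyQF φs) x ≡ true → Any (λ φ → ev φ x ≡ true) φs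
anyQF⁻ [] {x} t = contradiction (does-true⁻ (_ ℤ.≤? _) t) (subst (λ v → ¬ (+ 0 ℤ.≤ v)) (sym (val-constA (ℤ.- + 1) x)) λ ())
anyQF⁻ (φ ∷ φs) {x} t with ev φ x in eq
... | true  = here eq
... | false = there (anyQF⁻ φs (trans (sym (BoolP.not-involutive _)) t))

-- Cooper's elimination: the least witness is below the period or one period above a break point.
∃QF : ∀ {k} → QF (suc k) → QF k
∃QF φ with ∃Period φ
... | P , _ = anyQF (L.map (λ j → at (natPoint j) φ) (upTo (suc P))
               L.++ L.map (λ p → at p (shift (suc P) φ)) (breaks (suc P) φ))

∃QF⁺ : ∀ {k} (φ : QF (suc k)) y x → ev φ (y ∷ x) ≡ true → ev (∃QF φ) x ≡ true
∃QF⁺ φ y x t with ∃Period φ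
... | P , per = anyQF⁺ (go y (<-wellFounded y) t)
  where
  lows = L.map (λ j → at (natPoint j) φ) (upTo (suc P))
  highs = L.map (λ p → at p (shift (suc P) φ)) (breaks (suc P) φ)
  go : ∀ y → Acc ℕ._<_ y → ev φ (y ∷ x) ≡ true → Any (λ ψ → ev ψ x ≡ true) (lows L.++ highs)
  go y (acc rs) t with y ℕ.<? suc P
  ... | yes lt = AnyP.++⁺ˡ (AnyP.map⁺ (lose (∈P.∈-upTo⁺ lt) (at⁺ (natPoint y) φ (On-natPoint y x) t)))
  ... | no ≮ with ℕP.m≤n⇒∃[o]m+o≡n (ℕP.≮⇒≥ ≮)
  ... | y' , refl with crossing (suc P) φ per y' x
  ... | inj₁ e = go y' (rs (ℕP.m<n+m y' (ℕ.s≤s ℕ.z≤n))) (trans e t)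
  ... | inj₂ a = AnyP.++⁺ʳ lows (AnyP.map⁺ (Any.map (λ {p} on → at⁺ p (shift (suc P) φ) on (trans (ev-shift (suc P) φ y' x) t)) a))

∃QF⁻ : ∀ {k} (φ : QF (suc k)) x → ev (∃QF φ) x ≡ true → ∃ λ y → ev φ (y ∷ x) ≡ true
∃QF⁻ φ x t with ∃Period φ
... | P , per with AnyP.++⁻ (L.map (λ j → at (natPoint j) φ) (upTo (suc P))) (anyQF⁻ _ t)
... | inj₁ a with Any.satisfied (AnyP.map⁻ a)
...   | j , s with at⁻ (natPoint j) φ s
...     | y , _ , e = y , e
∃QF⁻ φ x t | P , per | inj₂ a with Any.satisfied (AnyP.map⁻ a)
...   | p , s with at⁻ p (shift (suc P) φ) s
...     | y , _ , e = suc P ℕ.+ y , trans (sym (ev-shift (suc P) φ y x)) e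

-- From first-order formulas to quantifier-free ones

termA : ∀ {m} → Term m → Aff m
termA (var i) = coordA i
termA (s ⊕ t) = termA s ⊞ termA t

val-termA : ∀ {m} (t : Term m) {ρ v} → (∀ i → ρ i ≡ lookup v i) → val (termA t) v ≡ + ⟦ t ⟧t ρ
val-termA (var i) {ρ} {v} eq = trans (val-coordA i v) (cong +_ (sym (eq i)))
val-termA (s ⊕ t) {ρ} {v} eq = trans (val-⊞ (termA s) (termA t) v)
  (trans (cong₂ ℤ._+_ (val-termA s eq) (val-termA t eq)) (sym (ℤP.pos-+ (⟦ s ⟧t ρ) (⟦ t ⟧t ρ))))

eqQF : ∀ {k} → Aff k → Aff k → QF k
eqQF ℓ ℓ' = and (ge (ℓ ⊞ (ℤ.- + 1) ⊠ ℓ')) (ge (ℓ' ⊞ (ℤ.- + 1) ⊠ ℓ))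

val-diff : ∀ {k} (ℓ ℓ' : Aff k) x → val (ℓ ⊞ (ℤ.- + 1) ⊠ ℓ') x ≡ val ℓ x ℤ.- val ℓ' x
val-diff ℓ ℓ' x = trans (val-⊞ ℓ ((ℤ.- + 1) ⊠ ℓ') x)
  (cong (λ w → val ℓ x ℤ.+ w) (trans (val-⊠ (ℤ.- + 1) ℓ' x) (ℤP.-1*i≡-i (val ℓ' x))))

leQF : ∀ {k} → Aff k → Aff k → QF k
leQF ℓ ℓ' = ge (ℓ' ⊞ (ℤ.- + 1) ⊠ ℓ)

ev-leQF : ∀ {k} (ℓ ℓ' : Aff k) x → ev (leQF ℓ ℓ') x ≡ does (val ℓ x ℤ.≤? val ℓ' x)
ev-leQF ℓ ℓ' x = does-⇔ (mk⇔ (λ p → ℤP.0≤i-j⇒j≤i {val ℓ' x} {val ℓ x} (subst (+ 0 ℤ.≤_) (val-diff ℓ' ℓ x) p))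
                              (λ p → subst (+ 0 ℤ.≤_) (sym (val-diff ℓ' ℓ x)) (ℤP.i≤j⇒0≤j-i {val ℓ x} {val ℓ' x} p))) (_ ℤ.≤? _) (val ℓ x ℤ.≤? val ℓ' x)

ev-eqQF : ∀ {k} (ℓ ℓ' : Aff k) x → ev (eqQF ℓ ℓ') x ≡ does (val ℓ x ℤP.≟ val ℓ' x)
ev-eqQF ℓ ℓ' x = trans (cong₂ _∧_ (ev-leQF ℓ' ℓ x) (ev-leQF ℓ ℓ' x)) (lemma (val ℓ x) (val ℓ' x))
  where
  lemma : ∀ z w → does (w ℤ.≤? z) ∧ does (z ℤ.≤? w) ≡ does (z ℤP.≟ w)
  lemma z w with w ℤ.≤? z | z ℤ.≤? w | z ℤP.≟ w
  ... | yes p | yes q | yes e = refl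
  ... | yes p | yes q | no ne = contradiction (ℤP.≤-antisym q p) ne
  ... | yes p | no q  | yes e = contradiction (ℤP.≤-reflexive e) q
  ... | yes p | no q  | no ne = refl
  ... | no p  | _     | yes e = contradiction (ℤP.≤-reflexive (sym e)) p
  ... | no p  | _     | no ne = refl

-- The semantics uses valuations that are functions, the evaluation uses vectors. Pointwise
-- agreement passes under a quantifier, where an equality of functions would require extensionality.
presburger : ∀ {m} (φ : Formula m) → Σ (QF m) λ ψ → ∀ ρ v → (∀ i → ρ i ≡ lookup v i) →
  (ρ ⊨ φ) ⇔ (ev ψ v ≡ true)
presburger (s ≐ t) = eqQF (termA s) (termA t) , λ ρ v eq → mk⇔
  (λ e → trans (ev-eqQF (termA s) (termA t) v) (dec-true (_ ℤP.≟ _) (trans (val-termA s eq) (trans (cong +_ e) (sym (val-termA t eq))))))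
  (λ e → ℤP.+-injective (trans (sym (val-termA s eq)) (trans (does-true⁻ (_ ℤP.≟ _) (trans (sym (ev-eqQF (termA s) (termA t) v)) e)) (val-termA t eq))))
presburger (¬' φ) with presburger φ
... | ψ , h = neg ψ , λ ρ v eq → mk⇔
  (λ n → not-true⁺ (λ e → n (Equivalence.from (h ρ v eq) e)))
  (λ e s → not-true⁻ e (Equivalence.to (h ρ v eq) s))
presburger (φ ∧' χ) with presburger φ | presburger χ
... | ψ , h | ω , g = and ψ ω , λ ρ v eq → mk⇔
  (λ { (p , q) → ∧-true⁺ (Equivalence.to (h ρ v eq) p) (Equivalence.to (g ρ v eq) q) })
  (λ e → Equivalence.from (h ρ v eq) (proj₁ (∧-true⁻ e)) , Equivalence.from (g ρ v eq) (proj₂ (∧-true⁻ {ev ψ v} e)))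
presburger (∃' φ) with presburger φ
... | ψ , h = ∃QF ψ , λ ρ v eq → mk⇔
  (λ { (y , s) → ∃QF⁺ ψ y v (Equivalence.to (h _ (y ∷ v) (ext y eq)) s) })
  (λ e → let (y , t) = ∃QF⁻ ψ v e in y , Equivalence.from (h _ (y ∷ v) (ext y eq)) t)
  where
  ext : ∀ {m} {ρ : Fin m → ℕ} {v} y → (∀ i → ρ i ≡ lookup v i) → ∀ i → extend y ρ i ≡ lookup (y ∷ v) i
  ext y eq zero    = refl
  ext y eq (suc i) = eq i

-- Polynomials and their antidifferences

ℚ-ring : AlmostCommutativeRing _ _
ℚ-ring = fromCommutativeRing ℚP.+-*-commutativeRing λ x → dec⇒maybe (0ℚ ℚP.≟ x)

ℤ→ℚ≃ : ∀ i → ℚ.toℚᵘ (ℤ→ℚ i) ℚᵘ.≃ ℚᵘ.mkℚᵘ i 0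
ℤ→ℚ≃ i = ℚP.toℚᵘ-fromℚᵘ (ℚᵘ.mkℚᵘ i 0)

ℤ→ℚ-+ : ∀ i j → ℤ→ℚ (i ℤ.+ j) ≡ ℤ→ℚ i ℚ.+ ℤ→ℚ j
ℤ→ℚ-+ i j = ℚP.toℚᵘ-injective (ℚᵘP.≃-trans (ℤ→ℚ≃ (i ℤ.+ j)) (ℚᵘP.≃-trans (ℚᵘ.*≡* (lemma i j))
  (ℚᵘP.≃-sym (ℚᵘP.≃-trans (ℚP.toℚᵘ-homo-+ (ℤ→ℚ i) (ℤ→ℚ j)) (ℚᵘP.+-cong (ℤ→ℚ≃ i) (ℤ→ℚ≃ j))))))
  where
  lemma : ∀ i j → (i ℤ.+ j) ℤ.* + 1 ≡ (i ℤ.* + 1 ℤ.+ j ℤ.* + 1) ℤ.* + 1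
  lemma = solve-∀

ℤ→ℚ-* : ∀ i j → ℤ→ℚ (i ℤ.* j) ≡ ℤ→ℚ i ℚ.* ℤ→ℚ j
ℤ→ℚ-* i j = ℚP.toℚᵘ-injective (ℚᵘP.≃-trans (ℤ→ℚ≃ (i ℤ.* j))
  (ℚᵘP.≃-sym (ℚᵘP.≃-trans (ℚP.toℚᵘ-homo-* (ℤ→ℚ i) (ℤ→ℚ j)) (ℚᵘP.*-cong (ℤ→ℚ≃ i) (ℤ→ℚ≃ j)))))

ℤ→ℚ-injective : ∀ i j → ℤ→ℚ i ≡ ℤ→ℚ j → i ≡ j
ℤ→ℚ-injective i j e with ℚᵘP.≃-trans (ℚᵘP.≃-sym (ℤ→ℚ≃ i)) (ℚᵘP.≃-trans (ℚᵘP.≃-reflexive (cong ℚ.toℚᵘ e)) (ℤ→ℚ≃ j))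
... | ℚᵘ.*≡* p = trans (sym (ℤP.*-identityʳ i)) (trans p (ℤP.*-identityʳ j))

ℤ→ℚ-inverse : ∀ i → i ≢ + 0 → ∃ λ r → r ℚ.* ℤ→ℚ i ≡ 1ℚ
ℤ→ℚ-inverse i i≢0 = ℚ.1/_ (ℤ→ℚ i) {{nz}} , ℚP.*-inverseˡ (ℤ→ℚ i) {{nz}}
  where
  nz = ℚ.≢-nonZero (λ e → i≢0 (ℤ→ℚ-injective i (+ 0) e))

-- The index bounds the degree. Multiplication by affine forms generates all polynomials, and an
-- affine substitution maps each factor to a factor, so it preserves the index.
data Pol (k : ℕ) : ℕ → Set where
  one   : Pol k 0
  add   : ∀ {d} → Pol k d → Pol k d → Pol k d
  scale : ∀ {d} → ℚ → Pol k d → Pol k d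
  mul   : ∀ {d} → Aff k → Pol k d → Pol k (suc d)
  wk    : ∀ {d} → Pol k d → Pol k (suc d)

evP : ∀ {k d} → Pol k d → Vec ℕ k → ℚ
evP one         x = 1ℚ
evP (add p q)   x = evP p x ℚ.+ evP q x
evP (scale c p) x = c ℚ.* evP p x
evP (mul ℓ p)   x = ℤ→ℚ (val ℓ x) ℚ.* evP p x
evP (wk p)      x = evP p x

subst-Pol : ∀ {k l d} a (σ : Fin k → Aff l) (p : Pol k d) →
  Σ (Pol l d) λ p' → ∀ z x → Rel a σ z x → evP p' z ≡ evP p x
subst-Pol a σ one = one , λ z x r → refl
subst-Pol a σ (add p q) with subst-Pol a σ p | subst-Pol a σ q
... | p' , h | q' , g = add p' q' , λ z x r → cong₂ ℚ._+_ (h z x r) (g z x r)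
subst-Pol a σ (scale c p) with subst-Pol a σ p
... | p' , h = scale c p' , λ z x r → cong (c ℚ.*_) (h z x r)
subst-Pol a σ (wk p) with subst-Pol a σ p
... | p' , h = wk p' , h
subst-Pol a σ (mul ℓ p) with subst-Pol a σ p | subst-aff a σ ℓ | ℤ→ℚ-inverse (+ suc a) (λ ())
-- Each affine factor picks up one factor `suc a` under the substitution; `r` is its inverse.
... | p' , h | ℓ' , g | r , inv = scale r (mul ℓ' p') , λ z x rel → begin
    r ℚ.* (ℤ→ℚ (val ℓ' z) ℚ.* evP p' z)                    ≡⟨ cong₂ (λ s t → r ℚ.* (s ℚ.* t)) (trans (cong ℤ→ℚ (g z x rel)) (ℤ→ℚ-* (+ suc a) (val ℓ x))) (h z x rel) ⟩
    r ℚ.* (ℤ→ℚ (+ suc a) ℚ.* ℤ→ℚ (val ℓ x) ℚ.* evP p x)   ≡⟨ lemma r (ℤ→ℚ (+ suc a)) (ℤ→ℚ (val ℓ x)) (evP p x) ⟩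
    r ℚ.* ℤ→ℚ (+ suc a) ℚ.* (ℤ→ℚ (val ℓ x) ℚ.* evP p x)   ≡⟨ cong (ℚ._* (ℤ→ℚ (val ℓ x) ℚ.* evP p x)) inv ⟩
    1ℚ ℚ.* (ℤ→ℚ (val ℓ x) ℚ.* evP p x)                    ≡⟨ ℚP.*-identityˡ _ ⟩
    ℤ→ℚ (val ℓ x) ℚ.* evP p x ∎
  where
  open ≡-Reasoning
  lemma : ∀ r a v p → r ℚ.* (a ℚ.* v ℚ.* p) ≡ r ℚ.* a ℚ.* (v ℚ.* p)
  lemma = Solver.solve-∀ ℚ-ring

-- Falling factorials with step m, a basis in which differences with step m are explicit.
ff : ℚ → ℕ → ℚ → ℚ
ff m zero    t = 1ℚ
ff m (suc e) t = (t ℚ.- ℕ→ℚ e ℚ.* m) ℚ.* ff m e t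

ℕ→ℚ-suc : ∀ e → ℕ→ℚ (suc e) ≡ 1ℚ ℚ.+ ℕ→ℚ e
ℕ→ℚ-suc e = ℤ→ℚ-+ (+ 1) (+ e)

-- A shift by the step turns each factor into the next one: only the factor t + m is new, and the
-- last factor of `ff m (suc e) t` disappears. The discrete power rule `ff-diff` follows.
ff-shift : ∀ m e t → ff m (suc e) (t ℚ.+ m) ≡ (t ℚ.+ m) ℚ.* ff m e t
ff-shift m zero    t = lemma m t
  where
  lemma : ∀ m t → (t ℚ.+ m ℚ.- 0ℚ ℚ.* m) ℚ.* 1ℚ ≡ (t ℚ.+ m) ℚ.* 1ℚ
  lemma = Solver.solve-∀ ℚ-ring
ff-shift m (suc e) t = begin
  (t ℚ.+ m ℚ.- ℕ→ℚ (suc e) ℚ.* m) ℚ.* ff m (suc e) (t ℚ.+ m)   ≡⟨ cong₂ (λ u v → (t ℚ.+ m ℚ.- u ℚ.* m) ℚ.* v) (ℕ→ℚ-suc e) (ff-shift m e t) ⟩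
  (t ℚ.+ m ℚ.- (1ℚ ℚ.+ ℕ→ℚ e) ℚ.* m) ℚ.* ((t ℚ.+ m) ℚ.* ff m e t) ≡⟨ lemma m t (ℕ→ℚ e) (ff m e t) ⟩
  (t ℚ.+ m) ℚ.* ((t ℚ.- ℕ→ℚ e ℚ.* m) ℚ.* ff m e t) ∎
  where
  open ≡-Reasoning
  lemma : ∀ m t e f → (t ℚ.+ m ℚ.- (1ℚ ℚ.+ e) ℚ.* m) ℚ.* ((t ℚ.+ m) ℚ.* f) ≡ (t ℚ.+ m) ℚ.* ((t ℚ.- e ℚ.* m) ℚ.* f)
  lemma = Solver.solve-∀ ℚ-ring

ff-diff : ∀ m e t → ff m (suc e) (t ℚ.+ m) ≡ ff m (suc e) t ℚ.+ ℕ→ℚ (suc e) ℚ.* m ℚ.* ff m e t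
ff-diff m e t = begin
  ff m (suc e) (t ℚ.+ m)      ≡⟨ ff-shift m e t ⟩
  (t ℚ.+ m) ℚ.* ff m e t      ≡⟨ lemma m t (ℕ→ℚ e) (ff m e t) ⟩
  (t ℚ.- ℕ→ℚ e ℚ.* m) ℚ.* ff m e t ℚ.+ (1ℚ ℚ.+ ℕ→ℚ e) ℚ.* m ℚ.* ff m e t
    ≡⟨ cong (λ u → ff m (suc e) t ℚ.+ u ℚ.* m ℚ.* ff m e t) (sym (ℕ→ℚ-suc e)) ⟩
  ff m (suc e) t ℚ.+ ℕ→ℚ (suc e) ℚ.* m ℚ.* ff m e t ∎
  where
  open ≡-Reasoning
  lemma : ∀ m t e f → (t ℚ.+ m) ℚ.* f ≡ (t ℚ.- e ℚ.* m) ℚ.* f ℚ.+ (1ℚ ℚ.+ e) ℚ.* m ℚ.* f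
  lemma = Solver.solve-∀ ℚ-ring

-- A term of a polynomial in the head variable, with coefficient in the other variables. The power
-- and the degree of the coefficient add up to `d` exactly, so raising the power by one costs
-- exactly one degree.
record FFTerm (k d : ℕ) : Set where
  constructor ffterm
  field
    pow   : ℕ
    {deg} : ℕ
    coef  : Pol k deg
    bound : pow ℕ.+ deg ≡ d

evFF : ∀ {k d} → ℚ → List (FFTerm k d) → ℚ → Vec ℕ k → ℚ
evFF m []                     t x = 0ℚ
evFF m (ffterm e c _ ∷ ts) t x = ff m e t ℚ.* evP c x ℚ.+ evFF m ts t x

evFF-++ : ∀ {k d} m (ts us : List (FFTerm k d)) t x → evFF m (ts L.++ us) t x ≡ evFF m ts t x ℚ.+ evFF m us t x
evFF-++ m []       us t x = sym (ℚP.+-identityˡ _)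
evFF-++ m (ffterm e c _ ∷ ts) us t x rewrite evFF-++ m ts us t x = sym (ℚP.+-assoc (ff m e t ℚ.* evP c x) _ _)

scaleFF : ∀ {k d} → ℚ → List (FFTerm k d) → List (FFTerm k d)
scaleFF r []                     = []
scaleFF r (ffterm e c b ∷ ts) = ffterm e (scale r c) b ∷ scaleFF r ts

evFF-scale : ∀ {k d} m r (ts : List (FFTerm k d)) t x → evFF m (scaleFF r ts) t x ≡ r ℚ.* evFF m ts t x
evFF-scale m r [] t x = sym (ℚP.*-zeroʳ r)
evFF-scale m r (ffterm e c b ∷ ts) t x rewrite evFF-scale m r ts t x = lemma r (ff m e t) (evP c x) (evFF m ts t x)
  where
  lemma : ∀ r f c s → f ℚ.* (r ℚ.* c) ℚ.+ r ℚ.* s ≡ r ℚ.* (f ℚ.* c ℚ.+ s)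
  lemma = Solver.solve-∀ ℚ-ring

wkFF : ∀ {k d} → List (FFTerm k d) → List (FFTerm k (suc d))
wkFF []                     = []
wkFF (ffterm e c b ∷ ts) = ffterm e (wk c) (trans (ℕP.+-suc e _) (cong suc b)) ∷ wkFF ts

evFF-wk : ∀ {k d} m (ts : List (FFTerm k d)) t x → evFF m (wkFF ts) t x ≡ evFF m ts t x
evFF-wk m [] t x = refl
evFF-wk m (ffterm e c b ∷ ts) t x = cong (ff m e t ℚ.* evP c x ℚ.+_) (evFF-wk m ts t x)

-- Uses t · ff e = ff (1 + e) + e m · ff e.
mulFF : ∀ {k d} → ℚ → ℤ → Aff k → List (FFTerm k d) → List (FFTerm k (suc d))
mulFF m α ℓ []                     = []
mulFF m α ℓ (ffterm e c b ∷ ts) =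
  ffterm (suc e) (scale (ℤ→ℚ α) c) (cong suc b) ∷
  ffterm e (wk (scale (ℤ→ℚ α ℚ.* (ℕ→ℚ e ℚ.* m)) c)) b' ∷
  ffterm e (mul ℓ c) b' ∷ mulFF m α ℓ ts
  where
  b' = trans (ℕP.+-suc e _) (cong suc b)

evFF-mul : ∀ {k d} m α ℓ (ts : List (FFTerm k d)) t x →
  evFF m (mulFF m α ℓ ts) t x ≡ (ℤ→ℚ α ℚ.* t ℚ.+ ℤ→ℚ (val ℓ x)) ℚ.* evFF m ts t x
evFF-mul m α ℓ [] t x = sym (ℚP.*-zeroʳ (ℤ→ℚ α ℚ.* t ℚ.+ ℤ→ℚ (val ℓ x)))
evFF-mul m α ℓ (ffterm e c b ∷ ts) t x rewrite evFF-mul m α ℓ ts t x =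
  lemma (ℤ→ℚ α) (ℤ→ℚ (val ℓ x)) (ℕ→ℚ e) m t (ff m e t) (evP c x) (evFF m ts t x)
  where
  lemma : ∀ α v e m t f c s →
    (t ℚ.- e ℚ.* m) ℚ.* f ℚ.* (α ℚ.* c) ℚ.+ (f ℚ.* (α ℚ.* (e ℚ.* m) ℚ.* c) ℚ.+ (f ℚ.* (v ℚ.* c) ℚ.+ (α ℚ.* t ℚ.+ v) ℚ.* s))
    ≡ (α ℚ.* t ℚ.+ v) ℚ.* (f ℚ.* c ℚ.+ s)
  lemma = Solver.solve-∀ ℚ-ring

toFF : ∀ {k d} → ℚ → Pol (suc k) d → List (FFTerm k d)
toFF m one         = ffterm 0 one refl ∷ []
toFF m (add p q)   = toFF m p L.++ toFF m q
toFF m (scale r p) = scaleFF r (toFF m p)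
toFF m (wk p)      = wkFF (toFF m p)
toFF m (mul (aff c (α ∷ as)) p) = mulFF m α (aff c as) (toFF m p)

evFF-toFF : ∀ {k d} m (p : Pol (suc k) d) y x → evFF m (toFF m p) (ℕ→ℚ y) x ≡ evP p (y ∷ x)
evFF-toFF m one y x = refl
evFF-toFF m (add p q) y x = trans (evFF-++ m (toFF m p) (toFF m q) (ℕ→ℚ y) x) (cong₂ ℚ._+_ (evFF-toFF m p y x) (evFF-toFF m q y x))
evFF-toFF m (scale r p) y x = trans (evFF-scale m r (toFF m p) (ℕ→ℚ y) x) (cong (r ℚ.*_) (evFF-toFF m p y x))
evFF-toFF m (wk p) y x = trans (evFF-wk m (toFF m p) (ℕ→ℚ y) x) (evFF-toFF m p y x)
evFF-toFF m (mul (aff c (α ∷ as)) p) y x = trans (evFF-mul m α (aff c as) (toFF m p) (ℕ→ℚ y) x)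
  (cong₂ ℚ._*_ eq (evFF-toFF m p y x))
  where
  lemma : ∀ c t d → c ℤ.+ (t ℤ.+ d) ≡ t ℤ.+ (c ℤ.+ d)
  lemma = solve-∀
  eq : ℤ→ℚ α ℚ.* ℕ→ℚ y ℚ.+ ℤ→ℚ (c ℤ.+ dot as x) ≡ ℤ→ℚ (c ℤ.+ (α ℤ.* + y ℤ.+ dot as x))
  eq = sym (trans (cong ℤ→ℚ (lemma c (α ℤ.* + y) (dot as x)))
        (trans (ℤ→ℚ-+ (α ℤ.* + y) (c ℤ.+ dot as x)) (cong (ℚ._+ ℤ→ℚ (c ℤ.+ dot as x)) (ℤ→ℚ-* α (+ y)))))

tailMap : ∀ {k} → Fin k → Aff (suc k)
tailMap i = coordA (suc i)

Rel-tailMap : ∀ {k} y (x : Vec ℕ k) → Rel 0 tailMap (y ∷ x) x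
Rel-tailMap y x i = trans (val-coordA (suc i) (y ∷ x)) (sym (ℤP.*-identityˡ _))

fromFF : ∀ {k d} → ℕ → (e : ℕ) → Pol k d → Pol (suc k) (e ℕ.+ d)
fromFF M zero    c = proj₁ (subst-Pol 0 tailMap c)
fromFF M (suc e) c = mul (coordA zero ⊞ constA (ℤ.- (+ e ℤ.* + M))) (fromFF M e c)

evP-fromFF : ∀ {k d} M e (c : Pol k d) y x → evP (fromFF M e c) (y ∷ x) ≡ ff (ℕ→ℚ M) e (ℕ→ℚ y) ℚ.* evP c x
evP-fromFF M zero    c y x = trans (proj₂ (subst-Pol 0 tailMap c) _ _ (Rel-tailMap y x)) (sym (ℚP.*-identityˡ _))
evP-fromFF M (suc e) c y x = begin
  ℤ→ℚ (val (coordA zero ⊞ constA (ℤ.- (+ e ℤ.* + M))) (y ∷ x)) ℚ.* evP (fromFF M e c) (y ∷ x)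
    ≡⟨ cong₂ (λ u v → ℤ→ℚ u ℚ.* v) (trans (val-⊞ (coordA zero) (constA (ℤ.- (+ e ℤ.* + M))) (y ∷ x)) (cong₂ ℤ._+_ (val-coordA zero (y ∷ x)) (val-constA (ℤ.- (+ e ℤ.* + M)) (y ∷ x)))) (evP-fromFF M e c y x) ⟩
  ℤ→ℚ (+ y ℤ.+ ℤ.- (+ e ℤ.* + M)) ℚ.* (f ℚ.* evP c x)
    ≡⟨ cong (ℚ._* (f ℚ.* evP c x)) eq ⟩
  (ℕ→ℚ y ℚ.+ ℤ→ℚ (ℤ.- + 1) ℚ.* (ℕ→ℚ e ℚ.* ℕ→ℚ M)) ℚ.* (f ℚ.* evP c x)
    ≡⟨ lemma (ℕ→ℚ y) (ℕ→ℚ e) (ℕ→ℚ M) f (evP c x) ⟩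
  (ℕ→ℚ y ℚ.- ℕ→ℚ e ℚ.* ℕ→ℚ M) ℚ.* f ℚ.* evP c x ∎
  where
  open ≡-Reasoning
  f = ff (ℕ→ℚ M) e (ℕ→ℚ y)
  eq : ℤ→ℚ (+ y ℤ.+ ℤ.- (+ e ℤ.* + M)) ≡ ℕ→ℚ y ℚ.+ ℤ→ℚ (ℤ.- + 1) ℚ.* (ℕ→ℚ e ℚ.* ℕ→ℚ M)
  eq = trans (ℤ→ℚ-+ (+ y) (ℤ.- (+ e ℤ.* + M))) (cong (ℕ→ℚ y ℚ.+_)
    (trans (cong ℤ→ℚ (sym (ℤP.-1*i≡-i (+ e ℤ.* + M)))) (trans (ℤ→ℚ-* (ℤ.- + 1) (+ e ℤ.* + M)) (cong (ℤ→ℚ (ℤ.- + 1) ℚ.*_) (ℤ→ℚ-* (+ e) (+ M))))))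
  lemma : ∀ y e m f c → (y ℚ.+ (ℚ.- 1ℚ) ℚ.* (e ℚ.* m)) ℚ.* (f ℚ.* c) ≡ (y ℚ.- e ℚ.* m) ℚ.* f ℚ.* c
  lemma = Solver.solve-∀ ℚ-ring

zeroP : ∀ {k d} → Pol k d
zeroP {d = zero}  = scale 0ℚ one
zeroP {d = suc d} = wk zeroP

evP-zeroP : ∀ {k} d (x : Vec ℕ k) → evP (zeroP {d = d}) x ≡ 0ℚ
evP-zeroP zero    x = refl
evP-zeroP (suc d) x = evP-zeroP d x

-- The power rule read backwards: with m = `suc P`, the term ff m e · c has the antidifference ff m
-- (e + 1) · c / ((e + 1) m) for step m.
antidiffFF : ∀ {k d} P (ts : List (FFTerm k d)) → Σ (Pol (suc k) (suc d)) λ G → ∀ y x →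
  evP G (suc P ℕ.+ y ∷ x) ≡ evP G (y ∷ x) ℚ.+ evFF (ℕ→ℚ (suc P)) ts (ℕ→ℚ y) x
antidiffFF {d = d} P [] = zeroP , λ y x → trans (evP-zeroP d (suc P ℕ.+ y ∷ x)) (sym (trans (ℚP.+-identityʳ _) (evP-zeroP d (y ∷ x))))
antidiffFF P (ffterm e c refl ∷ ts) with antidiffFF P ts | ℤ→ℚ-inverse (+ suc e ℤ.* + suc P) (λ ())
... | G , h | r , inv = add (scale r (fromFF (suc P) (suc e) c)) G , λ y x → begin
    r ℚ.* evP (fromFF (suc P) (suc e) c) (suc P ℕ.+ y ∷ x) ℚ.+ evP G (suc P ℕ.+ y ∷ x)
      ≡⟨ cong₂ (λ u v → r ℚ.* u ℚ.+ v) (trans (evP-fromFF (suc P) (suc e) c (suc P ℕ.+ y) x) (cong (λ u → ff m (suc e) u ℚ.* evP c x) (trans (ℤ→ℚ-+ (+ suc P) (+ y)) (ℚP.+-comm m (ℕ→ℚ y))))) (h y x) ⟩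
    r ℚ.* (ff m (suc e) (ℕ→ℚ y ℚ.+ m) ℚ.* evP c x) ℚ.+ (evP G (y ∷ x) ℚ.+ evFF m ts (ℕ→ℚ y) x)
      ≡⟨ cong (λ u → r ℚ.* (u ℚ.* evP c x) ℚ.+ (evP G (y ∷ x) ℚ.+ evFF m ts (ℕ→ℚ y) x)) (ff-diff m e (ℕ→ℚ y)) ⟩
    r ℚ.* ((ff m (suc e) (ℕ→ℚ y) ℚ.+ ℕ→ℚ (suc e) ℚ.* m ℚ.* ff m e (ℕ→ℚ y)) ℚ.* evP c x) ℚ.+ (evP G (y ∷ x) ℚ.+ evFF m ts (ℕ→ℚ y) x)
      ≡⟨ lemma r (ff m (suc e) (ℕ→ℚ y)) (ℕ→ℚ (suc e)) m (ff m e (ℕ→ℚ y)) (evP c x) (evP G (y ∷ x)) (evFF m ts (ℕ→ℚ y) x) ⟩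
    r ℚ.* (ff m (suc e) (ℕ→ℚ y) ℚ.* evP c x) ℚ.+ evP G (y ∷ x) ℚ.+ (r ℚ.* (ℕ→ℚ (suc e) ℚ.* m) ℚ.* (ff m e (ℕ→ℚ y) ℚ.* evP c x) ℚ.+ evFF m ts (ℕ→ℚ y) x)
      ≡⟨ cong₂ (λ u v → r ℚ.* u ℚ.+ evP G (y ∷ x) ℚ.+ (v ℚ.* (ff m e (ℕ→ℚ y) ℚ.* evP c x) ℚ.+ evFF m ts (ℕ→ℚ y) x)) (sym (evP-fromFF (suc P) (suc e) c y x)) inv' ⟩
    r ℚ.* evP (fromFF (suc P) (suc e) c) (y ∷ x) ℚ.+ evP G (y ∷ x) ℚ.+ (1ℚ ℚ.* (ff m e (ℕ→ℚ y) ℚ.* evP c x) ℚ.+ evFF m ts (ℕ→ℚ y) x)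
      ≡⟨ cong (λ u → r ℚ.* evP (fromFF (suc P) (suc e) c) (y ∷ x) ℚ.+ evP G (y ∷ x) ℚ.+ (u ℚ.+ evFF m ts (ℕ→ℚ y) x)) (ℚP.*-identityˡ (ff m e (ℕ→ℚ y) ℚ.* evP c x)) ⟩
    r ℚ.* evP (fromFF (suc P) (suc e) c) (y ∷ x) ℚ.+ evP G (y ∷ x) ℚ.+ (ff m e (ℕ→ℚ y) ℚ.* evP c x ℚ.+ evFF m ts (ℕ→ℚ y) x) ∎
  where
  open ≡-Reasoning
  m = ℕ→ℚ (suc P)
  inv' : r ℚ.* (ℕ→ℚ (suc e) ℚ.* m) ≡ 1ℚ
  inv' = trans (cong (r ℚ.*_) (sym (ℤ→ℚ-* (+ suc e) (+ suc P)))) inv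
  lemma : ∀ r F e m f c G T → r ℚ.* ((F ℚ.+ e ℚ.* m ℚ.* f) ℚ.* c) ℚ.+ (G ℚ.+ T) ≡ r ℚ.* (F ℚ.* c) ℚ.+ G ℚ.+ (r ℚ.* (e ℚ.* m) ℚ.* (f ℚ.* c) ℚ.+ T)
  lemma = Solver.solve-∀ ℚ-ring

antidiff : ∀ {k d} P (p : Pol (suc k) d) → Σ (Pol (suc k) (suc d)) λ G → ∀ y x →
  evP G (suc P ℕ.+ y ∷ x) ≡ evP G (y ∷ x) ℚ.+ evP p (y ∷ x)
antidiff P p with antidiffFF P (toFF (ℕ→ℚ (suc P)) p)
... | G , h = G , λ y x → trans (h y x) (cong (evP G (y ∷ x) ℚ.+_) (evFF-toFF (ℕ→ℚ (suc P)) p y x))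

gate : Bool → ℚ → ℚ
gate b q = if b then q else 0ℚ

gate-∧ : ∀ a b q → gate (a ∧ b) q ≡ gate a (gate b q)
gate-∧ true  b q = refl
gate-∧ false b q = refl

gate-+ : ∀ a p q → gate a (p ℚ.+ q) ≡ gate a p ℚ.+ gate a q
gate-+ true  p q = refl
gate-+ false p q = refl

gate-0 : ∀ a → gate a 0ℚ ≡ 0ℚ
gate-0 true  = refl
gate-0 false = refl

gate-* : ∀ a r q → gate a (r ℚ.* q) ≡ r ℚ.* gate a q
gate-* true  r q = refl
gate-* false r q = sym (ℚP.*-zeroʳ r)

-- Sums of polynomials gated by formulas

PP : ℕ → ℕ → Set
PP k d = List (QF k × Pol k d)

evPP : ∀ {k d} → PP k d → Vec ℕ k → ℚ
evPP []            x = 0ℚ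
evPP ((φ , p) ∷ g) x = gate (ev φ x) (evP p x) ℚ.+ evPP g x

evPP-++ : ∀ {k d} (g h : PP k d) x → evPP (g L.++ h) x ≡ evPP g x ℚ.+ evPP h x
evPP-++ []            h x = sym (ℚP.+-identityˡ _)
evPP-++ ((φ , p) ∷ g) h x rewrite evPP-++ g h x = sym (ℚP.+-assoc (gate (ev φ x) (evP p x)) (evPP g x) (evPP h x))

guard : ∀ {k d} → QF k → PP k d → PP k d
guard ψ []            = []
guard ψ ((φ , p) ∷ g) = (and ψ φ , p) ∷ guard ψ g

evPP-guard : ∀ {k d} ψ (g : PP k d) x → evPP (guard ψ g) x ≡ gate (ev ψ x) (evPP g x)
evPP-guard ψ []            x = sym (gate-0 (ev ψ x))
evPP-guard ψ ((φ , p) ∷ g) x rewrite evPP-guard ψ g x | gate-∧ (ev ψ x) (ev φ x) (evP p x) =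
  sym (gate-+ (ev ψ x) (gate (ev φ x) (evP p x)) (evPP g x))

scalePP : ∀ {k d} → ℚ → PP k d → PP k d
scalePP r []            = []
scalePP r ((φ , p) ∷ g) = (φ , scale r p) ∷ scalePP r g

evPP-scale : ∀ {k d} r (g : PP k d) x → evPP (scalePP r g) x ≡ r ℚ.* evPP g x
evPP-scale r []            x = sym (ℚP.*-zeroʳ r)
evPP-scale r ((φ , p) ∷ g) x rewrite evPP-scale r g x | gate-* (ev φ x) r (evP p x) =
  sym (ℚP.*-distribˡ-+ r (gate (ev φ x) (evP p x)) (evPP g x))

subst-PP : ∀ {k l d} a (σ : Fin k → Aff l) (g : PP k d) →
  Σ (PP l d) λ g' → ∀ z x → Rel a σ z x → evPP g' z ≡ evPP g x
subst-PP a σ []            = [] , λ z x r → refl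
subst-PP a σ ((φ , p) ∷ g) with subst-QF a σ φ | subst-Pol a σ p | subst-PP a σ g
... | φ' , h₁ | p' , h₂ | g' , h₃ = (φ' , p') ∷ g' ,
  λ z x r → cong₂ ℚ._+_ (cong₂ gate (h₁ z x r) (h₂ z x r)) (h₃ z x r)

atPP : ∀ {k d} → Point k → PP (suc k) d → PP k d
atPP p g = guard (defined p) (proj₁ (subst-PP (proj₁ p) (headMap p) g))

evPP-at : ∀ {k d} (p : Point k) (g : PP (suc k) d) {y x} → On p y x → evPP (atPP p g) x ≡ evPP g (y ∷ x)
evPP-at p g {y} {x} on = trans (evPP-guard (defined p) (proj₁ (subst-PP (proj₁ p) (headMap p) g)) x)
  (trans (cong (λ b → gate b (evPP (proj₁ (subst-PP (proj₁ p) (headMap p) g)) x)) (defined⁺ p on))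
    (proj₂ (subst-PP (proj₁ p) (headMap p) g) _ _ (Rel-headMap p on)))

evPP-at-undefined : ∀ {k d} (p : Point k) (g : PP (suc k) d) {x} → ev (defined p) x ≡ false → evPP (atPP p g) x ≡ 0ℚ
evPP-at-undefined p g {x} e = trans (evPP-guard (defined p) (proj₁ (subst-PP (proj₁ p) (headMap p) g)) x)
  (cong (λ b → gate b (evPP (proj₁ (subst-PP (proj₁ p) (headMap p) g)) x)) e)

-- Finite sums of rationals

sumTo : ℕ → (ℕ → ℚ) → ℚ
sumTo zero    f = 0ℚ
sumTo (suc n) f = sumTo n f ℚ.+ f n

sumTo-cong : ∀ n {f g : ℕ → ℚ} → (∀ y → y ℕ.< n → f y ≡ g y) → sumTo n f ≡ sumTo n g
sumTo-cong zero    h = refl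
sumTo-cong (suc n) h = cong₂ ℚ._+_ (sumTo-cong n (λ y lt → h y (ℕP.m≤n⇒m≤1+n lt))) (h n ℕP.≤-refl)

sumTo-0 : ∀ n → sumTo n (λ _ → 0ℚ) ≡ 0ℚ
sumTo-0 zero    = refl
sumTo-0 (suc n) = trans (ℚP.+-identityʳ _) (sumTo-0 n)

sumTo-+ : ∀ n (f g : ℕ → ℚ) → sumTo n (λ y → f y ℚ.+ g y) ≡ sumTo n f ℚ.+ sumTo n g
sumTo-+ zero    f g = refl
sumTo-+ (suc n) f g rewrite sumTo-+ n f g = lemma (sumTo n f) (sumTo n g) (f n) (g n)
  where
  lemma : ∀ a b c d → a ℚ.+ b ℚ.+ (c ℚ.+ d) ≡ a ℚ.+ c ℚ.+ (b ℚ.+ d)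
  lemma = Solver.solve-∀ ℚ-ring

sumTo-shift : ∀ n (f : ℕ → ℚ) → f 0 ℚ.+ sumTo n (λ y → f (suc y)) ≡ sumTo n f ℚ.+ f n
sumTo-shift zero    f = ℚP.+-comm (f 0) 0ℚ
sumTo-shift (suc n) f = trans (sym (ℚP.+-assoc (f 0) _ _)) (cong (ℚ._+ f (suc n)) (sumTo-shift n f))

-- Differences with step `M` cancel up to `M` values at either end. Induction on `n` avoids residue
-- classes and covers `n` smaller than `M`, where the two windows overlap.
telescope : ∀ M n (f : ℕ → ℚ) →
  sumTo n (λ y → f (M ℕ.+ y) ℚ.- f y) ≡ sumTo M (λ j → f (n ℕ.+ j)) ℚ.- sumTo M f
telescope M zero    f = sym (ℚP.+-inverseʳ (sumTo M f))
telescope M (suc n) f = begin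
  sumTo n (λ y → f (M ℕ.+ y) ℚ.- f y) ℚ.+ (f (M ℕ.+ n) ℚ.- f n) ≡⟨ cong₂ (λ u v → u ℚ.+ (f v ℚ.- f n)) (telescope M n f) (ℕP.+-comm M n) ⟩
  S ℚ.- T ℚ.+ (f (n ℕ.+ M) ℚ.- f n)                  ≡⟨ lemma₁ S T (f (n ℕ.+ M)) (f n) ⟩
  S ℚ.+ f (n ℕ.+ M) ℚ.- f n ℚ.- T                    ≡⟨ cong (λ u → u ℚ.- f n ℚ.- T) (sym (sumTo-shift M (λ j → f (n ℕ.+ j)))) ⟩
  f (n ℕ.+ 0) ℚ.+ S₁ ℚ.- f n ℚ.- T                   ≡⟨ cong (λ k → f k ℚ.+ S₁ ℚ.- f n ℚ.- T) (ℕP.+-identityʳ n) ⟩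
  f n ℚ.+ S₁ ℚ.- f n ℚ.- T                           ≡⟨ lemma₂ (f n) S₁ T ⟩
  S₁ ℚ.- T                                           ≡⟨ cong (ℚ._- T) (sumTo-cong M (λ j _ → cong f (ℕP.+-suc n j))) ⟩
  sumTo M (λ j → f (suc n ℕ.+ j)) ℚ.- T ∎
  where
  open ≡-Reasoning
  S = sumTo M (λ j → f (n ℕ.+ j))
  S₁ = sumTo M (λ j → f (n ℕ.+ suc j))
  T = sumTo M f
  lemma₁ : ∀ s t a b → s ℚ.- t ℚ.+ (a ℚ.- b) ≡ s ℚ.+ a ℚ.- b ℚ.- t
  lemma₁ = Solver.solve-∀ ℚ-ring
  lemma₂ : ∀ a s t → a ℚ.+ s ℚ.- a ℚ.- t ≡ s ℚ.- t
  lemma₂ = Solver.solve-∀ ℚ-ring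

sumTo-avoid : ∀ n y₀ (f g : ℕ → ℚ) → n ℕ.≤ y₀ → (∀ y → y ≢ y₀ → g y ≡ f y) → sumTo n f ≡ sumTo n g
sumTo-avoid n y₀ f g n≤y₀ h = sumTo-cong n (λ y y<n → sym (h y (ℕP.<⇒≢ (ℕP.<-≤-trans y<n n≤y₀))))

sumTo-extract : ∀ n y₀ (f g : ℕ → ℚ) → y₀ ℕ.< n → (∀ y → y ≢ y₀ → g y ≡ f y) → g y₀ ≡ 0ℚ →
  sumTo n f ≡ f y₀ ℚ.+ sumTo n g
sumTo-extract (suc n) y₀ f g (ℕ.s≤s y₀≤n) h z with y₀ ℕ.≟ n
... | yes refl = begin
  sumTo n f ℚ.+ f n            ≡⟨ ℚP.+-comm (sumTo n f) (f n) ⟩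
  f n ℚ.+ sumTo n f            ≡⟨ cong (f n ℚ.+_) (sumTo-avoid n n f g ℕP.≤-refl h) ⟩
  f n ℚ.+ sumTo n g            ≡⟨ cong (f n ℚ.+_) (sym (ℚP.+-identityʳ (sumTo n g))) ⟩
  f n ℚ.+ (sumTo n g ℚ.+ 0ℚ)   ≡⟨ cong (λ u → f n ℚ.+ (sumTo n g ℚ.+ u)) (sym z) ⟩
  f n ℚ.+ (sumTo n g ℚ.+ g n) ∎
  where open ≡-Reasoning
... | no ≢ = trans (cong₂ ℚ._+_ (sumTo-extract n y₀ f g (ℕP.≤∧≢⇒< y₀≤n ≢) h z) (sym (h n (≢ ∘ sym))))
                   (ℚP.+-assoc (f y₀) (sumTo n g) (g n))

-- Sums supported on break points

onQF : ∀ {k} → Point k → QF (suc k)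
onQF (a , aff c as) = eqQF (+ suc a ⊠ coordA zero) (aff c (+ 0 ∷ as))

ev-onQF : ∀ {k} ((a , q) : Point k) y x → ev (onQF (a , q)) (y ∷ x) ≡ does (+ suc a ℤ.* + y ℤP.≟ val q x)
ev-onQF (a , aff c as) y x = trans (ev-eqQF (+ suc a ⊠ coordA zero) (aff c (+ 0 ∷ as)) (y ∷ x))
  (cong₂ (λ u v → does (u ℤP.≟ v))
    (trans (val-⊠ (+ suc a) (coordA zero) (y ∷ x)) (cong (+ suc a ℤ.*_) (val-coordA zero (y ∷ x))))
    (cong (λ w → c ℤ.+ w) (ℤP.+-identityˡ (dot as x))))

-- y < N without division: for (1 + a) y = q this is q + 1 ≤ (1 + a) N.
belowQF : ∀ {k} → Point k → Aff k → QF k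
belowQF (a , q) N = leQF (q ⊞ constA (+ 1)) (+ suc a ⊠ N)

ev-belowQF : ∀ {k} (p : Point k) N {y ν x} → On p y x → val N x ≡ + ν → ev (belowQF p N) x ≡ does (y ℕ.<? ν)
ev-belowQF (a , q) N {y} {ν} {x} on eq = trans (ev-leQF (q ⊞ constA (+ 1)) (+ suc a ⊠ N) x)
  (does-⇔ (mk⇔ to from) (_ ℤ.≤? _) (y ℕ.<? ν))
  where
  lhs : val (q ⊞ constA (+ 1)) x ≡ + (suc (suc a ℕ.* y))
  lhs = begin
    val (q ⊞ constA (+ 1)) x    ≡⟨ trans (val-⊞ q (constA (+ 1)) x) (cong (λ w → val q x ℤ.+ w) (val-constA (+ 1) x)) ⟩
    val q x ℤ.+ + 1             ≡⟨ ℤP.+-comm (val q x) (+ 1) ⟩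
    + 1 ℤ.+ val q x             ≡⟨ cong (λ w → + 1 ℤ.+ w) (trans (sym on) (sym (ℤP.pos-* (suc a) y))) ⟩
    + suc (suc a ℕ.* y) ∎
    where open ≡-Reasoning
  rhs : val (+ suc a ⊠ N) x ≡ + (suc a ℕ.* ν)
  rhs = trans (val-⊠ (+ suc a) N x) (trans (cong (+ suc a ℤ.*_) eq) (sym (ℤP.pos-* (suc a) ν)))
  to : val (q ⊞ constA (+ 1)) x ℤ.≤ val (+ suc a ⊠ N) x → y ℕ.< ν
  to le = ℕP.*-cancelˡ-< (suc a) y ν (ℤP.drop‿+≤+ (subst₂ ℤ._≤_ lhs rhs le))
  from : y ℕ.< ν → val (q ⊞ constA (+ 1)) x ℤ.≤ val (+ suc a ⊠ N) x
  from lt = subst₂ ℤ._≤_ (sym lhs) (sym rhs) (ℤ.+≤+ (ℕP.*-monoʳ-< (suc a) lt))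

-- The limit is an affine form, which may be negative; nothing is claimed there.
SumOf : ∀ {k d} → PP (suc k) d → Aff k → PP k d → Set
SumOf g N s = ∀ x ν → val N x ≡ + ν → evPP s x ≡ sumTo ν (λ y → evPP g (y ∷ x))

-- A function supported on finitely many points is summed point by point; a point already
-- treated is removed from the support, so coinciding points are counted once.
sum-sparse : ∀ {k d} (N : Aff k) (ps : List (Point k)) (g : PP (suc k) d) →
  (∀ y x → evPP g (y ∷ x) ≡ 0ℚ ⊎ Any (λ p → On p y x) ps) → Σ (PP k d) (SumOf g N)
sum-sparse N [] g supp = [] , λ x ν _ → sym (trans (sumTo-cong ν (λ y _ → vanish y x)) (sumTo-0 ν))
  where
  vanish : ∀ y x → evPP g (y ∷ x) ≡ 0ℚ
  vanish y x with supp y x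
  ... | inj₁ e = e
sum-sparse {k} {d} N (p@(a , q) ∷ ps) g supp = s , correct
  where
  g' : PP (suc k) d
  g' = guard (neg (onQF p)) g
  off : ∀ y x → ¬ On p y x → evPP g' (y ∷ x) ≡ evPP g (y ∷ x)
  off y x n = trans (evPP-guard (neg (onQF p)) g (y ∷ x))
    (cong (λ b → gate (not b) (evPP g (y ∷ x))) (trans (ev-onQF p y x) (dec-false (_ ℤP.≟ _) n)))
  on-0 : ∀ y x → On p y x → evPP g' (y ∷ x) ≡ 0ℚ
  on-0 y x o = trans (evPP-guard (neg (onQF p)) g (y ∷ x))
    (cong (λ b → gate (not b) (evPP g (y ∷ x))) (trans (ev-onQF p y x) (dec-true (_ ℤP.≟ _) o)))
  supp' : ∀ y x → evPP g' (y ∷ x) ≡ 0ℚ ⊎ Any (λ p → On p y x) ps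
  supp' y x with + suc a ℤ.* + y ℤP.≟ val q x
  ... | yes o = inj₁ (on-0 y x o)
  ... | no n with supp y x
  ...   | inj₁ e         = inj₁ (trans (off y x n) e)
  ...   | inj₂ (here o)  = contradiction o n
  ...   | inj₂ (there b) = inj₂ b
  rest = sum-sparse N ps g' supp'
  first : PP k d
  first = guard (belowQF p N) (atPP p g)
  s = first L.++ proj₁ rest
  correct : SumOf g N s
  correct x ν eq = trans (evPP-++ first (proj₁ rest) x) (trans (cong₂ ℚ._+_ (evPP-guard (belowQF p N) (atPP p g) x) (proj₂ rest x ν eq)) main)
    where
    rhs = sumTo ν (λ y → evPP g' (y ∷ x))
    main : gate (ev (belowQF p N) x) (evPP (atPP p g) x) ℚ.+ rhs ≡ sumTo ν (λ y → evPP g (y ∷ x))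
    main with ev (defined p) x in def
    ... | false = trans (cong (ℚ._+ rhs) (trans (cong (gate (ev (belowQF p N) x)) (evPP-at-undefined p g def)) (gate-0 (ev (belowQF p N) x))))
                   (trans (ℚP.+-identityˡ rhs) (sumTo-cong ν (λ y _ → off y x (λ o → undef (trans (sym def) (defined⁺ p o))))))
      where
      undef : false ≢ true
      undef ()
    ... | true with defined⁻ p def
    ...   | y₀ , o with y₀ ℕ.<? ν
    ...     | yes lt = trans (cong (ℚ._+ rhs) (cong₂ gate (trans (ev-belowQF p N o eq) (dec-true (y₀ ℕ.<? ν) lt)) (evPP-at p g o)))
                (sym (sumTo-extract ν y₀ (λ y → evPP g (y ∷ x)) (λ y → evPP g' (y ∷ x)) lt
                  (λ y ≢y₀ → off y x (λ o' → ≢y₀ (On-unique p o' o))) (on-0 y₀ x o)))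
    ...     | no ≮ = trans (cong (ℚ._+ rhs) (cong (λ b → gate b (evPP (atPP p g) x)) (trans (ev-belowQF p N o eq) (dec-false (y₀ ℕ.<? ν) ≮))))
                (trans (ℚP.+-identityˡ rhs) (sym (sumTo-avoid ν y₀ (λ y → evPP g (y ∷ x)) (λ y → evPP g' (y ∷ x)) (ℕP.≮⇒≥ ≮)
                  (λ y ≢y₀ → off y x (λ o' → ≢y₀ (On-unique p o' o))))))

-- Sums of gated polynomials up to an affine limit

sumPP : ∀ {k d} → ℕ → (ℕ → PP k d) → PP k d
sumPP zero    g = []
sumPP (suc n) g = sumPP n g L.++ g n

evPP-sumPP : ∀ {k d} n (g : ℕ → PP k d) x → evPP (sumPP n g) x ≡ sumTo n (λ j → evPP (g j) x)
evPP-sumPP zero    g x = refl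
evPP-sumPP (suc n) g x = trans (evPP-++ (sumPP n g) (g n) x) (cong (ℚ._+ evPP (g n) x) (evPP-sumPP n g x))

-- The boundary terms left by `telescope`. Their number `M` does not depend on x, so they are
-- evaluations at the points N + j and keep the degree; the limit 0 gives the lower boundary.
sum-window : ∀ {k d} (N : Aff k) M (φ : QF (suc k)) (G : Pol (suc k) d) →
  Σ (PP k d) λ s → ∀ x ν → val N x ≡ + ν → evPP s x ≡ sumTo M (λ j → gate (ev φ (ν ℕ.+ j ∷ x)) (evP G (ν ℕ.+ j ∷ x)))
sum-window N M φ G = sumPP M (λ j → atPP (top j) ((φ , G) ∷ [])) , λ x ν eq →
  trans (evPP-sumPP M (λ j → atPP (top j) ((φ , G) ∷ [])) x)
    (sumTo-cong M (λ j _ → trans (evPP-at (top j) ((φ , G) ∷ []) (On-top j eq)) (ℚP.+-identityʳ (gate (ev φ (ν ℕ.+ j ∷ x)) (evP G (ν ℕ.+ j ∷ x))))))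
  where
  top : ℕ → Point _
  top j = 0 , N ⊞ constA (+ j)
  On-top : ∀ j {x ν} → val N x ≡ + ν → On (top j) (ν ℕ.+ j) x
  On-top j {x} {ν} eq = trans (ℤP.*-identityˡ (+ (ν ℕ.+ j)))
    (sym (trans (val-⊞ N (constA (+ j)) x) (cong₂ ℤ._+_ eq (val-constA (+ j) x))))

-- The correction for the failure of periodicity. By `crossing` it vanishes off the break points, so
-- `sum-sparse` sums it without raising the degree.
sum-breaks : ∀ {k d} (N : Aff k) M (φ : QF (suc k)) → Period M φ → (G : Pol (suc k) d) →
  Σ (PP k d) λ s → ∀ x ν → val N x ≡ + ν → evPP s x ≡
    sumTo ν (λ y → gate (ev φ (y ∷ x)) (evP G (M ℕ.+ y ∷ x)) ℚ.- gate (ev φ (M ℕ.+ y ∷ x)) (evP G (M ℕ.+ y ∷ x)))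
sum-breaks {k} {d} N M φ per G = proj₁ sparse , λ x ν eq →
  trans (proj₂ sparse x ν eq) (sumTo-cong ν (λ y _ → ev-D y x))
  where
  Gs : Pol (suc k) d
  Gs = proj₁ (subst-Pol 0 (shiftMap M) G)
  D : PP (suc k) d
  D = (φ , Gs) ∷ (shift M φ , scale (ℚ.- 1ℚ) Gs) ∷ []
  ev-D : ∀ y x → evPP D (y ∷ x) ≡ gate (ev φ (y ∷ x)) (evP G (M ℕ.+ y ∷ x)) ℚ.- gate (ev φ (M ℕ.+ y ∷ x)) (evP G (M ℕ.+ y ∷ x))
  ev-D y x = lemma (ev φ (y ∷ x)) (ev-shift M φ y x) (proj₂ (subst-Pol 0 (shiftMap M) G) (y ∷ x) (M ℕ.+ y ∷ x) (Rel-shiftMap M y x))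
    where
    identity : ∀ a b → a ℚ.+ ((ℚ.- 1ℚ) ℚ.* b ℚ.+ 0ℚ) ≡ a ℚ.- b
    identity = Solver.solve-∀ ℚ-ring
    lemma : ∀ b {b₁ b₂ t u} → b₁ ≡ b₂ → t ≡ u →
      gate b t ℚ.+ (gate b₁ ((ℚ.- 1ℚ) ℚ.* t) ℚ.+ 0ℚ) ≡ gate b u ℚ.- gate b₂ u
    lemma b {b₁} {t = t} refl refl = trans (cong (λ w → gate b t ℚ.+ (w ℚ.+ 0ℚ)) (gate-* b₁ (ℚ.- 1ℚ) t)) (identity (gate b t) (gate b₁ t))
  supp : ∀ y x → evPP D (y ∷ x) ≡ 0ℚ ⊎ Any (λ p → On p y x) (breaks M φ)
  supp y x with crossing M φ per y x
  ... | inj₂ a = inj₂ a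
  ... | inj₁ e = inj₁ (trans (ev-D y x) (trans (cong (λ b → gate b (evP G (M ℕ.+ y ∷ x)) ℚ.- gate (ev φ (M ℕ.+ y ∷ x)) (evP G (M ℕ.+ y ∷ x))) e)
                        (ℚP.+-inverseʳ (gate (ev φ (M ℕ.+ y ∷ x)) (evP G (M ℕ.+ y ∷ x))))))
  sparse : Σ (PP k d) (SumOf D N)
  sparse = sum-sparse N (breaks M φ) D supp

-- With q(y) = G(M + y) − G(y) and u = [b] G, one has
-- [b(y)] q(y) = u(M + y) − u(y) + ([b(y)] − [b(M + y)]) G(M + y).
summation-by-parts : ∀ M ν (b : ℕ → Bool) (G q : ℕ → ℚ) → (∀ y → G (M ℕ.+ y) ≡ G y ℚ.+ q y) →
  sumTo M (λ j → gate (b (ν ℕ.+ j)) (G (ν ℕ.+ j))) ℚ.- sumTo M (λ j → gate (b j) (G j))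
    ℚ.+ sumTo ν (λ y → gate (b y) (G (M ℕ.+ y)) ℚ.- gate (b (M ℕ.+ y)) (G (M ℕ.+ y)))
  ≡ sumTo ν (λ y → gate (b y) (q y))
summation-by-parts M ν b G q diff = begin
  sumTo M (λ j → U (ν ℕ.+ j)) ℚ.- sumTo M U ℚ.+ sumTo ν V    ≡⟨ cong (ℚ._+ sumTo ν V) (sym (telescope M ν U)) ⟩
  sumTo ν (λ y → U (M ℕ.+ y) ℚ.- U y) ℚ.+ sumTo ν V          ≡⟨ sym (sumTo-+ ν (λ y → U (M ℕ.+ y) ℚ.- U y) V) ⟩
  sumTo ν (λ y → U (M ℕ.+ y) ℚ.- U y ℚ.+ V y)                ≡⟨ sumTo-cong ν (λ y _ → pointwise (b y) (b (M ℕ.+ y)) (diff y)) ⟩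
  sumTo ν (λ y → gate (b y) (q y)) ∎
  where
  open ≡-Reasoning
  U V : ℕ → ℚ
  U y = gate (b y) (G y)
  V y = gate (b y) (G (M ℕ.+ y)) ℚ.- gate (b (M ℕ.+ y)) (G (M ℕ.+ y))
  pointwise : ∀ b₀ b₁ {G₀ G₁ q} → G₁ ≡ G₀ ℚ.+ q →
    gate b₁ G₁ ℚ.- gate b₀ G₀ ℚ.+ (gate b₀ G₁ ℚ.- gate b₁ G₁) ≡ gate b₀ q
  pointwise true b₁ {G₀} {_} {q} refl = identity (gate b₁ (G₀ ℚ.+ q)) G₀ q
    where
    identity : ∀ s G q → s ℚ.- G ℚ.+ (G ℚ.+ q ℚ.- s) ≡ q
    identity = Solver.solve-∀ ℚ-ring
  pointwise false b₁ {_} {G₁} _ = identity (gate b₁ G₁)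
    where
    identity : ∀ s → s ℚ.- 0ℚ ℚ.+ (0ℚ ℚ.- s) ≡ 0ℚ
    identity = Solver.solve-∀ ℚ-ring

evPP-combine : ∀ {k d} (f g h : PP k d) x → evPP (f L.++ scalePP (ℚ.- 1ℚ) g L.++ h) x ≡ evPP f x ℚ.- evPP g x ℚ.+ evPP h x
evPP-combine f g h x = trans (evPP-++ f (scalePP (ℚ.- 1ℚ) g L.++ h) x)
  (trans (cong (evPP f x ℚ.+_) (trans (evPP-++ (scalePP (ℚ.- 1ℚ) g) h x) (cong (ℚ._+ evPP h x) (evPP-scale (ℚ.- 1ℚ) g x))))
    (identity (evPP f x) (evPP g x) (evPP h x)))
  where
  identity : ∀ a b c → a ℚ.+ ((ℚ.- 1ℚ) ℚ.* b ℚ.+ c) ≡ a ℚ.- b ℚ.+ c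
  identity = Solver.solve-∀ ℚ-ring

sum-by-parts : ∀ {k d} (N : Aff k) M (φ : QF (suc k)) → Period M φ → (p : Pol (suc k) d) (G : Pol (suc k) (suc d)) →
  (∀ y x → evP G (M ℕ.+ y ∷ x) ≡ evP G (y ∷ x) ℚ.+ evP p (y ∷ x)) →
  Σ (PP k (suc d)) λ s → ∀ x ν → val N x ≡ + ν → evPP s x ≡ sumTo ν (λ y → gate (ev φ (y ∷ x)) (evP p (y ∷ x)))
sum-by-parts N M φ per p G diff with sum-window N M φ G | sum-window (constA (+ 0)) M φ G | sum-breaks N M φ per G
... | up , up-eq | low , low-eq | brk , brk-eq = up L.++ scalePP (ℚ.- 1ℚ) low L.++ brk , λ x ν eq →
  trans (evPP-combine up low brk x)
    (trans (cong₂ ℚ._+_ (cong₂ ℚ._-_ (up-eq x ν eq) (low-eq x 0 (val-constA (+ 0) x))) (brk-eq x ν eq))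
      (summation-by-parts M ν (λ y → ev φ (y ∷ x)) (λ y → evP G (y ∷ x)) (λ y → evP p (y ∷ x)) (λ y → diff y x)))

abstract
  sum-term : ∀ {k d} (N : Aff k) (φ : QF (suc k)) (p : Pol (suc k) d) →
    Σ (PP k (suc d)) λ s → ∀ x ν → val N x ≡ + ν → evPP s x ≡ sumTo ν (λ y → gate (ev φ (y ∷ x)) (evP p (y ∷ x)))
  sum-term N φ p = sum-by-parts N (suc (proj₁ (∃Period φ))) φ (proj₂ (∃Period φ)) p
    (proj₁ (antidiff (proj₁ (∃Period φ)) p)) (proj₂ (antidiff (proj₁ (∃Period φ)) p))

  sum-PP : ∀ {k d} (N : Aff k) (g : PP (suc k) d) →
    Σ (PP k (suc d)) λ s → ∀ x ν → val N x ≡ + ν → evPP s x ≡ sumTo ν (λ y → evPP g (y ∷ x))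
  sum-PP N [] = [] , λ x ν _ → sym (sumTo-0 ν)
  sum-PP N ((φ , p) ∷ g) = proj₁ (sum-term N φ p) L.++ proj₁ (sum-PP N g) , λ x ν eq →
    trans (evPP-++ (proj₁ (sum-term N φ p)) (proj₁ (sum-PP N g)) x) (trans (cong₂ ℚ._+_ (proj₂ (sum-term N φ p) x ν eq) (proj₂ (sum-PP N g) x ν eq))
      (sym (sumTo-+ ν (λ y → gate (ev φ (y ∷ x)) (evP p (y ∷ x))) (λ y → evPP g (y ∷ x)))))

-- Counting predecessors

∃QF* : ∀ n {k} → QF (n ℕ.+ k) → QF k
∃QF* zero    φ = φ
∃QF* (suc n) φ = ∃QF* n (∃QF φ)

∃QF*⁺ : ∀ {n k} (φ : QF (n ℕ.+ k)) (y : Vec ℕ n) x → ev φ (y ++ x) ≡ true → ev (∃QF* n φ) x ≡ true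
∃QF*⁺ φ []       x t = t
∃QF*⁺ φ (y ∷ ys) x t = ∃QF*⁺ (∃QF φ) ys x (∃QF⁺ φ y (ys ++ x) t)

∃QF*⁻ : ∀ n {k} (φ : QF (n ℕ.+ k)) x → ev (∃QF* n φ) x ≡ true → ∃ λ (y : Vec ℕ n) → ev φ (y ++ x) ≡ true
∃QF*⁻ zero    φ x t = [] , t
∃QF*⁻ (suc n) φ x t with ∃QF*⁻ n (∃QF φ) x t
... | ys , s with ∃QF⁻ φ (ys ++ x) s
...   | y , r = y ∷ ys , r

absA : ∀ {k} → Aff k → Aff k
absA (aff c as) = aff (+ ∣ c ∣) (map (λ a → + ∣ a ∣) as)

absV : ∀ {k} → Vec ℤ k → Vec ℕ k → ℕ
absV []       []       = 0
absV (a ∷ as) (x ∷ xs) = ∣ a ∣ ℕ.* x ℕ.+ absV as xs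

val-absA : ∀ {k} (ℓ : Aff k) x → val (absA ℓ) x ≡ + (∣ cst ℓ ∣ ℕ.+ absV (lin ℓ) x)
val-absA (aff c as) x = cong (λ w → + ∣ c ∣ ℤ.+ w) (go as x)
  where
  go : ∀ {k} (as : Vec ℤ k) x → dot (map (λ a → + ∣ a ∣) as) x ≡ + absV as x
  go []       []       = refl
  go (a ∷ as) (x ∷ xs) = cong₂ ℤ._+_ (sym (ℤP.pos-* ∣ a ∣ x)) (go as xs)

∣val∣≤ : ∀ {k} (ℓ : Aff k) x → ∣ val ℓ x ∣ ℕ.≤ ∣ cst ℓ ∣ ℕ.+ absV (lin ℓ) x
∣val∣≤ (aff c as) x = ℕP.≤-trans (ℤP.∣i+j∣≤∣i∣+∣j∣ c (dot as x)) (ℕP.+-monoʳ-≤ ∣ c ∣ (go as x))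
  where
  go : ∀ {k} (as : Vec ℤ k) x → ∣ dot as x ∣ ℕ.≤ absV as x
  go []       []       = ℕ.z≤n
  go (a ∷ as) (x ∷ xs) = ℕP.≤-trans (ℤP.∣i+j∣≤∣i∣+∣j∣ (a ℤ.* + x) (dot as xs))
    (ℕP.+-mono-≤ (ℕP.≤-reflexive (ℤP.abs-* a (+ x))) (go as xs))

-- A maximum of affine forms is not affine, a sum is. Absolute values of the coefficients make every
-- summand a natural number dominating its point, since y ≤ (1 + a) y = q x; the added 1 makes the
-- bound strict.
beyond : ∀ {k} (ps : List (Point k)) → Σ (Aff k) λ N → Σ (Vec ℕ k → ℕ) λ δ →
  (∀ x → val N x ≡ + δ x) × (∀ y x → Any (λ p → On p y x) ps → y ℕ.< δ x)
beyond [] = constA (+ 0) , (λ _ → 0) , val-constA (+ 0) , λ y x ()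
beyond ((a , q) ∷ ps) with beyond ps
... | N , δ , eq , lt = absA q ⊞ constA (+ 1) ⊞ N , (λ x → bound x ℕ.+ 1 ℕ.+ δ x) , val-bound , below
  where
  bound : Vec ℕ _ → ℕ
  bound x = ∣ cst q ∣ ℕ.+ absV (lin q) x
  val-bound : ∀ x → val (absA q ⊞ constA (+ 1) ⊞ N) x ≡ + (bound x ℕ.+ 1 ℕ.+ δ x)
  val-bound x = trans (val-⊞ (absA q ⊞ constA (+ 1)) N x)
    (cong₂ ℤ._+_ (trans (val-⊞ (absA q) (constA (+ 1)) x) (cong₂ ℤ._+_ (val-absA q x) (val-constA (+ 1) x))) (eq x))
  below : ∀ y x → Any (λ p → On p y x) ((a , q) ∷ ps) → y ℕ.< bound x ℕ.+ 1 ℕ.+ δ x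
  below y x (here on) = ℕP.<-≤-trans (ℕP.≤-<-trans y≤ (ℕP.m<m+n (bound x) (ℕ.s≤s ℕ.z≤n))) (ℕP.m≤m+n (bound x ℕ.+ 1) (δ x))
    where
    y≤ : y ℕ.≤ bound x
    y≤ = ℕP.≤-trans (ℕP.m≤n*m y (suc a)) (ℕP.≤-trans (ℕP.≤-reflexive
      (trans (sym (ℤP.abs-* (+ suc a) (+ y))) (cong ∣_∣ on))) (∣val∣≤ q x))
  below y x (there b) = ℕP.<-≤-trans (lt y x b) (ℕP.m≤n+m (δ x) (bound x ℕ.+ 1))

-- Past the break points φ is periodic in its first variable, so if it fails eventually it fails there.
eventually-fails : ∀ {k} (φ : QF (suc k)) (T : Vec ℕ k → ℕ) → (∀ y x → ev φ (y ∷ x) ≡ true → y ℕ.≤ T x) →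
  Σ (Aff k) λ N → Σ (Vec ℕ k → ℕ) λ δ → (∀ x → val N x ≡ + δ x) × (∀ x → ev φ (δ x ∷ x) ≢ true)
eventually-fails φ T bounded with ∃Period φ
... | P , per with beyond (breaks (suc P) φ)
...   | N , δ , eq , past = N , δ , eq , fails
  where
  persists : ∀ x t → ev φ (δ x ∷ x) ≡ true → ev φ (t ℕ.* suc P ℕ.+ δ x ∷ x) ≡ true
  persists x zero    e = e
  persists x (suc t) e with crossing (suc P) φ per (t ℕ.* suc P ℕ.+ δ x) x
  ... | inj₁ same = trans (cong (λ N → ev φ (N ∷ x)) (ℕP.+-assoc (suc P) (t ℕ.* suc P) (δ x))) (trans (sym same) (persists x t e))
  ... | inj₂ a    = contradiction (ℕP.<-≤-trans (past _ x a) (ℕP.m≤n+m (δ x) (t ℕ.* suc P))) (ℕP.<-irrefl refl)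
  fails : ∀ x → ev φ (δ x ∷ x) ≢ true
  -- Truth at `δ x` would persist after `suc (T x)` further periods, beyond the bound `T x`. `T`
  -- enters only this contradiction and hence need not be affine.
  fails x e = ℕP.<-irrefl refl (ℕP.<-≤-trans (ℕP.n<1+n (T x)) (ℕP.≤-trans (ℕP.m≤m*n (suc (T x)) (suc P))
    (ℕP.≤-trans (ℕP.m≤m+n (suc (T x) ℕ.* suc P) (δ x)) (bounded _ x (persists x (suc (T x)) e)))))

-- A renaming that makes room for N between y and x: once the block y is quantified away, N is the
-- head variable that `eventually-fails` expects.
insertN : ∀ n → Fin (n ℕ.+ n) → Aff (n ℕ.+ suc n)
insertN n i with F.splitAt n i
... | inj₁ j = coordA (j F.↑ˡ suc n)
... | inj₂ j = coordA (n F.↑ʳ suc j)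

Rel-insertN : ∀ {n} (y : Vec ℕ n) N x → Rel 0 (insertN n) (y ++ N ∷ x) (y ++ x)
Rel-insertN {n} y N x i rewrite VecP.lookup-splitAt n y x i with F.splitAt n i
... | inj₁ j = trans (val-coordA (j F.↑ˡ suc n) (y ++ N ∷ x))
                 (trans (cong +_ (VecP.lookup-++ˡ y (N ∷ x) j)) (sym (ℤP.*-identityˡ _)))
... | inj₂ j = trans (val-coordA (n F.↑ʳ suc j) (y ++ N ∷ x))
                 (trans (cong +_ (VecP.lookup-++ʳ y (N ∷ x) (suc j))) (sym (ℤP.*-identityˡ _)))

sumA : ∀ n k → Aff (n ℕ.+ k)
sumA n k = aff (+ 0) (replicate n (+ 1) ++ replicate k (+ 0))

val-sumA : ∀ {n k} (y : Vec ℕ n) (x : Vec ℕ k) → val (sumA n k) (y ++ x) ≡ + sum y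
val-sumA y x = trans (ℤP.+-identityˡ _) (go y x)
  where
  go : ∀ {n k} (y : Vec ℕ n) (x : Vec ℕ k) → dot (replicate n (+ 1) ++ replicate k (+ 0)) (y ++ x) ≡ + sum y
  go []       x = dot-zeros x
  go (y ∷ ys) x = cong₂ ℤ._+_ (ℤP.*-identityˡ (+ y)) (go ys x)

liftA : ∀ n {k} → Aff k → Aff (n ℕ.+ k)
liftA n (aff c as) = aff c (replicate n (+ 0) ++ as)

val-liftA : ∀ {n k} (N : Aff k) (y : Vec ℕ n) x → val (liftA n N) (y ++ x) ≡ val N x
val-liftA (aff c as) y x = cong (λ w → c ℤ.+ w) (go y)
  where
  go : ∀ {n} (y : Vec ℕ n) → dot (replicate n (+ 0) ++ as) (y ++ x) ≡ dot as x
  go []       = refl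
  go (y ∷ ys) = trans (ℤP.+-identityˡ _) (go ys)

-- The head coordinate is summed innermost because `sum-PP` eliminates the head variable.
boxSum : ∀ n → ℕ → (Vec ℕ n → ℚ) → ℚ
boxSum zero    ν h = h []
boxSum (suc n) ν h = boxSum n ν (λ ys → sumTo ν (λ y → h (y ∷ ys)))

boxSum-cong : ∀ n ν {g h : Vec ℕ n → ℚ} → (∀ y → g y ≡ h y) → boxSum n ν g ≡ boxSum n ν h
boxSum-cong zero    ν e = e []
boxSum-cong (suc n) ν e = boxSum-cong n ν (λ ys → sumTo-cong ν (λ y _ → e (y ∷ ys)))

boxSum-0 : ∀ n ν → boxSum n ν (λ _ → 0ℚ) ≡ 0ℚ
boxSum-0 zero    ν = refl
boxSum-0 (suc n) ν = trans (boxSum-cong n ν (λ _ → sumTo-0 ν)) (boxSum-0 n ν)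

boxSum-+ : ∀ n ν (g h : Vec ℕ n → ℚ) → boxSum n ν (λ y → g y ℚ.+ h y) ≡ boxSum n ν g ℚ.+ boxSum n ν h
boxSum-+ zero    ν g h = refl
boxSum-+ (suc n) ν g h = trans (boxSum-cong n ν (λ ys → sumTo-+ ν (λ y → g (y ∷ ys)) (λ y → h (y ∷ ys))))
  (boxSum-+ n ν (λ ys → sumTo ν (λ y → g (y ∷ ys))) (λ ys → sumTo ν (λ y → h (y ∷ ys))))

boxSum-sumTo : ∀ n ν m (h : ℕ → Vec ℕ n → ℚ) → boxSum n ν (λ y → sumTo m (λ v → h v y)) ≡ sumTo m (λ v → boxSum n ν (h v))
boxSum-sumTo n ν zero    h = boxSum-0 n ν
boxSum-sumTo n ν (suc m) h = trans (boxSum-+ n ν (λ y → sumTo m (λ v → h v y)) (h m))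
  (cong (ℚ._+ boxSum n ν (h m)) (boxSum-sumTo n ν m h))

boxPP : ∀ n {k d e} (N : Aff k) (g : PP (n ℕ.+ k) d) → n ℕ.+ d ≡ e →
  Σ (PP k e) λ s → ∀ x ν → val N x ≡ + ν → evPP s x ≡ boxSum n ν (λ y → evPP g (y ++ x))
boxPP zero    N g refl = g , λ x ν _ → refl
boxPP (suc n) {d = d} N g eq with sum-PP (liftA n N) g
... | s , h with boxPP n N s (trans (ℕP.+-suc n d) eq)
...   | t , i = t , λ x ν e → trans (i x ν e) (boxSum-cong n ν (λ ys → h (ys ++ x) ν (trans (val-liftA N ys x) e)))

indicator : ∀ {n} → Vec ℕ n → Vec ℕ n → ℚ
indicator []       []       = 1ℚ
indicator (w ∷ ws) (y ∷ ys) = gate (does (y ℕ.≟ w)) (indicator ws ys)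

indicator-refl : ∀ {n} (w : Vec ℕ n) → indicator w w ≡ 1ℚ
indicator-refl []       = refl
indicator-refl (w ∷ ws) = trans (cong (λ b → gate b (indicator ws ws)) (dec-true (w ℕ.≟ w) refl)) (indicator-refl ws)

indicator-≢ : ∀ {n} (w y : Vec ℕ n) → w ≢ y → indicator w y ≡ 0ℚ
indicator-≢ []       []       n = contradiction refl n
indicator-≢ (w ∷ ws) (y ∷ ys) n with y ℕ.≟ w
... | no ≢     = cong (λ b → gate b (indicator ws ys)) (dec-false (y ℕ.≟ w) ≢)
... | yes refl = trans (cong (λ b → gate b (indicator ws ys)) (dec-true (y ℕ.≟ w) refl))
                       (indicator-≢ ws ys (n ∘ cong (y ∷_)))

-- A bound on the coordinate sum puts `w` inside the box and is inherited by its tail.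
boxSum-indicator : ∀ {n} ν (w : Vec ℕ n) → sum w ℕ.< ν → boxSum n ν (indicator w) ≡ 1ℚ
boxSum-indicator ν []       _  = refl
boxSum-indicator {suc n} ν (w ∷ ws) lt = trans (boxSum-cong n ν inner) (boxSum-indicator ν ws (ℕP.≤-<-trans (ℕP.m≤n+m (sum ws) w) lt))
  where
  inner : ∀ ys → sumTo ν (λ y → indicator (w ∷ ws) (y ∷ ys)) ≡ indicator ws ys
  inner ys = trans (sumTo-extract ν w (λ y → indicator (w ∷ ws) (y ∷ ys)) (λ _ → 0ℚ) (ℕP.≤-<-trans (ℕP.m≤m+n w (sum ws)) lt)
                (λ y ≢w → cong (λ b → gate b (indicator ws ys)) (sym (dec-false (y ℕ.≟ w) ≢w))) refl)
    (trans (cong₂ ℚ._+_ (cong (λ b → gate b (indicator ws ys)) (dec-true (w ℕ.≟ w) refl)) (sumTo-0 ν)) (ℚP.+-identityʳ _))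

sumTo-1 : ∀ n → sumTo n (λ _ → 1ℚ) ≡ ℕ→ℚ n
sumTo-1 zero    = refl
sumTo-1 (suc n) = trans (cong (ℚ._+ 1ℚ) (sumTo-1 n)) (trans (ℚP.+-comm (ℕ→ℚ n) 1ℚ) (sym (ℕ→ℚ-suc n)))

sumN : ℕ → (ℕ → ℕ) → ℕ
sumN zero    f = 0
sumN (suc n) f = sumN n f ℕ.+ f n

≤-sumN : ∀ n f v → v ℕ.< n → f v ℕ.≤ sumN n f
≤-sumN (suc n) f v (ℕ.s≤s v≤n) with v ℕ.≟ n
... | yes refl = ℕP.m≤n+m (f n) (sumN n f)
... | no ≢     = ℕP.≤-trans (≤-sumN n f v (ℕP.≤∧≢⇒< v≤n ≢)) (ℕP.m≤m+n (sumN n f) (f n))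

module _ {n} (rank : Vec ℕ n → ℕ) (unrank : ℕ → Vec ℕ n)
  (rank∘unrank : ∀ v → rank (unrank v) ≡ v) (unrank∘rank : ∀ y → unrank (rank y) ≡ y)
  (ψ : QF (n ℕ.+ n)) (ψ-correct : ∀ y x → (ev ψ (y ++ x) ≡ true) ⇔ (rank y ℕ.< rank x)) where

  abstract
    -- Says that some predecessor of x has coordinate sum at least N. Measuring predecessors by one
    -- number leaves a single variable to which periodicity applies.
    exceeds : QF (suc n)
    exceeds = ∃QF* n (and (proj₁ (subst-QF 0 (insertN n) ψ)) (leQF (coordA (n F.↑ʳ zero)) (sumA n (suc n))))

    val-N : ∀ (y : Vec ℕ n) N (x : Vec ℕ n) → val (coordA (n F.↑ʳ zero)) (y ++ N ∷ x) ≡ + N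
    val-N y N x = trans (val-coordA (n F.↑ʳ zero) (y ++ N ∷ x)) (cong +_ (VecP.lookup-++ʳ y (N ∷ x) zero))

    exceeds⁺ : ∀ N x y → rank y ℕ.< rank x → N ℕ.≤ sum y → ev exceeds (N ∷ x) ≡ true
    exceeds⁺ N x y lt le = ∃QF*⁺ (and (proj₁ (subst-QF 0 (insertN n) ψ)) (leQF (coordA (n F.↑ʳ zero)) (sumA n (suc n)))) y (N ∷ x) (∧-true⁺
      (trans (proj₂ (subst-QF 0 (insertN n) ψ) (y ++ N ∷ x) (y ++ x) (Rel-insertN y N x)) (Equivalence.from (ψ-correct y x) lt))
      (trans (ev-leQF (coordA (n F.↑ʳ zero)) (sumA n (suc n)) (y ++ N ∷ x))
        (dec-true (val (coordA (n F.↑ʳ zero)) (y ++ N ∷ x) ℤ.≤? val (sumA n (suc n)) (y ++ N ∷ x))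
          (subst₂ ℤ._≤_ (sym (val-N y N x)) (sym (val-sumA y (N ∷ x))) (ℤ.+≤+ le)))))

    exceeds⁻ : ∀ N x → ev exceeds (N ∷ x) ≡ true → ∃ λ y → rank y ℕ.< rank x × N ℕ.≤ sum y
    exceeds⁻ N x t with ∃QF*⁻ n (and (proj₁ (subst-QF 0 (insertN n) ψ)) (leQF (coordA (n F.↑ʳ zero)) (sumA n (suc n)))) (N ∷ x) t
    ... | y , s = y ,
      Equivalence.to (ψ-correct y x) (trans (sym (proj₂ (subst-QF 0 (insertN n) ψ) (y ++ N ∷ x) (y ++ x) (Rel-insertN y N x))) (proj₁ (∧-true⁻ s))) ,
      ℤP.drop‿+≤+ (subst₂ ℤ._≤_ (val-N y N x) (val-sumA y (N ∷ x))
        (does-true⁻ (val (coordA (n F.↑ʳ zero)) (y ++ N ∷ x) ℤ.≤? val (sumA n (suc n)) (y ++ N ∷ x))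
          (trans (sym (ev-leQF (coordA (n F.↑ʳ zero)) (sumA n (suc n)) (y ++ N ∷ x)))
            (proj₂ (∧-true⁻ {ev (proj₁ (subst-QF 0 (insertN n) ψ)) (y ++ N ∷ x)} s)))))

  -- Here the order type matters: x has only the predecessors `unrank v` with v < `rank x`, and the
  -- total of their coordinate sums is the bound required by `eventually-fails`.
  predecessors-bounded : Σ (Aff n) λ N → Σ (Vec ℕ n → ℕ) λ δ →
    (∀ x → val N x ≡ + δ x) × (∀ y x → rank y ℕ.< rank x → sum y ℕ.< δ x)
  predecessors-bounded with eventually-fails exceeds (λ x → sumN (rank x) (λ v → sum (unrank v))) bounded
    where
    bounded : ∀ N x → ev exceeds (N ∷ x) ≡ true → N ℕ.≤ sumN (rank x) (λ v → sum (unrank v))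
    bounded N x e with exceeds⁻ N x e
    ... | y , lt , le = ℕP.≤-trans le (subst (λ z → sum z ℕ.≤ sumN (rank x) (λ v → sum (unrank v))) (unrank∘rank y)
                          (≤-sumN (rank x) (λ v → sum (unrank v)) (rank y) lt))
  ... | N , δ , eq , fails = N , δ , eq , λ y x lt → ℕP.≰⇒> (λ δ≤ → fails x (exceeds⁺ (δ x) x y lt δ≤))

  -- Double counting: the truth value of y ≺ x is the sum of the indicators of the points
  -- `unrank v`, v < `rank x`. After exchanging the sums, each of these points contributes 1,
  -- because it lies in the box.
  rank-as-PP : Σ (PP n n) λ g → ∀ x → evPP g x ≡ ℕ→ℚ (rank x)
  rank-as-PP with predecessors-bounded
  ... | N , δ , eq , bound with boxPP n N ((ψ , one) ∷ []) (ℕP.+-identityʳ n)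
  ...   | g , h = g , λ x → begin
      evPP g x                                                              ≡⟨ h x (δ x) (eq x) ⟩
      boxSum n (δ x) (λ y → gate (ev ψ (y ++ x)) 1ℚ ℚ.+ 0ℚ)                 ≡⟨ boxSum-cong n (δ x) (λ y → below x y) ⟩
      boxSum n (δ x) (λ y → sumTo (rank x) (λ v → indicator (unrank v) y))  ≡⟨ boxSum-sumTo n (δ x) (rank x) (λ v → indicator (unrank v)) ⟩
      sumTo (rank x) (λ v → boxSum n (δ x) (indicator (unrank v)))          ≡⟨ sumTo-cong (rank x) (λ v lt → boxSum-indicator (δ x) (unrank v)
                                                                                  (bound (unrank v) x (subst (ℕ._< rank x) (sym (rank∘unrank v)) lt))) ⟩
      sumTo (rank x) (λ _ → 1ℚ)                                             ≡⟨ sumTo-1 (rank x) ⟩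
      ℕ→ℚ (rank x) ∎
    where
    open ≡-Reasoning
    other : ∀ y v → v ≢ rank y → 0ℚ ≡ indicator (unrank v) y
    other y v ≢ = sym (indicator-≢ (unrank v) y (λ e → ≢ (trans (sym (rank∘unrank v)) (cong rank e))))
    below : ∀ x y → gate (ev ψ (y ++ x)) 1ℚ ℚ.+ 0ℚ ≡ sumTo (rank x) (λ v → indicator (unrank v) y)
    below x y with rank y ℕ.<? rank x
    ... | yes lt = trans (cong (λ b → gate b 1ℚ ℚ.+ 0ℚ) (Equivalence.from (ψ-correct y x) lt))
           (sym (trans (sumTo-extract (rank x) (rank y) (λ v → indicator (unrank v) y) (λ _ → 0ℚ) lt (other y) refl)
             (cong₂ ℚ._+_ (trans (cong (λ z → indicator z y) (unrank∘rank y)) (indicator-refl y)) (sumTo-0 (rank x)))))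
    ... | no ≮ = trans (cong (λ b → gate b 1ℚ ℚ.+ 0ℚ) (BoolP.¬-not (λ t → ≮ (Equivalence.to (ψ-correct y x) t))))
           (sym (trans (sumTo-avoid (rank x) (rank y) (λ v → indicator (unrank v) y) (λ _ → 0ℚ) (ℕP.≮⇒≥ ≮) (other y)) (sumTo-0 (rank x))))

-- Splitting ℕᵐ into lattices

-- An injective affine parametrisation of a subset of ℕⁿ. The function supplies natural values, the
-- forms supply base point and generators of the future lattice.
record Patch (m n : ℕ) : Set where
  field
    fun      : Vec ℕ m → Vec ℕ n
    form     : Fin n → Aff m
    val-form : ∀ κ i → val (form i) κ ≡ + lookup (fun κ) i
    inj      : ∀ {κ κ'} → fun κ ≡ fun κ' → κ ≡ κ'
open Patch public

Rel-form : ∀ {m n} (σ : Patch m n) κ → Rel 0 (form σ) κ (fun σ κ)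
Rel-form σ κ i = trans (val-form σ κ i) (sym (ℤP.*-identityˡ _))

idPatch : ∀ {m} → Patch m m
idPatch = record { fun = id ; form = coordA ; val-form = λ κ i → val-coordA i κ ; inj = id }

infixr 9 _⊙_

_⊙_ : ∀ {l m n} → Patch m n → Patch l m → Patch l n
σ ⊙ τ = record
  { fun      = fun σ ∘ fun τ
  ; form     = λ i → proj₁ (subst-aff 0 (form τ) (form σ i))
  ; val-form = λ κ i → trans (proj₂ (subst-aff 0 (form τ) (form σ i)) κ (fun τ κ) (Rel-form τ κ))
                 (trans (ℤP.*-identityˡ _) (val-form σ (fun τ κ) i))
  ; inj      = inj τ ∘ inj σ
  }

-- A tree of successive disjoint subdivisions, with `b` constant at the leaves. Being a tree, it is
-- refined by grafting further trees at the leaves, as in `Split-bind`; the number of parameters may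
-- change along a branch.
data Split : ∀ {m} → (Vec ℕ m → Bool) → Set where
  constant : ∀ {m} {b : Vec ℕ m → Bool} c → (∀ κ → b κ ≡ c) → Split b
  split    : ∀ {m} {b : Vec ℕ m → Bool} r (ms : Fin r → ℕ) (τ : ∀ t → Patch (ms t) m) →
             (∀ κ → ∃ λ t → ∃ λ κ' → fun (τ t) κ' ≡ κ) →
             (∀ t t' κ κ' → fun (τ t) κ ≡ fun (τ t') κ' → t ≡ t') →
             (∀ t → Split (b ∘ fun (τ t))) → Split b

Split-cong : ∀ {m} {b b' : Vec ℕ m → Bool} → (∀ κ → b κ ≡ b' κ) → Split b → Split b'
Split-cong e (constant c h)      = constant c (λ κ → trans (sym (e κ)) (h κ))
Split-cong e (split r ms τ cover disjoint s) = split r ms τ cover disjoint (λ t → Split-cong (e ∘ fun (τ t)) (s t))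

Split-not : ∀ {m} {b : Vec ℕ m → Bool} → Split b → Split (not ∘ b)
Split-not (constant c h)                 = constant (not c) (cong not ∘ h)
Split-not (split r ms τ cover disjoint s) = split r ms τ cover disjoint (λ t → Split-not (s t))

Split-bind : ∀ {m} {b b' : Vec ℕ m → Bool} → Split b →
  (∀ {l} (τ : Patch l m) c → (∀ κ → b (fun τ κ) ≡ c) → Split (b' ∘ fun τ)) → Split b'
Split-bind (constant c h) k = k idPatch c h
Split-bind (split r ms τ cover disjoint s) k =
  split r ms τ cover disjoint (λ t → Split-bind (s t) (λ τ' c h → k (τ t ⊙ τ') c h))

lookup-ext : ∀ {m} {κ κ' : Vec ℕ m} → (∀ i → lookup κ i ≡ lookup κ' i) → κ ≡ κ'
lookup-ext {κ = κ} {κ'} e = trans (sym (VecP.tabulate∘lookup κ)) (trans (VecP.tabulate-cong e) (VecP.tabulate∘lookup κ'))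

-- The substitution κ_i := g(κ) + (1 + w) κ_i, where g does not depend on κ_i.
module Update {m} (i : Fin m) (w : ℕ) (g : Vec ℕ m → ℕ) (gA : Aff m) (val-gA : ∀ κ → val gA κ ≡ + g κ)
  (g-indep : ∀ κ f → g (updateAt κ i f) ≡ g κ) where

  upd : Vec ℕ m → Vec ℕ m
  upd κ = updateAt κ i (λ x → g κ ℕ.+ x ℕ.* suc w)

  lookup-upd : ∀ κ → lookup (upd κ) i ≡ g (upd κ) ℕ.+ lookup κ i ℕ.* suc w
  lookup-upd κ = trans (VecP.lookup∘updateAt i κ) (cong (ℕ._+ lookup κ i ℕ.* suc w) (sym (g-indep κ _)))

  updForm : Fin m → Aff m
  updForm l with l F.≟ i
  ... | yes _ = gA ⊞ + suc w ⊠ coordA i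
  ... | no  _ = coordA l

  val-updForm : ∀ κ l → val (updForm l) κ ≡ + lookup (upd κ) l
  val-updForm κ l with l F.≟ i
  ... | no l≢i = trans (val-coordA l κ) (cong +_ (sym (VecP.lookup∘updateAt′ l i l≢i κ)))
  ... | yes refl = begin
    val (gA ⊞ + suc w ⊠ coordA i) κ             ≡⟨ val-⊞ gA (+ suc w ⊠ coordA i) κ ⟩
    val gA κ ℤ.+ val (+ suc w ⊠ coordA i) κ     ≡⟨ cong₂ ℤ._+_ (val-gA κ) (trans (val-⊠ (+ suc w) (coordA i) κ) (cong (+ suc w ℤ.*_) (val-coordA i κ))) ⟩
    + g κ ℤ.+ + suc w ℤ.* + lookup κ i          ≡⟨ cong (λ u → + g κ ℤ.+ u) (trans (sym (ℤP.pos-* (suc w) (lookup κ i))) (cong +_ (ℕP.*-comm (suc w) (lookup κ i)))) ⟩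
    + (g κ ℕ.+ lookup κ i ℕ.* suc w)            ≡⟨ cong +_ (sym (VecP.lookup∘updateAt i κ)) ⟩
    + lookup (upd κ) i ∎
    where open ≡-Reasoning

  upd-inj : ∀ {κ κ'} → upd κ ≡ upd κ' → κ ≡ κ'
  upd-inj {κ} {κ'} e = lookup-ext go
    where
    go : ∀ l → lookup κ l ≡ lookup κ' l
    go l with l F.≟ i
    ... | no l≢i = trans (sym (VecP.lookup∘updateAt′ l i l≢i κ)) (trans (cong (λ v → lookup v l) e) (VecP.lookup∘updateAt′ l i l≢i κ'))
    ... | yes refl = ℕP.*-cancelʳ-≡ (lookup κ i) (lookup κ' i) (suc w) (ℕP.+-cancelˡ-≡ (g (upd κ)) _ _
            (trans (sym (lookup-upd κ)) (trans (cong (λ v → lookup v i) e)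
              (trans (lookup-upd κ') (cong (λ v → g v ℕ.+ lookup κ' i ℕ.* suc w) (sym e))))))

  patch : Patch m m
  patch = record { fun = upd ; form = updForm ; val-form = val-updForm ; inj = upd-inj }

  upd-onto : ∀ κ x → lookup κ i ≡ g κ ℕ.+ x ℕ.* suc w → upd (updateAt κ i (const x)) ≡ κ
  upd-onto κ x e = trans (VecP.updateAt-updateAt i κ)
    (VecP.updateAt-id-local i κ (trans (cong (ℕ._+ x ℕ.* suc w) (g-indep κ (const x))) (sym e)))

  dot-upd : ∀ as κ → dot as (upd κ) ≡ dot as κ ℤ.+ lookup as i ℤ.* (+ g κ ℤ.+ + lookup κ i ℤ.* + w)
  dot-upd as κ = trans (go as κ i (λ x → g κ ℕ.+ x ℕ.* suc w))
    (trans (cong (λ u → dot as κ ℤ.+ lookup as i ℤ.* (u ℤ.- + lookup κ i)) (trans (ℤP.pos-+ (g κ) (lookup κ i ℕ.* suc w)) (cong (λ u → + g κ ℤ.+ u) (ℤP.pos-* (lookup κ i) (suc w)))))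
      (lemma (dot as κ) (lookup as i) (+ g κ) (+ lookup κ i) (+ w)))
    where
    lemma : ∀ d a g x w → d ℤ.+ a ℤ.* (g ℤ.+ x ℤ.* (+ 1 ℤ.+ w) ℤ.- x) ≡ d ℤ.+ a ℤ.* (g ℤ.+ x ℤ.* w)
    lemma = solve-∀
    step : ∀ a d v w e → a ℤ.* v ℤ.+ (d ℤ.+ e ℤ.* w) ≡ a ℤ.* v ℤ.+ d ℤ.+ e ℤ.* w
    step = solve-∀
    change : ∀ a d v w → a ℤ.* w ℤ.+ d ≡ a ℤ.* v ℤ.+ d ℤ.+ a ℤ.* (w ℤ.- v)
    change = solve-∀
    go : ∀ {m} (as : Vec ℤ m) κ i f → dot as (updateAt κ i f) ≡ dot as κ ℤ.+ lookup as i ℤ.* (+ f (lookup κ i) ℤ.- + lookup κ i)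
    go (a ∷ as) (x ∷ κ) zero    f = change a (dot as κ) (+ x) (+ f x)
    go (a ∷ as) (x ∷ κ) (suc i) f = trans (cong (λ u → a ℤ.* + x ℤ.+ u) (go as κ i f))
      (step a (dot as κ) (+ x) (+ f (lookup κ i) ℤ.- + lookup κ i) (lookup as i))

dot-updateAt : ∀ {m} (as : Vec ℤ m) κ i f → dot (updateAt as i f) κ ≡ dot as κ ℤ.+ (f (lookup as i) ℤ.- lookup as i) ℤ.* + lookup κ i
dot-updateAt (a ∷ as) (x ∷ κ) zero    f = lemma a (f a) (+ x) (dot as κ)
  where
  lemma : ∀ a b x d → b ℤ.* x ℤ.+ d ≡ a ℤ.* x ℤ.+ d ℤ.+ (b ℤ.- a) ℤ.* x
  lemma = solve-∀
dot-updateAt (a ∷ as) (x ∷ κ) (suc i) f = trans (cong (λ u → a ℤ.* + x ℤ.+ u) (dot-updateAt as κ i f))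
  (sym (ℤP.+-assoc (a ℤ.* + x) (dot as κ) _))

geB : ∀ {m} → ℤ → Vec ℤ m → Vec ℕ m → Bool
geB c as κ = does (+ 0 ℤ.≤? c ℤ.+ dot as κ)

-- Elementary subdivisions of the parameter space

module Residue {m} (i : Fin m) (w : ℕ) (r : ℕ) =
  Update i w (λ _ → r) (constA (+ r)) (val-constA (+ r)) (λ _ _ → refl)

split-residue : ∀ {m} {b : Vec ℕ m → Bool} (i : Fin m) w →
  (∀ (r : Fin (suc w)) → Split (b ∘ Residue.upd i w (toℕ r))) → Split b
split-residue i w s = split (suc w) _ (λ r → Residue.patch i w (toℕ r)) cover disjoint s
  where
  cover : ∀ κ → ∃ λ r → ∃ λ κ' → Residue.upd i w (toℕ r) κ' ≡ κ
  cover κ with lookup κ i ℕDM.divMod suc w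
  ... | ℕDM.result q r e = r , _ , Residue.upd-onto i w (toℕ r) κ q e
  disjoint : ∀ r r' κ κ' → Residue.upd i w (toℕ r) κ ≡ Residue.upd i w (toℕ r') κ' → r ≡ r'
  disjoint r r' κ κ' e = FP.toℕ-injective (begin
    toℕ r                                         ≡⟨ rem r (lookup κ i) ⟨
    (toℕ r ℕ.+ lookup κ i ℕ.* suc w) ℕDM.% suc w   ≡⟨ cong (ℕDM._% suc w) (trans (sym (Residue.lookup-upd i w (toℕ r) κ)) (trans (cong (λ v → lookup v i) e) (Residue.lookup-upd i w (toℕ r') κ'))) ⟩
    (toℕ r' ℕ.+ lookup κ' i ℕ.* suc w) ℕDM.% suc w ≡⟨ rem r' (lookup κ' i) ⟩
    toℕ r' ∎)
    where
    open ≡-Reasoning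
    rem : ∀ (r : Fin (suc w)) q → (toℕ r ℕ.+ q ℕ.* suc w) ℕDM.% suc w ≡ toℕ r
    rem r q = trans (ℕDM.[m+kn]%n≡m%n (toℕ r) q (suc w)) (ℕDM.m<n⇒m%n≡m (FP.toℕ<n r))

module Compare {m} (i j : Fin m) (j≢i : j ≢ i) (e : ℕ) =
  Update i 0 (λ κ → e ℕ.+ lookup κ j) (constA (+ e) ⊞ coordA j)
    (λ κ → trans (val-⊞ (constA (+ e)) (coordA j) κ) (cong₂ ℤ._+_ (val-constA (+ e) κ) (val-coordA j κ)))
    (λ κ f → cong (e ℕ.+_) (VecP.lookup∘updateAt′ j i j≢i κ))

-- The offset 0 covers κⱼ ≤ κᵢ and the offset 1 covers κᵢ < κⱼ, so ties fall into the first part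
-- only.
split-compare : ∀ {m} {b : Vec ℕ m → Bool} (i j : Fin m) (i≢j : i ≢ j) →
  Split (b ∘ Compare.upd i j (i≢j ∘ sym) 0) → Split (b ∘ Compare.upd j i i≢j 1) → Split b
split-compare {m} {b} i j i≢j s₀ s₁ = split 2 (λ _ → m) τ cover disjoint s
  where
  module C₀ = Compare i j (i≢j ∘ sym) 0
  module C₁ = Compare j i i≢j 1
  τ : Fin 2 → Patch m m
  τ zero       = C₀.patch
  τ (suc zero) = C₁.patch
  cover : ∀ κ → ∃ λ t → ∃ λ κ' → fun (τ t) κ' ≡ κ
  cover κ with ℕP.≤-<-connex (lookup κ j) (lookup κ i)
  ... | inj₁ le with ℕP.m≤n⇒∃[o]m+o≡n le
  ...   | o , eq = zero , _ , C₀.upd-onto κ o (trans (sym eq) (cong (lookup κ j ℕ.+_) (sym (ℕP.*-identityʳ o))))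
  cover κ | inj₂ lt with ℕP.m≤n⇒∃[o]m+o≡n lt
  ...   | o , eq = suc zero , _ , C₁.upd-onto κ o (trans (sym eq) (cong (suc (lookup κ i) ℕ.+_) (sym (ℕP.*-identityʳ o))))
  absurd : ∀ κ κ' → C₀.upd κ ≢ C₁.upd κ'
  absurd κ κ' e = ℕP.<-irrefl refl (ℕP.<-≤-trans {lookup (C₀.upd κ) i}
    (ℕP.≤-trans (ℕP.m≤m+n _ _) (ℕP.≤-reflexive (trans (cong (λ v → 1 ℕ.+ lookup v i ℕ.+ lookup κ' j ℕ.* 1) e) (sym (C₁.lookup-upd κ')))))
    (ℕP.≤-trans (ℕP.≤-reflexive (cong (λ v → lookup v j) (sym e))) (ℕP.≤-trans (ℕP.m≤m+n _ _) (ℕP.≤-reflexive (sym (C₀.lookup-upd κ))))))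
  disjoint : ∀ t t' κ κ' → fun (τ t) κ ≡ fun (τ t') κ' → t ≡ t'
  disjoint zero       zero       κ κ' e = refl
  disjoint zero       (suc zero) κ κ' e = contradiction e (absurd κ κ')
  disjoint (suc zero) zero       κ κ' e = contradiction (sym e) (absurd κ' κ)
  disjoint (suc zero) (suc zero) κ κ' e = refl
  s : ∀ t → Split (b ∘ fun (τ t))
  s zero       = s₀
  s (suc zero) = s₁

zeroForm : ∀ {m} → Fin (suc m) → Fin (suc m) → Aff m
zeroForm i l with i F.≟ l
... | yes _  = constA (+ 0)
... | no i≢l = coordA (F.punchOut i≢l)

insertZero : ∀ {m} → Fin (suc m) → Patch m (suc m)
insertZero i = record
  { fun = λ κ → insertAt κ i 0
  ; form = zeroForm i
  ; val-form = correct
  ; inj = λ {κ} {κ'} e → trans (sym (VecP.removeAt-insertAt κ i 0)) (trans (cong (λ v → removeAt v i) e) (VecP.removeAt-insertAt κ' i 0)) }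
  where
  correct : ∀ κ l → val (zeroForm i l) κ ≡ + lookup (insertAt κ i 0) l
  correct κ l with i F.≟ l
  ... | yes refl = trans (val-constA (+ 0) κ) (cong +_ (sym (VecP.insertAt-lookup κ i 0)))
  ... | no i≢l = trans (val-coordA (F.punchOut i≢l) κ) (cong +_ (trans (sym (VecP.insertAt-punchIn κ i 0 (F.punchOut i≢l)))
                   (cong (lookup (insertAt κ i 0)) (FP.punchIn-punchOut i≢l))))

-- Modulus 1 with the "remainder" 1 is the substitution of 1 + κᵢ for κᵢ; `Update` does not ask the
-- offset to be below the modulus.
module Successor {m} (i : Fin m) = Residue i 0 1

split-zero : ∀ {m} {b : Vec ℕ (suc m) → Bool} (i : Fin (suc m)) →
  Split (λ κ → b (insertAt κ i 0)) → Split (b ∘ Successor.upd i) → Split b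
split-zero {m} {b} i s₀ s₁ = split 2 ms τ cover disjoint s
  where
  ms : Fin 2 → ℕ
  ms zero       = m
  ms (suc zero) = suc m
  τ : ∀ t → Patch (ms t) (suc m)
  τ zero       = insertZero i
  τ (suc zero) = Successor.patch i
  cover : ∀ κ → ∃ λ t → ∃ λ κ' → fun (τ t) κ' ≡ κ
  cover κ with lookup κ i in eq
  ... | zero  = zero , removeAt κ i , trans (cong (insertAt (removeAt κ i) i) (sym eq)) (VecP.insertAt-removeAt κ i)
  ... | suc x = suc zero , _ , Successor.upd-onto i κ x (trans eq (cong suc (sym (ℕP.*-identityʳ x))))
  absurd : ∀ κ κ' → insertAt κ i 0 ≢ Successor.upd i κ'
  absurd κ κ' e with trans (sym (VecP.insertAt-lookup κ i 0)) (trans (cong (λ v → lookup v i) e) (Successor.lookup-upd i κ'))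
  ... | ()
  disjoint : ∀ t t' κ κ' → fun (τ t) κ ≡ fun (τ t') κ' → t ≡ t'
  disjoint zero       zero       κ κ' e = refl
  disjoint zero       (suc zero) κ κ' e = contradiction e (absurd κ κ')
  disjoint (suc zero) zero       κ κ' e = contradiction (sym e) (absurd κ' κ)
  disjoint (suc zero) (suc zero) κ κ' e = refl
  s : ∀ t → Split (b ∘ fun (τ t))
  s zero       = s₀
  s (suc zero) = s₁

-- Splitting by an affine inequality

absV-successor : ∀ {m} (as : Vec ℤ m) κ i → absV as (updateAt κ i (λ x → suc (x ℕ.* 1))) ≡ ∣ lookup as i ∣ ℕ.+ absV as κ
absV-successor (a ∷ as) (x ∷ κ) zero    = lemma ∣ a ∣ x (absV as κ)
  where
  lemma : ∀ a x d → a ℕ.* (1 ℕ.+ x ℕ.* 1) ℕ.+ d ≡ a ℕ.+ (a ℕ.* x ℕ.+ d)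
  lemma = ℕSolver.solve-∀
absV-successor (a ∷ as) (x ∷ κ) (suc i) = trans (cong (∣ a ∣ ℕ.* x ℕ.+_) (absV-successor as κ i))
  (lemma (∣ a ∣ ℕ.* x) ∣ lookup as i ∣ (absV as κ))
  where
  lemma : ∀ t u d → t ℕ.+ (u ℕ.+ d) ≡ u ℕ.+ (t ℕ.+ d)
  lemma = ℕSolver.solve-∀

absV-insertZero : ∀ {m} (as : Vec ℤ (suc m)) κ i → absV as (insertAt κ i 0) ≡ absV (removeAt as i) κ
absV-insertZero (a ∷ as)          κ       zero    = cong (ℕ._+ absV as κ) (ℕP.*-zeroʳ ∣ a ∣)
absV-insertZero (a ∷ as@(_ ∷ _)) (x ∷ κ) (suc i) = cong (∣ a ∣ ℕ.* x ℕ.+_) (absV-insertZero as κ i)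

absV-0⊎ : ∀ {m} (as : Vec ℤ m) → (∀ κ → absV as κ ≡ 0) ⊎ ∃ λ i → ∃ λ a → ∣ lookup as i ∣ ≡ suc a
absV-0⊎ [] = inj₁ λ { [] → refl }
absV-0⊎ (a ∷ as) with ∣ a ∣ in eq | absV-0⊎ as
... | suc b | _              = inj₂ (zero , b , eq)
... | zero  | inj₁ h         = inj₁ λ { (x ∷ κ) → trans (cong (λ b → b ℕ.* x ℕ.+ absV as κ) eq) (h κ) }
... | zero  | inj₂ (i , b , e) = inj₂ (suc i , b , e)

-- For a nonzero coefficient, κᵢ = 0 removes a variable and κᵢ ≥ 1 lowers the threshold by at least
-- 1. `F` bounds the threshold and makes the recursion structural.
split-threshold : ∀ m F (as : Vec ℤ m) T → T ℕ.≤ F → Split (λ κ → does (T ℕ.≤? absV as κ))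
split-threshold m F as zero _ = constant true (λ κ → refl)
split-threshold m (suc F) as (suc T) (ℕ.s≤s T≤F) with absV-0⊎ as
... | inj₁ h = constant false (λ κ → dec-false (suc T ℕ.≤? absV as κ) (λ le → contradiction (subst (suc T ℕ.≤_) (h κ) le) λ ()))
split-threshold (suc m) (suc F) as (suc T) (ℕ.s≤s T≤F) | inj₂ (i , a , e) = split-zero i
  (Split-cong (λ κ → cong (λ D → does (suc T ℕ.≤? D)) (sym (absV-insertZero as κ i)))
    (split-threshold m (suc F) (removeAt as i) (suc T) (ℕ.s≤s T≤F)))
  (Split-cong (λ κ → trans (does-⇔ (mk⇔ (λ le → ℕP.≤-trans (ℕP.m≤n+m∸n (suc T) (suc a)) (ℕP.+-monoʳ-≤ (suc a) le)) (ℕP.m≤n+o⇒m∸n≤o (suc T) (suc a))) (T ℕ.∸ a ℕ.≤? absV as κ) (suc T ℕ.≤? suc a ℕ.+ absV as κ))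
      (cong (λ D → does (suc T ℕ.≤? D)) (sym (trans (absV-successor as κ i) (cong (ℕ._+ absV as κ) e)))))
    -- `T ℕ.∸ a` is the threshold `suc T` lowered by the coefficient `suc a`; truncation to 0 means
    -- that it is already reached.
    (split-threshold (suc m) F as (T ℕ.∸ a) (ℕP.≤-trans (ℕP.m∸n≤m T a) T≤F)))

isNeg isPos : ℤ → Bool
isNeg (+ _)    = false
isNeg -[1+ _ ] = true
isPos (+ zero)  = false
isPos (+ suc _) = true
isPos -[1+ _ ]  = false

dot-nonneg : ∀ {m} (as : Vec ℤ m) → (∀ i → isNeg (lookup as i) ≡ false) → ∀ κ → dot as κ ≡ + absV as κ
dot-nonneg [] h [] = refl
dot-nonneg (+ a ∷ as) h (x ∷ κ) = cong₂ ℤ._+_ (sym (ℤP.pos-* a x)) (dot-nonneg as (h ∘ suc) κ)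
dot-nonneg (-[1+ a ] ∷ as) h (x ∷ κ) with h zero
... | ()

split-ge-nonneg : ∀ {m} c (as : Vec ℤ m) → (∀ i → isNeg (lookup as i) ≡ false) → Split (geB c as)
split-ge-nonneg (+ n) as h = constant true (λ κ → dec-true (+ 0 ℤ.≤? + n ℤ.+ dot as κ)
  (subst (λ d → + 0 ℤ.≤ + n ℤ.+ d) (sym (dot-nonneg as h κ)) (ℤ.+≤+ ℕ.z≤n)))
split-ge-nonneg {m} -[1+ n ] as h = Split-cong
  (λ κ → trans (does-⇔ (mk⇔ (λ le → ℤP.i≤j⇒0≤j-i {+ suc n} {+ absV as κ} (ℤ.+≤+ le)) (λ le → ℤP.drop‿+≤+ (ℤP.0≤i-j⇒j≤i {+ absV as κ} {+ suc n} le)))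
                 (suc n ℕ.≤? absV as κ) (+ 0 ℤ.≤? -[1+ n ] ℤ.+ + absV as κ))
    (cong (λ d → does (+ 0 ℤ.≤? -[1+ n ] ℤ.+ d)) (sym (dot-nonneg as h κ))))
  (split-threshold m (suc n) as (suc n) ℕP.≤-refl)

-- Over the integers, the negation of 0 ≤ z is z ≤ -1. This reduces nonpositive coefficients to
-- nonnegative ones.
ge-negate : ∀ z → does (+ 0 ℤ.≤? z) ≡ not (does (+ 0 ℤ.≤? -[1+ 0 ] ℤ.- z))
ge-negate (+ zero)  = refl
ge-negate (+ suc n) = refl
ge-negate -[1+ n ]  = refl

split-ge-nonpos : ∀ {m} c (as : Vec ℤ m) → (∀ i → isPos (lookup as i) ≡ false) → Split (geB c as)
split-ge-nonpos c as h = Split-cong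
  (λ κ → sym (trans (ge-negate (c ℤ.+ dot as κ)) (cong (λ z → not (does (+ 0 ℤ.≤? z))) (trans (lemma c (dot as κ)) (cong (λ d → -[1+ 0 ] ℤ.- c ℤ.+ d) (sym (dot-map -[1+ 0 ] as κ)))))))
  (Split-not (split-ge-nonneg (-[1+ 0 ] ℤ.- c) (map (-[1+ 0 ] ℤ.*_) as) (λ i → trans (cong isNeg (VecP.lookup-map i (-[1+ 0 ] ℤ.*_) as)) (flip (lookup as i) (h i)))))
  where
  lemma : ∀ c d → -[1+ 0 ] ℤ.- (c ℤ.+ d) ≡ -[1+ 0 ] ℤ.- c ℤ.+ -[1+ 0 ] ℤ.* d
  lemma = solve-∀
  flip : ∀ a → isPos a ≡ false → isNeg (-[1+ 0 ] ℤ.* a) ≡ false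
  flip (+ zero)  _ = refl
  flip -[1+ n ]  _ = refl

search : ∀ {m} (P : ℤ → Bool) (as : Vec ℤ m) → (∀ i → P (lookup as i) ≡ false) ⊎ ∃ λ i → P (lookup as i) ≡ true
search P [] = inj₁ λ ()
search P (a ∷ as) with P a in eq | search P as
... | true  | _            = inj₂ (zero , eq)
... | false | inj₁ h       = inj₁ λ { zero → eq ; (suc i) → h i }
... | false | inj₂ (i , e) = inj₂ (suc i , e)

count : ∀ {m} → (ℤ → Bool) → Vec ℤ m → ℕ
count P []       = 0
count P (a ∷ as) = (if P a then 1 else 0) ℕ.+ count P as

count-≤ : ∀ {m} P (as : Vec ℤ m) i f → P (lookup as i) ≡ true → count P (updateAt as i f) ℕ.≤ count P as
count-≤ P (a ∷ as) zero    f e rewrite e with P (f a)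
... | true  = ℕP.≤-refl
... | false = ℕP.n≤1+n _
count-≤ P (a ∷ as) (suc i) f e = ℕP.+-monoʳ-≤ (if P a then 1 else 0) (count-≤ P as i f e)

count-< : ∀ {m} P (as : Vec ℤ m) i f → P (lookup as i) ≡ true → P (f (lookup as i)) ≡ false →
  count P (updateAt as i f) ℕ.< count P as
count-< P (a ∷ as) zero    f e e' rewrite e | e' = ℕP.≤-refl
count-< P (a ∷ as) (suc i) f e e' = ℕP.+-monoʳ-< (if P a then 1 else 0) (count-< P as i f e e')

nonZero? : ℤ → Bool
nonZero? a = not (does (a ℤP.≟ + 0))

dot-residue : ∀ {m} (as : Vec ℤ m) i w r κ →
  dot as (Residue.upd i w r κ) ≡ lookup as i ℤ.* + r ℤ.+ dot (updateAt as i (ℤ._* + suc w)) κ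
dot-residue as i w r κ = trans (Residue.dot-upd i w r as κ)
  (trans (lemma (dot as κ) (lookup as i) (+ r) (+ lookup κ i) (+ w)) (cong (λ u → lookup as i ℤ.* + r ℤ.+ u) (sym (dot-updateAt as κ i (ℤ._* + suc w)))))
  where
  lemma : ∀ d a r x w → d ℤ.+ a ℤ.* (r ℤ.+ x ℤ.* w) ≡ a ℤ.* r ℤ.+ (d ℤ.+ (a ℤ.* (+ 1 ℤ.+ w) ℤ.- a) ℤ.* x)
  lemma = solve-∀

dot-compare : ∀ {m} (as : Vec ℤ m) i j (j≢i : j ≢ i) e κ →
  dot as (Compare.upd i j j≢i e κ) ≡ lookup as i ℤ.* + e ℤ.+ dot (updateAt as j (λ a → a ℤ.+ lookup as i)) κ
dot-compare as i j j≢i e κ = trans (Compare.dot-upd i j j≢i e as κ)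
  (trans (cong (λ u → dot as κ ℤ.+ lookup as i ℤ.* (u ℤ.+ + lookup κ i ℤ.* + 0)) (ℤP.pos-+ e (lookup κ j)))
  (trans (lemma (dot as κ) (lookup as i) (lookup as j) (+ e) (+ lookup κ i) (+ lookup κ j))
    (cong (λ u → lookup as i ℤ.* + e ℤ.+ u) (sym (dot-updateAt as κ j (λ a → a ℤ.+ lookup as i))))))
  where
  lemma : ∀ d a b e x y → d ℤ.+ a ℤ.* (e ℤ.+ y ℤ.+ x ℤ.* + 0) ≡ a ℤ.* e ℤ.+ (d ℤ.+ (b ℤ.+ a ℤ.- b) ℤ.* y)
  lemma = solve-∀

geB-subst : ∀ {m} c c' (as as' : Vec ℤ m) (s : Vec ℕ m → Vec ℕ m) → (∀ κ → dot as (s κ) ≡ c' ℤ.+ dot as' κ) →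
  ∀ κ → geB (c ℤ.+ c') as' κ ≡ geB c as (s κ)
geB-subst c c' as as' s h κ = cong (λ z → does (+ 0 ℤ.≤? z))
  (trans (ℤP.+-assoc c c' (dot as' κ)) (cong (λ u → c ℤ.+ u) (sym (h κ))))

-- Two coefficients of opposite signs are first made opposite by passing to residue classes;
-- comparing the two variables then annihilates one of the coefficients.
split-ge : ∀ F {m} c (as : Vec ℤ m) → count nonZero? as ℕ.≤ F → Split (geB c as)
split-ge F c as le with search isNeg as | search isPos as
... | inj₁ h       | _            = split-ge-nonneg c as h
... | inj₂ _       | inj₁ h       = split-ge-nonpos c as h
... | inj₂ (j , n) | inj₂ (i , p) with lookup as i in eᵢ | lookup as j in eⱼ
split-ge F c as le | inj₂ (j , n) | inj₂ (i , p) | + suc a | -[1+ b ] = go F le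
  where
  i≢j : i ≢ j
  i≢j refl with trans (sym eᵢ) eⱼ
  ... | ()
  nzᵢ : nonZero? (lookup as i) ≡ true
  nzᵢ = cong nonZero? eᵢ
  -- Residues of κᵢ modulo |aⱼ| and of κⱼ modulo |aᵢ| bring both coefficients to the absolute value
  -- |aᵢ aⱼ|.
  as₁ = updateAt as i (ℤ._* + suc b)
  as₂ = updateAt as₁ j (ℤ._* + suc a)
  nzⱼ : nonZero? (lookup as₁ j) ≡ true
  nzⱼ = trans (cong nonZero? (VecP.lookup∘updateAt′ j i (i≢j ∘ sym) as)) (cong nonZero? eⱼ)
  as₂ᵢ : lookup as₂ i ≡ + suc a ℤ.* + suc b
  as₂ᵢ = trans (VecP.lookup∘updateAt′ i j i≢j as₁) (trans (VecP.lookup∘updateAt i as) (cong (ℤ._* + suc b) eᵢ))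
  as₂ⱼ : lookup as₂ j ≡ -[1+ b ] ℤ.* + suc a
  as₂ⱼ = trans (VecP.lookup∘updateAt j as₁) (cong (ℤ._* + suc a) (trans (VecP.lookup∘updateAt′ j i (i≢j ∘ sym) as) eⱼ))
  opposite : ∀ a b → a ℤ.* b ℤ.+ ℤ.- b ℤ.* a ≡ + 0
  opposite = solve-∀
  opposite' : ∀ a b → ℤ.- b ℤ.* a ℤ.+ a ℤ.* b ≡ + 0
  opposite' = solve-∀
  le₂ : ∀ {F} → count nonZero? as ℕ.≤ F → count nonZero? as₂ ℕ.≤ F
  le₂ le = ℕP.≤-trans (count-≤ nonZero? as₁ j _ nzⱼ) (ℕP.≤-trans (count-≤ nonZero? as i _ nzᵢ) le)
  nz₂ᵢ : nonZero? (lookup as₂ i) ≡ true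
  nz₂ᵢ = cong nonZero? as₂ᵢ
  nz₂ⱼ : nonZero? (lookup as₂ j) ≡ true
  nz₂ⱼ = cong nonZero? as₂ⱼ
  -- Substituting κⱼ + t for κᵢ adds the coefficient of κᵢ to that of κⱼ, which becomes 0; `as₄` is
  -- the mirror case. The number of nonzero coefficients drops in both.
  as₃ = updateAt as₂ j (λ z → z ℤ.+ lookup as₂ i)
  as₄ = updateAt as₂ i (λ z → z ℤ.+ lookup as₂ j)
  lt₃ : count nonZero? as₃ ℕ.< count nonZero? as₂
  lt₃ = count-< nonZero? as₂ j _ nz₂ⱼ (cong nonZero? (trans (cong₂ ℤ._+_ as₂ⱼ as₂ᵢ) (opposite' (+ suc a) (+ suc b))))
  lt₄ : count nonZero? as₄ ℕ.< count nonZero? as₂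
  lt₄ = count-< nonZero? as₂ i _ nz₂ᵢ (cong nonZero? (trans (cong₂ ℤ._+_ as₂ᵢ as₂ⱼ) (opposite (+ suc a) (+ suc b))))
  go : ∀ F → count nonZero? as ℕ.≤ F → Split (geB c as)
  go zero    le = contradiction (ℕP.<-≤-trans lt₃ (le₂ le)) λ ()
  go (suc F) le = split-residue i b λ r →
    let c₁ = c ℤ.+ lookup as i ℤ.* + toℕ r in
    Split-cong (geB-subst c (lookup as i ℤ.* + toℕ r) as as₁ (Residue.upd i b (toℕ r)) (dot-residue as i b (toℕ r)))
      (split-residue j a λ r' →
        let c₂ = c₁ ℤ.+ lookup as₁ j ℤ.* + toℕ r' in
        Split-cong (geB-subst c₁ (lookup as₁ j ℤ.* + toℕ r') as₁ as₂ (Residue.upd j a (toℕ r')) (dot-residue as₁ j a (toℕ r')))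
          (split-compare i j i≢j
            (Split-cong (geB-subst c₂ (lookup as₂ i ℤ.* + 0) as₂ as₃ (Compare.upd i j (i≢j ∘ sym) 0) (dot-compare as₂ i j (i≢j ∘ sym) 0))
              (split-ge F (c₂ ℤ.+ lookup as₂ i ℤ.* + 0) as₃ (ℕP.≤-pred (ℕP.<-≤-trans lt₃ (le₂ le)))))
            (Split-cong (geB-subst c₂ (lookup as₂ j ℤ.* + 1) as₂ as₄ (Compare.upd j i i≢j 1) (dot-compare as₂ j i i≢j 1))
              (split-ge F (c₂ ℤ.+ lookup as₂ j ℤ.* + 1) as₄ (ℕP.≤-pred (ℕP.<-≤-trans lt₄ (le₂ le)))))))

-- Splitting by a congruence

dvB : ∀ {m} → ℕ → ℤ → Vec ℤ m → Vec ℕ m → Bool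
dvB d c as κ = does (suc d ℕD.∣? ∣ c ℤ.+ dot as κ ∣)

indivisible : ℕ → ℤ → Bool
indivisible d a = not (does (suc d ℕD.∣? ∣ a ∣))

dot-∣ : ∀ {m} d (as : Vec ℤ m) → (∀ i → indivisible d (lookup as i) ≡ false) → ∀ κ → + suc d ℤD.∣ dot as κ
dot-∣ d []       h []      = ℤD.divides (+ 0) refl
dot-∣ d (a ∷ as) h (x ∷ κ) = ℤD.∣m∣n⇒∣m+n (ℤD.∣m⇒∣m*n (+ x) (ℤD.∣ᵤ⇒∣ {+ suc d} {a} (divisible (suc d ℕD.∣? ∣ a ∣) (h zero)))) (dot-∣ d as (h ∘ suc) κ)
  where
  divisible : ∀ {A : Set} (a? : Dec A) → not (does a?) ≡ false → A
  divisible (yes p) _ = p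

-- Passing to residues of κᵢ modulo `suc d` makes its coefficient divisible by `suc d`. Once all
-- coefficients are, only the constant term decides.
split-dv : ∀ F {m} d c (as : Vec ℤ m) → count (indivisible d) as ℕ.≤ F → Split (dvB d c as)
split-dv F d c as le with search (indivisible d) as
... | inj₁ h = constant (does (suc d ℕD.∣? ∣ c ∣)) (λ κ → does-⇔ (mk⇔
      (λ p → ℤD.∣⇒∣ᵤ {+ suc d} {c} (ℤD.∣m+n∣n⇒∣m (ℤD.∣ᵤ⇒∣ {+ suc d} {c ℤ.+ dot as κ} p) (dot-∣ d as h κ)))
      (λ p → ℤD.∣⇒∣ᵤ {+ suc d} {c ℤ.+ dot as κ} (ℤD.∣m∣n⇒∣m+n (ℤD.∣ᵤ⇒∣ {+ suc d} {c} p) (dot-∣ d as h κ))))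
      (suc d ℕD.∣? ∣ c ℤ.+ dot as κ ∣) (suc d ℕD.∣? ∣ c ∣))
... | inj₂ (i , e) = go F le
  where
  as₁ = updateAt as i (ℤ._* + suc d)
  lt : count (indivisible d) as₁ ℕ.< count (indivisible d) as
  lt = count-< (indivisible d) as i _ e (cong not (dec-true (suc d ℕD.∣? _)
    (subst (suc d ℕD.∣_) (sym (ℤP.abs-* (lookup as i) (+ suc d))) (ℕD.n∣m*n ∣ lookup as i ∣))))
  go : ∀ F → count (indivisible d) as ℕ.≤ F → Split (dvB d c as)
  go zero    le = contradiction (ℕP.<-≤-trans lt le) λ ()
  go (suc F) le = split-residue i d λ r → Split-cong
    (λ κ → cong (λ z → does (suc d ℕD.∣? ∣ z ∣)) (trans (ℤP.+-assoc c (lookup as i ℤ.* + toℕ r) (dot as₁ κ)) (cong (λ u → c ℤ.+ u) (sym (dot-residue as i d (toℕ r) κ)))))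
    (split-dv F d (c ℤ.+ lookup as i ℤ.* + toℕ r) as₁ (ℕP.≤-pred (ℕP.<-≤-trans lt le)))

split-QF : ∀ {m n} (φ : QF n) (σ : Patch m n) → Split (λ κ → ev φ (fun σ κ))
split-QF (ge ℓ) σ = Split-cong
  (λ κ → cong (λ z → does (+ 0 ℤ.≤? z)) (trans (proj₂ (subst-aff 0 (form σ) ℓ) κ (fun σ κ) (Rel-form σ κ)) (ℤP.*-identityˡ _)))
  (split-ge _ (cst ℓ') (lin ℓ') ℕP.≤-refl)
  where
  ℓ' = proj₁ (subst-aff 0 (form σ) ℓ)
split-QF (dv d ℓ) σ = Split-cong
  (λ κ → cong (λ z → does (suc d ℕD.∣? ∣ z ∣)) (trans (proj₂ (subst-aff 0 (form σ) ℓ) κ (fun σ κ) (Rel-form σ κ)) (ℤP.*-identityˡ _)))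
  (split-dv _ d (cst ℓ') (lin ℓ') ℕP.≤-refl)
  where
  ℓ' = proj₁ (subst-aff 0 (form σ) ℓ)
split-QF (neg φ)   σ = Split-not (split-QF φ σ)
split-QF (and φ ψ) σ = Split-bind (split-QF φ σ) λ where
  τ false h → constant false (λ κ → cong (_∧ ev ψ (fun σ (fun τ κ))) (h κ))
  τ true  h → Split-cong (λ κ → cong (_∧ ev ψ (fun σ (fun τ κ))) (sym (h κ))) (split-QF ψ (σ ⊙ τ))

-- Decomposition into fundamental lattices

record Piece (n : ℕ) (Good : ∀ {m} → Patch m n → Set) : Set where
  constructor piece
  field
    {params} : ℕ
    chart    : Patch params n
    good     : Good chart

Image : ∀ {m n} → Patch m n → Vec ℕ n → Set
Image σ x = ∃ λ κ → fun σ κ ≡ x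

module Decomposition {n} (Good : ∀ {m} → Patch m n → Set) where

  _∈P_ : Vec ℕ n → Piece n Good → Set
  x ∈P p = Image (Piece.chart p) x

  Disjoint : Piece n Good → Piece n Good → Set
  Disjoint p q = ∀ x → x ∈P p → x ∈P q → ⊥

  -- `within` keeps pieces from different parts disjoint when decompositions of disjoint sets are
  -- concatenated.
  record Decomp (S : Vec ℕ n → Set) : Set where
    field
      pieces   : List (Piece n Good)
      covers   : ∀ x → S x → Any (x ∈P_) pieces
      within   : ∀ x → Any (x ∈P_) pieces → S x
      disjoint : AllPairs Disjoint pieces
  open Decomp public

  Decomp-⇔ : ∀ {S S' : Vec ℕ n → Set} → (∀ x → S x → S' x) → (∀ x → S' x → S x) → Decomp S → Decomp S'
  Decomp-⇔ to from D = record
    { pieces = pieces D ; covers = λ x s → covers D x (from x s) ; within = λ x a → to x (within D x a) ; disjoint = disjoint D }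

  Decomp-patch : ∀ {m} (σ : Patch m n) → Good σ → Decomp (Image σ)
  Decomp-patch σ g = record
    { pieces = piece σ g ∷ [] ; covers = λ x → here ; within = λ { x (here i) → i } ; disjoint = [] ∷ [] }

  Decomp-⋃ : ∀ r (S : Fin r → Vec ℕ n → Set) → (∀ t t' x → S t x → S t' x → t ≡ t') →
    (∀ t → Decomp (S t)) → Decomp (λ x → ∃ λ t → S t x)
  Decomp-⋃ zero    S dis D = record { pieces = [] ; covers = λ { x (() , _) } ; within = λ { x () } ; disjoint = [] }
  Decomp-⋃ (suc r) S dis D = record
    { pieces   = pieces D₀ L.++ pieces Ds
    ; covers   = λ { x (zero , s) → AnyP.++⁺ˡ (covers D₀ x s) ; x (suc t , s) → AnyP.++⁺ʳ (pieces D₀) (covers Ds x (t , s)) }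
    ; within   = λ x a → sound x (AnyP.++⁻ (pieces D₀) a)
    ; disjoint = AllPairsP.++⁺ (disjoint D₀) (disjoint Ds) (All.tabulate λ p∈ → All.tabulate λ q∈ x xp xq → apart p∈ q∈ x xp xq)
    }
    where
    D₀ = D zero
    Ds = Decomp-⋃ r (S ∘ suc) (λ t t' x s s' → suc-inj (dis (suc t) (suc t') x s s')) (D ∘ suc)
      where
      suc-inj : ∀ {t t' : Fin r} → Fin.suc t ≡ suc t' → t ≡ t'
      suc-inj refl = refl
    sound : ∀ x → Any (x ∈P_) (pieces D₀) ⊎ Any (x ∈P_) (pieces Ds) → ∃ λ t → S t x
    sound x (inj₁ a) = zero , within D₀ x a
    sound x (inj₂ a) = let (t , s) = within Ds x a in suc t , s
    apart : ∀ {p q} → p ∈ pieces D₀ → q ∈ pieces Ds → Disjoint p q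
    apart p∈ q∈ x xp xq with within Ds x (lose q∈ xq)
    ... | t , s with dis zero (suc t) x (within D₀ x (lose p∈ xp)) s
    ...   | ()

  -- The tree partitions the parameters; injectivity of `σ` makes the images of its branches
  -- disjoint as well. The continuation `k` decomposes the leaves.
  Decomp-Split : ∀ {m} {b : Vec ℕ m → Bool} → Split b → (σ : Patch m n) →
    (∀ {l} (τ : Patch l m) c → (∀ κ → b (fun τ κ) ≡ c) → Decomp (Image (σ ⊙ τ))) → Decomp (Image σ)
  Decomp-Split (constant c h) σ k = k idPatch c h
  Decomp-Split (split r ms τ cover dis s) σ k = Decomp-⇔
    (λ { x (t , κ , e) → fun (τ t) κ , e })
    (λ { x (κ , e) → let (t , κ' , e') = cover κ in t , κ' , trans (cong (fun σ) e') e })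
    (Decomp-⋃ r (λ t → Image (σ ⊙ τ t))
      (λ { t t' x (κ , e) (κ' , e') → dis t t' κ κ' (inj σ (trans e (sym e'))) })
      (λ t → Decomp-Split (s t) (σ ⊙ τ t) (λ τ' c h → k (τ t ⊙ τ') c h)))

  -- Every gate is split on the patches left by the preceding ones. In continuation style the finest
  -- patches come last, each with the sum of the polynomials whose gates are open there.
  Decomp-PP : ∀ {d} (g : PP n d) {m} (σ : Patch m n) →
    (∀ {l} (τ : Patch l m) → (∃ λ (p : Pol n d) → ∀ κ → evPP g (fun σ (fun τ κ)) ≡ evP p (fun σ (fun τ κ))) → Decomp (Image (σ ⊙ τ))) →
    Decomp (Image σ)
  Decomp-PP {d} [] σ k = k idPatch (zeroP , λ κ → sym (evP-zeroP d (fun σ κ)))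
  Decomp-PP ((φ , p) ∷ g) σ k = Decomp-Split (split-QF φ σ) σ λ
    { τ true  h → Decomp-PP g (σ ⊙ τ) λ { τ' (q , e) → k (τ ⊙ τ') (add p q ,
        λ κ → cong₂ ℚ._+_ (cong (λ b → gate b (evP p (fun σ (fun τ (fun τ' κ))))) (h (fun τ' κ))) (e κ)) }
    ; τ false h → Decomp-PP g (σ ⊙ τ) λ { τ' (q , e) → k (τ ⊙ τ') (q ,
        λ κ → trans (cong (λ b → gate b (evP p (fun σ (fun τ (fun τ' κ)))) ℚ.+ evPP g (fun σ (fun τ (fun τ' κ)))) (h (fun τ' κ)))
                (trans (ℚP.+-identityˡ (evPP g (fun σ (fun τ (fun τ' κ))))) (e κ))) }
    }

-- Linear independence of the generators

clear : (a : ℚ) → ℤ→ℚ (+ suc (ℚ.denominator-1 a)) ℚ.* a ≡ ℤ→ℚ (ℚ.numerator a)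
clear a@(ℚ.mkℚ n d c) = ℚP.toℚᵘ-injective (ℚᵘP.≃-trans (ℚP.toℚᵘ-homo-* (ℤ→ℚ (+ suc d)) a)
  (ℚᵘP.≃-trans (ℚᵘP.*-congʳ (ℤ→ℚ≃ (+ suc d))) (ℚᵘP.≃-trans (ℚᵘ.*≡* lemma') (ℚᵘP.≃-sym (ℤ→ℚ≃ n)))))
  where
  lemma : ∀ s n → s ℤ.* n ℤ.* + 1 ≡ n ℤ.* s
  lemma = solve-∀
  lemma' : + suc d ℤ.* n ℤ.* + 1 ≡ n ℤ.* + (1 ℕ.* suc d)
  lemma' = trans (lemma (+ suc d) n) (cong (λ k → n ℤ.* + k) (sym (ℕP.*-identityˡ (suc d))))

common-denominator : ∀ {m} (a : Fin m → ℚ) → ∃ λ D → Σ (Fin m → ℤ) λ z → ∀ i → ℤ→ℚ (z i) ≡ ℤ→ℚ (+ suc D) ℚ.* a i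
common-denominator {zero}  a = 0 , (λ ()) , λ ()
common-denominator {suc m} a with common-denominator (a ∘ suc)
... | D , z , h = D ℕ.+ d ℕ.* suc D , z' , h'
  where
  d = ℚ.denominator-1 (a zero)
  z' : Fin (suc m) → ℤ
  z' zero    = + suc D ℤ.* ℚ.numerator (a zero)
  z' (suc i) = + suc d ℤ.* z i
  D' : ℤ→ℚ (+ suc (D ℕ.+ d ℕ.* suc D)) ≡ ℤ→ℚ (+ suc d) ℚ.* ℤ→ℚ (+ suc D)
  D' = trans (cong ℤ→ℚ (ℤP.pos-* (suc d) (suc D))) (ℤ→ℚ-* (+ suc d) (+ suc D))
  swap : ∀ x y a → x ℚ.* (y ℚ.* a) ≡ y ℚ.* x ℚ.* a
  swap = Solver.solve-∀ ℚ-ring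
  h' : ∀ i → ℤ→ℚ (z' i) ≡ ℤ→ℚ (+ suc (D ℕ.+ d ℕ.* suc D)) ℚ.* a i
  h' zero = trans (ℤ→ℚ-* (+ suc D) (ℚ.numerator (a zero))) (trans (cong (ℤ→ℚ (+ suc D) ℚ.*_) (sym (clear (a zero))))
    (trans (swap (ℤ→ℚ (+ suc D)) (ℤ→ℚ (+ suc d)) (a zero)) (cong (ℚ._* a zero) (sym D'))))
  h' (suc i) = trans (ℤ→ℚ-* (+ suc d) (z i)) (trans (cong (ℤ→ℚ (+ suc d) ℚ.*_) (h i))
    (trans (sym (ℚP.*-assoc (ℤ→ℚ (+ suc d)) (ℤ→ℚ (+ suc D)) (a (suc i)))) (cong (ℚ._* a (suc i)) (sym D'))))

posPart negPart : ℤ → ℕ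
posPart (+ n)    = n
posPart -[1+ n ] = 0
negPart (+ n)    = 0
negPart -[1+ n ] = suc n

pos-neg : ∀ z → + posPart z ℤ.- + negPart z ≡ z
pos-neg (+ n)    = ℤP.+-identityʳ (+ n)
pos-neg -[1+ n ] = ℤP.+-identityˡ -[1+ n ]

dot-tabulate : ∀ {m} (as : Vec ℤ m) (κ : Fin m → ℕ) → dot as (tabulate κ) ≡ sumℤ (λ i → + κ i ℤ.* lookup as i)
dot-tabulate []       κ = refl
dot-tabulate (a ∷ as) κ = cong₂ ℤ._+_ (ℤP.*-comm a (+ κ zero)) (dot-tabulate as (κ ∘ suc))

dot-parts : ∀ {m} (as : Vec ℤ m) (z : Fin m → ℤ) →
  dot as (tabulate (posPart ∘ z)) ℤ.- dot as (tabulate (negPart ∘ z)) ≡ sumℤ (λ i → z i ℤ.* lookup as i)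
dot-parts []       z = refl
dot-parts (a ∷ as) z = trans (lemma a (+ posPart (z zero)) (+ negPart (z zero)) (dot as (tabulate (posPart ∘ z ∘ suc))) (dot as (tabulate (negPart ∘ z ∘ suc))))
  (cong₂ ℤ._+_ (cong (ℤ._* a) (pos-neg (z zero))) (dot-parts as (z ∘ suc)))
  where
  lemma : ∀ a p n u v → a ℤ.* p ℤ.+ u ℤ.- (a ℤ.* n ℤ.+ v) ≡ (p ℤ.- n) ℤ.* a ℤ.+ (u ℤ.- v)
  lemma = solve-∀

ℤ→ℚ-combination : ∀ {m} q (a : Fin m → ℚ) (z p : Fin m → ℤ) → (∀ i → ℤ→ℚ (z i) ≡ q ℚ.* a i) →
  ℤ→ℚ (sumℤ (λ i → z i ℤ.* p i)) ≡ q ℚ.* sumℚ (λ i → a i ℚ.* ℤ→ℚ (p i))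
ℤ→ℚ-combination {zero}  q a z p h = sym (ℚP.*-zeroʳ q)
ℤ→ℚ-combination {suc m} q a z p h = trans (ℤ→ℚ-+ (z zero ℤ.* p zero) (sumℤ (λ i → z (suc i) ℤ.* p (suc i))))
  (trans (cong₂ ℚ._+_ (trans (ℤ→ℚ-* (z zero) (p zero)) (trans (cong (ℚ._* ℤ→ℚ (p zero)) (h zero)) (ℚP.*-assoc q (a zero) (ℤ→ℚ (p zero)))))
                      (ℤ→ℚ-combination q (a ∘ suc) (z ∘ suc) (p ∘ suc) (h ∘ suc)))
    (sym (ℚP.*-distribˡ-+ q (a zero ℚ.* ℤ→ℚ (p zero)) (sumℚ (λ i → a (suc i) ℚ.* ℤ→ℚ (p (suc i)))))))

-- A rational relation between the columns becomes, after clearing denominators and separating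
-- signs, an equality between two values of the injective map.
patch-indep : ∀ {m n} (σ : Patch m n) → LinIndep {n} {m} (λ i j → lookup (lin (form σ j)) i)
patch-indep {m} {n} σ a rel i with common-denominator a
... | D , z , h = trans (sym (ℚP.*-identityˡ (a i))) (trans (cong (ℚ._* a i) (sym (proj₂ r)))
    (trans (ℚP.*-assoc (proj₁ r) (ℤ→ℚ (+ suc D)) (a i)) (trans (cong (proj₁ r ℚ.*_) (trans (sym (h i)) (cong ℤ→ℚ z≡0))) (ℚP.*-zeroʳ (proj₁ r)))))
  where
  r = ℤ→ℚ-inverse (+ suc D) (λ ())
  κ = tabulate (posPart ∘ z)
  κ' = tabulate (negPart ∘ z)
  zero-combination : ∀ j → sumℤ (λ i → z i ℤ.* lookup (lin (form σ j)) i) ≡ + 0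
  zero-combination j = ℤ→ℚ-injective (sumℤ (λ i → z i ℤ.* lookup (lin (form σ j)) i)) (+ 0) (trans (ℤ→ℚ-combination (ℤ→ℚ (+ suc D)) a z (lookup (lin (form σ j))) h)
    (trans (cong (ℤ→ℚ (+ suc D) ℚ.*_) (rel j)) (ℚP.*-zeroʳ (ℤ→ℚ (+ suc D)))))
  same : fun σ κ ≡ fun σ κ'
  same = lookup-ext λ j → ℤP.+-injective (trans (sym (val-form σ κ j))
    (trans (cong (λ u → cst (form σ j) ℤ.+ u) (ℤP.i-j≡0⇒i≡j _ _ (trans (dot-parts (lin (form σ j)) z) (zero-combination j)))) (val-form σ κ' j)))
  parts : posPart (z i) ≡ negPart (z i)
  parts = trans (sym (VecP.lookup∘tabulate (posPart ∘ z) i)) (trans (cong (λ v → lookup v i) (inj σ same)) (VecP.lookup∘tabulate (negPart ∘ z) i))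
  z≡0 : z i ≡ + 0
  z≡0 = trans (sym (pos-neg (z i))) (trans (cong (λ u → + u ℤ.- + negPart (z i)) parts) (ℤP.+-inverseʳ (+ negPart (z i))))

toLattice : ∀ {m n} → Patch m n → FundLattice n
toLattice {m} σ = record
  { dim = m ; base = cst ∘ form σ ; gens = λ i j → lookup (lin (form σ j)) i ; indep = patch-indep σ }

point-toLattice : ∀ {m n} (σ : Patch m n) (κ : Fin m → ℕ) j → point (toLattice σ) κ j ≡ + lookup (fun σ (tabulate κ)) j
point-toLattice σ κ j = trans (cong (λ u → cst (form σ j) ℤ.+ u) (sym (dot-tabulate (lin (form σ j)) κ))) (val-form σ (tabulate κ) j)

∈L⇒Image : ∀ {m n} (σ : Patch m n) x → x ∈L toLattice σ → Image σ (tabulate x)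
∈L⇒Image σ x (κ , e) = tabulate κ , lookup-ext λ j →
  trans (ℤP.+-injective (trans (sym (point-toLattice σ κ j)) (e j))) (sym (VecP.lookup∘tabulate x j))

Image⇒∈L : ∀ {m n} (σ : Patch m n) x → Image σ (tabulate x) → x ∈L toLattice σ
Image⇒∈L σ x (κ , e) = lookup κ , λ j → trans (point-toLattice σ (lookup κ) j)
  (cong +_ (trans (cong (λ v → lookup (fun σ v) j) (VecP.tabulate∘lookup κ)) (trans (cong (λ v → lookup v j) e) (VecP.lookup∘tabulate x j))))

AllPairs-lookup : ∀ {A : Set} {R : A → A → Set} {xs : List A} → AllPairs R xs → ∀ i j →
  i ≡ j ⊎ R (L.lookup xs i) (L.lookup xs j) ⊎ R (L.lookup xs j) (L.lookup xs i)
AllPairs-lookup (r ∷ rs) zero    zero    = inj₁ refl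
AllPairs-lookup (r ∷ rs) zero    (suc j) = inj₂ (inj₁ (All.lookup r (∈P.∈-lookup j)))
AllPairs-lookup (r ∷ rs) (suc i) zero    = inj₂ (inj₂ (All.lookup r (∈P.∈-lookup i)))
AllPairs-lookup (r ∷ rs) (suc i) (suc j) with AllPairs-lookup rs i j
... | inj₁ e = inj₁ (cong suc e)
... | inj₂ s = inj₂ s

-- Expansion into monomials

scalePoly : ∀ {n} → ℚ → Poly n → Poly n
scalePoly r []            = []
scalePoly r ((c , e) ∷ P) = (r ℚ.* c , e) ∷ scalePoly r P

evalPoly-scale : ∀ {n} r (P : Poly n) x → evalPoly (scalePoly r P) x ≡ r ℚ.* evalPoly P x
evalPoly-scale r []            x = sym (ℚP.*-zeroʳ r)
evalPoly-scale r ((c , e) ∷ P) x = trans (cong₂ ℚ._+_ (ℚP.*-assoc r c (prodℚ (λ j → ℕ→ℚ (x j ℕ.^ e j)))) (evalPoly-scale r P x))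
  (sym (ℚP.*-distribˡ-+ r (evalMono (c , e) x) (evalPoly P x)))

DegLe-scale : ∀ {n d} r (P : Poly n) → DegLe d P → DegLe d (scalePoly r P)
DegLe-scale r []      []       = []
DegLe-scale r (m ∷ P) (h ∷ hs) = h ∷ DegLe-scale r P hs

evalPoly-++ : ∀ {n} (P Q : Poly n) x → evalPoly (P L.++ Q) x ≡ evalPoly P x ℚ.+ evalPoly Q x
evalPoly-++ []      Q x = sym (ℚP.+-identityˡ _)
evalPoly-++ (m ∷ P) Q x = trans (cong (evalMono m x ℚ.+_) (evalPoly-++ P Q x)) (sym (ℚP.+-assoc (evalMono m x) (evalPoly P x) (evalPoly Q x)))

bump : ∀ {n} → Fin n → Poly n → Poly n
bump i []            = []
bump i ((c , e) ∷ P) = (c , VF.updateAt e i suc) ∷ bump i P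

prodℚ-bump : ∀ {n} (e : Vector ℕ n) i (x : Vector ℕ n) →
  prodℚ (λ j → ℕ→ℚ (x j ℕ.^ VF.updateAt e i suc j)) ≡ ℕ→ℚ (x i) ℚ.* prodℚ (λ j → ℕ→ℚ (x j ℕ.^ e j))
prodℚ-bump {suc n} e zero    x = trans (cong (ℚ._* rest) (trans (cong ℤ→ℚ (ℤP.pos-* (x zero) (x zero ℕ.^ e zero))) (ℤ→ℚ-* (+ x zero) (+ (x zero ℕ.^ e zero)))))
  (ℚP.*-assoc (ℕ→ℚ (x zero)) (ℕ→ℚ (x zero ℕ.^ e zero)) rest)
  where
  rest = prodℚ (λ j → ℕ→ℚ (x (suc j) ℕ.^ e (suc j)))
prodℚ-bump {suc n} e (suc i) x = trans (cong (ℕ→ℚ (x zero ℕ.^ e zero) ℚ.*_) (prodℚ-bump (e ∘ suc) i (x ∘ suc)))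
  (swap (ℕ→ℚ (x zero ℕ.^ e zero)) (ℕ→ℚ (x (suc i))) (prodℚ (λ j → ℕ→ℚ (x (suc j) ℕ.^ e (suc j)))))
  where
  swap : ∀ a b c → a ℚ.* (b ℚ.* c) ≡ b ℚ.* (a ℚ.* c)
  swap = Solver.solve-∀ ℚ-ring

evalPoly-bump : ∀ {n} i (P : Poly n) x → evalPoly (bump i P) x ≡ ℕ→ℚ (x i) ℚ.* evalPoly P x
evalPoly-bump i []            x = sym (ℚP.*-zeroʳ (ℕ→ℚ (x i)))
evalPoly-bump i ((c , e) ∷ P) x = trans (cong₂ (λ u v → c ℚ.* u ℚ.+ v) (prodℚ-bump e i x) (evalPoly-bump i P x))
  (lemma c (ℕ→ℚ (x i)) (prodℚ (λ j → ℕ→ℚ (x j ℕ.^ e j))) (evalPoly P x))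
  where
  lemma : ∀ c a b p → c ℚ.* (a ℚ.* b) ℚ.+ a ℚ.* p ≡ a ℚ.* (c ℚ.* b ℚ.+ p)
  lemma = Solver.solve-∀ ℚ-ring

sumℕ-bump : ∀ {n} (e : Vector ℕ n) i → sumℕ (VF.updateAt e i suc) ≡ suc (sumℕ e)
sumℕ-bump {suc n} e zero    = refl
sumℕ-bump {suc n} e (suc i) = trans (cong (e zero ℕ.+_) (sumℕ-bump (e ∘ suc) i)) (ℕP.+-suc (e zero) _)

DegLe-bump : ∀ {n d} i (P : Poly n) → DegLe d P → DegLe (suc d) (bump i P)
DegLe-bump i []            []       = []
DegLe-bump i ((c , e) ∷ P) (h ∷ hs) = subst (ℕ._≤ _) (sym (sumℕ-bump e i)) (ℕ.s≤s h) ∷ DegLe-bump i P hs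

-- Multiplication by a linear form. The recursion consumes the coefficients while the polynomial
-- keeps all its variables; `ι` remembers which variable each remaining coefficient belongs to.
linPoly : ∀ {m n} → Vec ℤ m → (Fin m → Fin n) → Poly n → Poly n
linPoly []       ι P = []
linPoly (a ∷ as) ι P = scalePoly (ℤ→ℚ a) (bump (ι zero) P) L.++ linPoly as (ι ∘ suc) P

evalPoly-lin : ∀ {m n} (as : Vec ℤ m) (ι : Fin m → Fin n) P x →
  evalPoly (linPoly as ι P) x ≡ ℤ→ℚ (dot as (tabulate (x ∘ ι))) ℚ.* evalPoly P x
evalPoly-lin []       ι P x = sym (ℚP.*-zeroˡ (evalPoly P x))
evalPoly-lin (a ∷ as) ι P x = begin
  evalPoly (scalePoly (ℤ→ℚ a) (bump (ι zero) P) L.++ linPoly as (ι ∘ suc) P) x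
    ≡⟨ trans (evalPoly-++ (scalePoly (ℤ→ℚ a) (bump (ι zero) P)) (linPoly as (ι ∘ suc) P) x)
         (cong₂ ℚ._+_ (trans (evalPoly-scale (ℤ→ℚ a) (bump (ι zero) P) x) (cong (ℤ→ℚ a ℚ.*_) (evalPoly-bump (ι zero) P x))) (evalPoly-lin as (ι ∘ suc) P x)) ⟩
  ℤ→ℚ a ℚ.* (ℕ→ℚ (x (ι zero)) ℚ.* p) ℚ.+ ℤ→ℚ d ℚ.* p    ≡⟨ lemma (ℤ→ℚ a) (ℕ→ℚ (x (ι zero))) p (ℤ→ℚ d) ⟩
  (ℤ→ℚ a ℚ.* ℕ→ℚ (x (ι zero)) ℚ.+ ℤ→ℚ d) ℚ.* p          ≡⟨ cong (ℚ._* p) (sym (trans (ℤ→ℚ-+ (a ℤ.* + x (ι zero)) d) (cong (ℚ._+ ℤ→ℚ d) (ℤ→ℚ-* a (+ x (ι zero)))))) ⟩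
  ℤ→ℚ (a ℤ.* + x (ι zero) ℤ.+ d) ℚ.* p ∎
  where
  open ≡-Reasoning
  p = evalPoly P x
  d = dot as (tabulate (x ∘ ι ∘ suc))
  lemma : ∀ a y p d → a ℚ.* (y ℚ.* p) ℚ.+ d ℚ.* p ≡ (a ℚ.* y ℚ.+ d) ℚ.* p
  lemma = Solver.solve-∀ ℚ-ring

DegLe-lin : ∀ {m n d} (as : Vec ℤ m) (ι : Fin m → Fin n) P → DegLe d P → DegLe (suc d) (linPoly as ι P)
DegLe-lin []       ι P h = []
DegLe-lin (a ∷ as) ι P h = AllP.++⁺ (DegLe-scale (ℤ→ℚ a) (bump (ι zero) P) (DegLe-bump (ι zero) P h)) (DegLe-lin as (ι ∘ suc) P h)

toPoly : ∀ {n d} → Pol n d → Poly n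
toPoly one         = (1ℚ , λ _ → 0) ∷ []
toPoly (add p q)   = toPoly p L.++ toPoly q
toPoly (scale r p) = scalePoly r (toPoly p)
toPoly (mul ℓ p)   = scalePoly (ℤ→ℚ (cst ℓ)) (toPoly p) L.++ linPoly (lin ℓ) (λ i → i) (toPoly p)
toPoly (wk p)      = toPoly p

prodℚ-1 : ∀ n → prodℚ {n} (λ _ → 1ℚ) ≡ 1ℚ
prodℚ-1 zero    = refl
prodℚ-1 (suc n) = trans (ℚP.*-identityˡ (prodℚ {n} (λ _ → 1ℚ))) (prodℚ-1 n)

evalPoly-toPoly : ∀ {n d} (p : Pol n d) x → evalPoly (toPoly p) x ≡ evP p (tabulate x)
evalPoly-toPoly {n} one         x = trans (ℚP.+-identityʳ (1ℚ ℚ.* prodℚ {n} (λ _ → 1ℚ))) (trans (ℚP.*-identityˡ (prodℚ {n} (λ _ → 1ℚ))) (prodℚ-1 n))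
evalPoly-toPoly (add p q)   x = trans (evalPoly-++ (toPoly p) (toPoly q) x) (cong₂ ℚ._+_ (evalPoly-toPoly p x) (evalPoly-toPoly q x))
evalPoly-toPoly (scale r p) x = trans (evalPoly-scale r (toPoly p) x) (cong (r ℚ.*_) (evalPoly-toPoly p x))
evalPoly-toPoly (wk p)      x = evalPoly-toPoly p x
evalPoly-toPoly (mul ℓ p)   x = trans (evalPoly-++ (scalePoly (ℤ→ℚ (cst ℓ)) (toPoly p)) (linPoly (lin ℓ) (λ i → i) (toPoly p)) x)
  (trans (cong₂ ℚ._+_ (evalPoly-scale (ℤ→ℚ (cst ℓ)) (toPoly p) x) (evalPoly-lin (lin ℓ) (λ i → i) (toPoly p) x))
  (trans (sym (ℚP.*-distribʳ-+ (evalPoly (toPoly p) x) (ℤ→ℚ (cst ℓ)) (ℤ→ℚ (dot (lin ℓ) (tabulate x)))))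
    (cong₂ ℚ._*_ (sym (ℤ→ℚ-+ (cst ℓ) (dot (lin ℓ) (tabulate x)))) (evalPoly-toPoly p x))))

DegLe-suc : ∀ {n d} (P : Poly n) → DegLe d P → DegLe (suc d) P
DegLe-suc []      []       = []
DegLe-suc (m ∷ P) (h ∷ hs) = ℕP.m≤n⇒m≤1+n h ∷ DegLe-suc P hs

sumℕ-0 : ∀ n → sumℕ {n} (λ _ → 0) ≡ 0
sumℕ-0 zero    = refl
sumℕ-0 (suc n) = sumℕ-0 n

DegLe-toPoly : ∀ {n d} (p : Pol n d) → DegLe d (toPoly p)
DegLe-toPoly {n} one     = ℕP.≤-reflexive (sumℕ-0 n) ∷ []
DegLe-toPoly (add p q)   = AllP.++⁺ (DegLe-toPoly p) (DegLe-toPoly q)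
DegLe-toPoly (scale r p) = DegLe-scale r (toPoly p) (DegLe-toPoly p)
DegLe-toPoly (mul ℓ p)   = AllP.++⁺ (DegLe-scale (ℤ→ℚ (cst ℓ)) (toPoly p) (DegLe-suc (toPoly p) (DegLe-toPoly p)))
                             (DegLe-lin (lin ℓ) (λ i → i) (toPoly p) (DegLe-toPoly p))
DegLe-toPoly (wk p)      = DegLe-suc (toPoly p) (DegLe-toPoly p)

PP⇒PiecewisePoly : ∀ {n d} (g : PP n d) (f : Vector ℕ n → ℕ) → (∀ x → evPP g (tabulate x) ≡ ℕ→ℚ (f x)) → PiecewisePoly n d f
PP⇒PiecewisePoly {n} {d} g f g≡f = length L₀ , lattice ,
  (λ j κ i → subst (+ 0 ℤ.≤_) (sym (point-toLattice (chartAt j) κ i)) (ℤ.+≤+ ℕ.z≤n)) ,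
  (λ x → let a = covers D (tabulate x) (tabulate x , refl) in Any.index a , Image⇒∈L (chartAt (Any.index a)) x (AnyP.lookup-index a)) ,
  unique ,
  λ j → let (p , h) = Piece.good (L.lookup L₀ j) in toPoly p , DegLe-toPoly p , λ x x∈ →
    let (κ , e) = ∈L⇒Image (chartAt j) x x∈ in
    trans (evalPoly-toPoly p x) (trans (cong (evP p) (sym e)) (trans (sym (h κ)) (trans (cong (evPP g) e) (g≡f x))))
  where
  Good : ∀ {m} → Patch m n → Set
  Good σ = ∃ λ (p : Pol n d) → ∀ κ → evPP g (fun σ κ) ≡ evP p (fun σ κ)
  open Decomposition {n} Good
  D : Decomp (Image idPatch)
  D = Decomp-PP g idPatch (λ τ h → Decomp-patch (idPatch ⊙ τ) h)
  L₀ = pieces D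
  chartAt : ∀ j → Patch (Piece.params (L.lookup L₀ j)) n
  chartAt j = Piece.chart (L.lookup L₀ j)
  lattice : Fin (length L₀) → FundLattice n
  lattice j = toLattice (chartAt j)
  unique : ∀ x j j' → x ∈L lattice j → x ∈L lattice j' → j ≡ j'
  unique x j j' x∈ x∈' with AllPairs-lookup (disjoint D) j j'
  ... | inj₁ e        = e
  ... | inj₂ (inj₁ r) = contradiction (∈L⇒Image (chartAt j') x x∈') (r (tabulate x) (∈L⇒Image (chartAt j) x x∈))
  ... | inj₂ (inj₂ r) = contradiction (∈L⇒Image (chartAt j) x x∈) (r (tabulate x) (∈L⇒Image (chartAt j') x x∈'))

-- The order isomorphism

lookup-++ : ∀ {m n} {x : Vector ℕ m} {y : Vector ℕ n} (v : Vec ℕ m) (w : Vec ℕ n) → (∀ i → x i ≡ lookup v i) → (∀ i → y i ≡ lookup w i) →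
  ∀ i → (x VF.++ y) i ≡ lookup (v ++ w) i
lookup-++ {m} v w e e' i rewrite VecP.lookup-splitAt m v w i with F.splitAt m i
... | inj₁ j = e j
... | inj₂ j = e' j

theorem15 : (n : ℕ) (_≺_ : Vector ℕ n → Vector ℕ n → Set) →
    Definable n _≺_ →
    (f : Vector ℕ n → ℕ) → Bijective _≡_ _≡_ f →
    (∀ x y → (x ≺ y → f x < f y) × (f x < f y → x ≺ y)) →
    PiecewisePoly n n f
theorem15 n _≺_ (φ , def) f (f-inj , f-surj) order with presburger φ
... | ψ , ψ-spec = PP⇒PiecewisePoly (proj₁ g) f λ x → trans (proj₂ g (tabulate x)) (cong ℕ→ℚ (f-cong (VecP.lookup∘tabulate x)))
  where
  -- Without function extensionality, f must be shown to respect pointwise equality; formulas do.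
  ≺-resp : ∀ {x x' y y'} → (∀ i → x i ≡ x' i) → (∀ i → y i ≡ y' i) → x ≺ y → x' ≺ y'
  ≺-resp {x} {x'} {y} {y'} ex ey x≺y = proj₁ (def x' y') (Equivalence.from (ψ-spec (x' VF.++ y') v
      (lookup-++ (tabulate x) (tabulate y) (λ i → trans (sym (ex i)) (tab x i)) (λ i → trans (sym (ey i)) (tab y i))))
    (Equivalence.to (ψ-spec (x VF.++ y) v (lookup-++ (tabulate x) (tabulate y) (tab x) (tab y))) (proj₂ (def x y) x≺y)))
    where
    v = tabulate x ++ tabulate y
    tab : ∀ (x : Vector ℕ n) i → x i ≡ lookup (tabulate x) i
    tab x i = sym (VecP.lookup∘tabulate x i)
  f-cong : ∀ {x y} → (∀ i → x i ≡ y i) → f x ≡ f y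
  f-cong {x} {y} e with ℕP.<-cmp (f x) (f y)
  ... | tri≈ _ eq _ = eq
  ... | tri< lt _ _ = contradiction (proj₁ (order x x) (≺-resp (λ _ → refl) (sym ∘ e) (proj₂ (order x y) lt))) (ℕP.<-irrefl refl)
  ... | tri> _ _ gt = contradiction (proj₁ (order x x) (≺-resp (sym ∘ e) (λ _ → refl) (proj₂ (order y x) gt))) (ℕP.<-irrefl refl)
  rank : Vec ℕ n → ℕ
  rank v = f (lookup v)
  unrank : ℕ → Vec ℕ n
  unrank v = tabulate (proj₁ (f-surj v))
  rank∘unrank : ∀ v → rank (unrank v) ≡ v
  rank∘unrank v = trans (f-cong (VecP.lookup∘tabulate (proj₁ (f-surj v)))) (proj₂ (f-surj v) refl)
  unrank∘rank : ∀ y → unrank (rank y) ≡ y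
  -- Injectivity of `f` yields a genuine equality of functions, so no extensionality is involved.
  unrank∘rank y = trans (cong tabulate (f-inj (proj₂ (f-surj (rank y)) refl))) (VecP.tabulate∘lookup y)
  ψ-correct : ∀ y x → (ev ψ (y ++ x) ≡ true) ⇔ (rank y < rank x)
  ψ-correct y x = mk⇔
    (λ t → proj₁ (order (lookup y) (lookup x)) (proj₁ (def (lookup y) (lookup x)) (Equivalence.from spec t)))
    (λ lt → Equivalence.to spec (proj₂ (def (lookup y) (lookup x)) (proj₂ (order (lookup y) (lookup x)) lt)))
    where
    spec = ψ-spec (lookup y VF.++ lookup x) (y ++ x) (lookup-++ y x (λ _ → refl) (λ _ → refl))
  g = rank-as-PP rank unrank rank∘unrank unrank∘rank ψ ψ-correct
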